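{- $\mathbf{FQSym}^{(\ell)}$, endowed with the coproduct $\Delta f(\boldsymbol{A})=f(\boldsymbol{A}'\oplus\boldsymbol{A}'')$, is a graded connected bialgebra; hence it is a Hopf algebra. The coproduct is given by $$\Delta\mathbf{G}_{\sigma,u}=\sum_{\substack{(\sigma',u'),(\sigma'',u'')\\ (\sigma,u)\in(\sigma',u')\Cup(\sigma'',u'')}}\mathbf{G}_{\sigma',u'}\otimes\mathbf{G}_{\sigma'',u''}$$ for every colored permutation $(\sigma,u)$, the sum being over pairs of colored permutations (including the empty one).
   Context: Let $C$ be a set of $\ell$ colors, $A=\{1<2<3<\cdots\}$, and $\boldsymbol{A}=A\times C$. A word of length $n$ over $\boldsymbol{A}$ is written $(v,u)$ with $v\in A^n$, $u\in C^n$. $\mathrm{Std}(v)\in\mathfrak{S}_n$ denotes the standardization of $v$ (the permutation having the same inversions as $v$); it makes sense over any totally ordered alphabet. Put $\mathbf{Std}(v,u)=(\mathrm{Std}(v),u)$. A colored permutation of size $n$ is a pair $(\sigma,u)$ with $\sigma\in\mathfrak{S}_n$, $u\in C^n$, and $$\mathbf{G}_{\sigma,u}=\mathbf{G}_{\sigma,u}(\boldsymbol{A})=\sum_{w\in\boldsymbol{A}^n,\ \mathbf{Std}(w)=(\sigma,u)}w$$ (infinite formal sums of words of bounded degree are allowed). $\mathbf{FQSym}^{(\ell)}$ is the algebra spanned by all the $\mathbf{G}_{\sigma,u}$, graded by size. Coproduct: let $A',A''$ be two isomorphic copies of the ordered set $A$, let $A'\oplus A''$ be their ordered sum (every element of $A'$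 is smaller than every element of $A''$), and let $\boldsymbol{A}'\oplus\boldsymbol{A}''=(A'\oplus A'')\times C$. Assuming that the letters of $\boldsymbol{A}'=A'\times C$ commute with those of $\boldsymbol{A}''=A''\times C$, identify $f(\boldsymbol{A}')g(\boldsymbol{A}'')$ with $f\otimes g$ and set $\Delta f(\boldsymbol{A})=f(\boldsymbol{A}'\oplus\boldsymbol{A}'')$. Shifted shuffle: for a colored word $(v,u)$ and integer $k$, $(v,u)[k]$ is obtained by adding $k$ to every letter of $v$, keeping colors. The shifted shuffle $(\sigma',u')\Cup(\sigma'',u'')$ is the ordinary shuffle of the words of biletters $(\sigma',u')$ and $(\sigma'',u'')[k]$, where $k$ is the length of $\sigma'$ (each color follows the letter to which it is attached). -}

module Defs where

open import Algebra.Bundles using (CommutativeRing)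
open import Algebra.Core using (Op₂)
open import Algebra.Module.Bundles using (LeftModule)
import Algebra.Module.Construct.TensorUnit as TensorUnit
import Algebra.Module.Morphism.LeftModuleMonomorphism as LeftModuleMonomorphism
open import Algebra.Module.Morphism.Structures using (module LeftModuleMorphisms)
open import Algebra.Structures using (IsRing)
import Algebra.Construct.Pointwise as Pointwise
import Algebra.Properties.AbelianGroup as AbelianGroupProperties
open import Data.Bool.Base using (if_then_else_)
open import Data.Fin.Base as Fin using (Fin; toℕ; cast)
import Data.Fin.Properties as Fin
open import Data.Fin.Permutation using (Permutation′; _⟨$⟩ʳ_)
open import Data.List.Base using (List; []; _∷_; [_]; _++_; map; foldr; concatMap; cartesianProductWith; zipWith; inits; tails; length; lookup; tabulate; upTo)
open import Data.List.Properties using (++-assoc; ++-identityʳ; map-++; ≡-dec)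
import Data.List.Membership.Setoid as SetoidMembership
import Data.List.Relation.Unary.Unique.Setoid as SetoidUnique
open import Data.List.Relation.Unary.All using (All)
open import Data.Nat.Base as ℕ using (ℕ)
import Data.Nat.Properties as ℕ
open import Data.Product.Base using (Σ-syntax; ∃-syntax; _×_; _,_; proj₁; proj₂; map₁; map₂)
open import Data.Sum.Base using (_⊎_; inj₁; inj₂)
open import Data.Sum.Relation.Binary.LeftOrder using (⊎-<-strictTotalOrder)
open import Data.Vec.Base as Vec using (Vec)
open import Function.Base using (id; _∘_)
open import Function.Bundles using (_⇔_; mk⇔; Equivalence)
open import Level using (Level; 0ℓ; _⊔_)
open import Relation.Binary.Bundles using (Setoid; StrictTotalOrder)
import Relation.Binary.Construct.On as On
open import Relation.Binary.PropositionalEquality.Core as ≡ using (_≡_; _≢_)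
import Relation.Binary.PropositionalEquality.Properties as ≡
open import Relation.Nullary.Decidable using (Dec; yes; no; does; map′; _×-dec_; _→-dec_)
open import Relation.Unary using (Pred)

-- A finite sum over { x | P x } is a sum over such a list; the order of the
-- list is immaterial.
module _ {a ℓ : Level} (S : Setoid a ℓ) where
  open Setoid S using (Carrier)
  open SetoidMembership S using () renaming (_∈_ to _∈ₛ_)
  open SetoidUnique S using (Unique)

  record Enumerates {p : Level} (P : Pred Carrier p) (xs : List Carrier) : Set (a ⊔ ℓ ⊔ p) where
    field
      unique   : Unique xs
      complete : ∀ x → P x ⇔ x ∈ₛ xs

module LinearAlgebra {k ℓk : Level} (K : CommutativeRing k ℓk) where

  open CommutativeRing K using (ring; _+_; _*_; -_; 0#; 1#) renaming (Carrier to 𝕂; _≈_ to _≈ᴷ_)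
  private module K = CommutativeRing K

  ∑ᴷ : List 𝕂 → 𝕂
  ∑ᴷ = foldr _+_ 0#

  module _ {m ℓm : Level} (M : LeftModule ring m ℓm) where
    open LeftModule M

    ∑ : List Carrierᴹ → Carrierᴹ
    ∑ = foldr _+ᴹ_ 0ᴹ

  module _ {m ℓm n ℓn : Level} (M : LeftModule ring m ℓm) (N : LeftModule ring n ℓn) where
    private
      module M = LeftModule M
      module N = LeftModule N

    IsLinear : (M.Carrierᴹ → N.Carrierᴹ) → Set (k ⊔ m ⊔ ℓm ⊔ ℓn)
    IsLinear = LeftModuleMorphisms.IsLeftModuleHomomorphism M.rawLeftModule N.rawLeftModule

  Functions : ∀ {a} → Set a → LeftModule ring (a ⊔ k) (a ⊔ ℓk)
  Functions A = record
    { Carrierᴹ = A → 𝕂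
    ; _≈ᴹ_ = λ f g → ∀ x → f x ≈ᴷ g x
    ; _+ᴹ_ = λ f g x → f x + g x
    ; _*ₗ_ = λ c f x → c * f x
    ; 0ᴹ   = λ _ → 0#
    ; -ᴹ_  = λ f x → - f x
    ; isLeftModule = record
      { isLeftSemimodule = record
        { +ᴹ-isCommutativeMonoid = Pointwise.isCommutativeMonoid A K.+-isCommutativeMonoid
        ; isPreleftSemimodule = record
          { *ₗ-cong      = λ c≈d f≈g x → K.*-cong c≈d (f≈g x)
          ; *ₗ-zeroˡ     = λ f x → K.zeroˡ (f x)
          ; *ₗ-distribʳ  = λ f c d x → K.distribʳ (f x) c d
          ; *ₗ-identityˡ = λ f x → K.*-identityˡ (f x)
          ; *ₗ-assoc     = λ c d f x → K.*-assoc c d (f x)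
          ; *ₗ-zeroʳ     = λ c x → K.zeroʳ c
          ; *ₗ-distribˡ  = λ c f g x → K.distribˡ c (f x) (g x)
          }
        }
      ; -ᴹ‿cong = λ f≈g x → K.-‿cong (f≈g x)
      ; -ᴹ‿inverse = (λ f x → K.-‿inverseˡ (f x)) , (λ f x → K.-‿inverseʳ (f x))
      }
    }

  -- The submodule of V spanned by a family of vectors: formal linear
  -- combinations, two of them being equal when they have the same value in V.

  module _ {v ℓv i : Level} (V : LeftModule ring v ℓv) {I : Set i} (e : I → LeftModule.Carrierᴹ V) where
    private module V = LeftModule V

    value : List (𝕂 × I) → V.Carrierᴹ
    value []             = V.0ᴹ
    value ((c , i) ∷ xs) = c V.*ₗ e i V.+ᴹ value xs

    private
      scale : 𝕂 → List (𝕂 × I) → List (𝕂 × I)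
      scale c = map (map₁ (c *_))

      negate : List (𝕂 × I) → List (𝕂 × I)
      negate = map (map₁ -_)

      value-++ : ∀ xs ys → value (xs ++ ys) V.≈ᴹ value xs V.+ᴹ value ys
      value-++ []       ys = V.≈ᴹ-sym (V.+ᴹ-identityˡ _)
      value-++ (x ∷ xs) ys = V.≈ᴹ-trans (V.+ᴹ-congˡ (value-++ xs ys)) (V.≈ᴹ-sym (V.+ᴹ-assoc _ _ _))

      value-scale : ∀ c xs → value (scale c xs) V.≈ᴹ c V.*ₗ value xs
      value-scale c []       = V.≈ᴹ-sym (V.*ₗ-zeroʳ c)
      value-scale c (x ∷ xs) = V.≈ᴹ-trans
        (V.+ᴹ-cong (V.*ₗ-assoc _ _ _) (value-scale c xs)) (V.≈ᴹ-sym (V.*ₗ-distribˡ c _ _))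

      open AbelianGroupProperties V.+ᴹ-abelianGroup using (ε⁻¹≈ε; ⁻¹-∙-comm; inverseˡ-unique)

      neg-*ₗ : ∀ c x → (- c) V.*ₗ x V.≈ᴹ V.-ᴹ (c V.*ₗ x)
      neg-*ₗ c x = inverseˡ-unique _ _ (V.≈ᴹ-trans (V.≈ᴹ-sym (V.*ₗ-distribʳ x (- c) c))
        (V.≈ᴹ-trans (V.*ₗ-congʳ (K.-‿inverseˡ c)) (V.*ₗ-zeroˡ x)))

      value-negate : ∀ xs → value (negate xs) V.≈ᴹ V.-ᴹ value xs
      value-negate []       = V.≈ᴹ-sym ε⁻¹≈ε
      value-negate (x ∷ xs) = V.≈ᴹ-trans
        (V.+ᴹ-cong (neg-*ₗ _ _) (value-negate xs)) (⁻¹-∙-comm _ _)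

    Span : LeftModule ring (k ⊔ i) ℓv
    Span = record
      { Carrierᴹ = List (𝕂 × I)
      ; _≈ᴹ_ = λ xs ys → value xs V.≈ᴹ value ys
      ; _+ᴹ_ = _++_
      ; _*ₗ_ = scale
      ; 0ᴹ   = []
      ; -ᴹ_  = negate
      ; isLeftModule = LeftModuleMonomorphism.isLeftModule {N = V.rawLeftModule} {⟦_⟧ = value}
          (record
            { isLeftModuleHomomorphism = record
              { +ᴹ-isGroupHomomorphism = record
                { isMonoidHomomorphism = record
                  { isMagmaHomomorphism = record
                    { isRelHomomorphism = record { cong = id } ; homo = value-++ }
                  ; ε-homo = V.≈ᴹ-refl
                  }
                ; ⁻¹-homo = value-negate
                }
              ; *ₗ-homo = value-scale
              }
            ; injective = id
            }) K.isRing V.isLeftModule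
      }

  -- The tensor product over K: finite sums of pure tensors (a list stands
  -- for the sum of its entries), modulo the congruence generated by
  -- bilinearity.

  module Tensor {m ℓm n ℓn : Level} (M : LeftModule ring m ℓm) (N : LeftModule ring n ℓn) where
    private
      module M = LeftModule M
      module N = LeftModule N

      T : Set (m ⊔ n)
      T = List (M.Carrierᴹ × N.Carrierᴹ)

    infix 4 _≈ᵀ_
    data _≈ᵀ_ : T → T → Set (k ⊔ m ⊔ ℓm ⊔ n ⊔ ℓn) where
      reflᵀ    : ∀ {s} → s ≈ᵀ s
      symᵀ     : ∀ {s t} → s ≈ᵀ t → t ≈ᵀ s
      transᵀ   : ∀ {s t u} → s ≈ᵀ t → t ≈ᵀ u → s ≈ᵀ u
      +-congᵀ  : ∀ {s s′ t t′} → s ≈ᵀ s′ → t ≈ᵀ t′ → s ++ t ≈ᵀ s′ ++ t′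
      +-commᵀ  : ∀ s t → s ++ t ≈ᵀ t ++ s
      ⊗-cong   : ∀ {x x′ y y′} → x M.≈ᴹ x′ → y N.≈ᴹ y′ → [ x , y ] ≈ᵀ [ x′ , y′ ]
      ⊗-zeroˡ  : ∀ y → [ M.0ᴹ , y ] ≈ᵀ []
      ⊗-addˡ   : ∀ x x′ y → [ x M.+ᴹ x′ , y ] ≈ᵀ (x , y) ∷ (x′ , y) ∷ []
      ⊗-addʳ   : ∀ x y y′ → [ x , y N.+ᴹ y′ ] ≈ᵀ (x , y) ∷ (x , y′) ∷ []
      ⊗-scalar : ∀ c x y → [ c M.*ₗ x , y ] ≈ᵀ [ x , c N.*ₗ y ]

    private
      scale : 𝕂 → T → T
      scale c = map (map₁ (c M.*ₗ_))

      negate : T → T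
      negate = map (map₁ M.-ᴹ_)

      reflexiveᵀ : ∀ {s t} → s ≡ t → s ≈ᵀ t
      reflexiveᵀ ≡.refl = reflᵀ

      ∷-cong : ∀ {x x′ y s t} → x M.≈ᴹ x′ → s ≈ᵀ t → (x , y) ∷ s ≈ᵀ (x′ , y) ∷ t
      ∷-cong p q = +-congᵀ (⊗-cong p N.≈ᴹ-refl) q

      map-≈ : ∀ {f g : M.Carrierᴹ → M.Carrierᴹ} → (∀ x → f x M.≈ᴹ g x) → ∀ t → map (map₁ f) t ≈ᵀ map (map₁ g) t
      map-≈ h []      = reflᵀ
      map-≈ h (x ∷ t) = ∷-cong (h _) (map-≈ h t)

      map-id : ∀ {f : M.Carrierᴹ → M.Carrierᴹ} → (∀ x → f x M.≈ᴹ x) → ∀ t → map (map₁ f) t ≈ᵀ t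
      map-id h []      = reflᵀ
      map-id h (x ∷ t) = ∷-cong (h _) (map-id h t)

      map-∘ : ∀ {f g h : M.Carrierᴹ → M.Carrierᴹ} → (∀ x → f x M.≈ᴹ g (h x)) → ∀ t → map (map₁ f) t ≈ᵀ map (map₁ g) (map (map₁ h) t)
      map-∘ h []      = reflᵀ
      map-∘ h (x ∷ t) = ∷-cong (h _) (map-∘ h t)

      map-0 : ∀ {f : M.Carrierᴹ → M.Carrierᴹ} → (∀ x → f x M.≈ᴹ M.0ᴹ) → ∀ t → map (map₁ f) t ≈ᵀ []
      map-0 h []            = reflᵀ
      map-0 h ((x , y) ∷ t) = +-congᵀ (transᵀ (⊗-cong (h x) N.≈ᴹ-refl) (⊗-zeroˡ y)) (map-0 h t)

      map-+ : ∀ {f g h : M.Carrierᴹ → M.Carrierᴹ} → (∀ x → f x M.≈ᴹ g x M.+ᴹ h x) →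
              ∀ t → map (map₁ f) t ≈ᵀ map (map₁ g) t ++ map (map₁ h) t
      map-+         e []            = reflᵀ
      map-+ {f} {g} {h} e ((x , y) ∷ t) = transᵀ
        (+-congᵀ (transᵀ (⊗-cong (e x) N.≈ᴹ-refl) (⊗-addˡ (g x) (h x) y)) (map-+ e t))
        (+-congᵀ (reflᵀ {[ g x , y ]}) (transᵀ
          (+-congᵀ (+-commᵀ [ h x , y ] (map (map₁ g) t)) (reflᵀ {map (map₁ h) t}))
          (reflexiveᵀ (++-assoc (map (map₁ g) t) [ h x , y ] (map (map₁ h) t)))))

      map-cong : ∀ {f : M.Carrierᴹ → M.Carrierᴹ} → IsLinear M M f → ∀ {s t} → s ≈ᵀ t → map (map₁ f) s ≈ᵀ map (map₁ f) t
      map-cong {f} f-linear = go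
        where
        open LeftModuleMorphisms.IsLeftModuleHomomorphism f-linear

        go : ∀ {s t} → s ≈ᵀ t → map (map₁ f) s ≈ᵀ map (map₁ f) t
        go reflᵀ            = reflᵀ
        go (symᵀ p)         = symᵀ (go p)
        go (transᵀ p q)     = transᵀ (go p) (go q)
        go (+-congᵀ {s} {s′} {t} {t′} p q) = transᵀ (reflexiveᵀ (map-++ _ s t))
          (transᵀ (+-congᵀ (go p) (go q)) (reflexiveᵀ (≡.sym (map-++ _ s′ t′))))
        go (+-commᵀ s t)    = transᵀ (reflexiveᵀ (map-++ _ s t))
          (transᵀ (+-commᵀ (map (map₁ f) s) (map (map₁ f) t)) (reflexiveᵀ (≡.sym (map-++ _ t s))))
        go (⊗-cong p q)     = ⊗-cong (⟦⟧-cong p) q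
        go (⊗-zeroˡ y)      = transᵀ (⊗-cong 0ᴹ-homo N.≈ᴹ-refl) (⊗-zeroˡ y)
        go (⊗-addˡ x x′ y)  = transᵀ (⊗-cong (+ᴹ-homo x x′) N.≈ᴹ-refl) (⊗-addˡ (f x) (f x′) y)
        go (⊗-addʳ x y y′)  = ⊗-addʳ (f x) y y′
        go (⊗-scalar c x y) = transᵀ (⊗-cong (*ₗ-homo c x) N.≈ᴹ-refl) (⊗-scalar c (f x) y)

      open AbelianGroupProperties M.+ᴹ-abelianGroup using (ε⁻¹≈ε; ⁻¹-∙-comm; inverseˡ-unique)

      *ₗ-neg : ∀ c x → M.-ᴹ (c M.*ₗ x) M.≈ᴹ c M.*ₗ (M.-ᴹ x)
      *ₗ-neg c x = M.≈ᴹ-sym (inverseˡ-unique _ _ (M.≈ᴹ-trans (M.≈ᴹ-sym (M.*ₗ-distribˡ c _ _))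
        (M.≈ᴹ-trans (M.*ₗ-congˡ (M.-ᴹ‿inverseˡ x)) (M.*ₗ-zeroʳ c))))

      swap-scalars : ∀ c d x → c M.*ₗ (d M.*ₗ x) M.≈ᴹ d M.*ₗ (c M.*ₗ x)
      swap-scalars c d x = M.≈ᴹ-trans (M.≈ᴹ-sym (M.*ₗ-assoc c d x))
        (M.≈ᴹ-trans (M.*ₗ-congʳ (K.*-comm c d)) (M.*ₗ-assoc d c x))

      scale-linear : ∀ c → IsLinear M M (c M.*ₗ_)
      scale-linear c = record
        { +ᴹ-isGroupHomomorphism = record
          { isMonoidHomomorphism = record
            { isMagmaHomomorphism = record
              { isRelHomomorphism = record { cong = M.*ₗ-congˡ } ; homo = M.*ₗ-distribˡ c }
            ; ε-homo = M.*ₗ-zeroʳ c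
            }
          ; ⁻¹-homo = λ x → M.≈ᴹ-sym (*ₗ-neg c x)
          }
        ; *ₗ-homo = λ d x → swap-scalars c d x
        }

      negate-linear : IsLinear M M M.-ᴹ_
      negate-linear = record
        { +ᴹ-isGroupHomomorphism = record
          { isMonoidHomomorphism = record
            { isMagmaHomomorphism = record
              { isRelHomomorphism = record { cong = M.-ᴹ‿cong }
              ; homo = λ x y → M.≈ᴹ-sym (⁻¹-∙-comm x y) }
            ; ε-homo = ε⁻¹≈ε
            }
          ; ⁻¹-homo = λ x → M.≈ᴹ-refl
          }
        ; *ₗ-homo = *ₗ-neg
        }

      inverseˡ : ∀ t → negate t ++ t ≈ᵀ []
      inverseˡ t = symᵀ (transᵀ (symᵀ (map-0 (λ _ → M.≈ᴹ-refl) t))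
        (transᵀ (map-+ {h = id} (λ x → M.≈ᴹ-sym (M.-ᴹ‿inverseˡ x)) t) (+-congᵀ reflᵀ (map-id (λ _ → M.≈ᴹ-refl) t))))

    module⊗ : LeftModule ring (m ⊔ n) (k ⊔ m ⊔ ℓm ⊔ n ⊔ ℓn)
    module⊗ = record
      { Carrierᴹ = T
      ; _≈ᴹ_ = _≈ᵀ_
      ; _+ᴹ_ = _++_
      ; _*ₗ_ = scale
      ; 0ᴹ   = []
      ; -ᴹ_  = negate
      ; isLeftModule = record
        { isLeftSemimodule = record
          { +ᴹ-isCommutativeMonoid = record
            { isMonoid = record
              { isSemigroup = record
                { isMagma = record
                  { isEquivalence = record { refl = reflᵀ ; sym = symᵀ ; trans = transᵀ }
                  ; ∙-cong = +-congᵀ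
                  }
                ; assoc = λ s t u → reflexiveᵀ (++-assoc s t u)
                }
              ; identity = (λ _ → reflᵀ) , (λ t → reflexiveᵀ (++-identityʳ t))
              }
            ; comm = +-commᵀ
            }
          ; isPreleftSemimodule = record
            { *ₗ-cong      = λ {c} {d} {s} c≈d s≈t → transᵀ (map-≈ (λ x → M.*ₗ-congʳ c≈d) s) (map-cong (scale-linear d) s≈t)
            ; *ₗ-zeroˡ     = map-0 M.*ₗ-zeroˡ
            ; *ₗ-distribʳ  = λ t c d → map-+ (λ x → M.*ₗ-distribʳ x c d) t
            ; *ₗ-identityˡ = map-id M.*ₗ-identityˡ
            ; *ₗ-assoc     = λ c d → map-∘ (M.*ₗ-assoc c d)
            ; *ₗ-zeroʳ     = λ _ → reflᵀ
            ; *ₗ-distribˡ  = λ c s t → reflexiveᵀ (map-++ _ s t)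
            }
          }
        ; -ᴹ‿cong = map-cong negate-linear
        ; -ᴹ‿inverse = inverseˡ , (λ t → transᵀ (+-commᵀ t (negate t)) (inverseˡ t))
        }
      }

  infixr 7 _⊗_
  _⊗_ : ∀ {m ℓm n ℓn} → LeftModule ring m ℓm → LeftModule ring n ℓn → LeftModule ring (m ⊔ n) (k ⊔ m ⊔ ℓm ⊔ n ⊔ ℓn)
  M ⊗ N = Tensor.module⊗ M N

  record RawBialgebra {m ℓm : Level} (M : LeftModule ring m ℓm) : Set (k ⊔ m) where
    open LeftModule M
    private module M⊗M = LeftModule (M ⊗ M)

    infixl 7 _∙_ _∙⊗_
    field
      _∙_ : Op₂ Carrierᴹ
      𝟙   : Carrierᴹ
      Δ   : Carrierᴹ → M⊗M.Carrierᴹ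
      ε   : Carrierᴹ → 𝕂

    _∙⊗_ : Op₂ M⊗M.Carrierᴹ
    _∙⊗_ = cartesianProductWith λ (x , y) (x′ , y′) → x ∙ x′ , y ∙ y′

    -- Given a bilinear f, the value at t of the induced linear map on M ⊗ M.
    lift : (Carrierᴹ → Carrierᴹ → Carrierᴹ) → M⊗M.Carrierᴹ → Carrierᴹ
    lift f = ∑ M ∘ map λ (x , y) → f x y

    -- (Δ ⊗ id) ∘ Δ followed by (M ⊗ M) ⊗ M ≅ M ⊗ (M ⊗ M), and (id ⊗ Δ) ∘ Δ.
    Δ⊗id∘Δ id⊗Δ∘Δ : Carrierᴹ → LeftModule.Carrierᴹ (M ⊗ (M ⊗ M))
    Δ⊗id∘Δ = concatMap (λ (x , z) → map (λ (x₁ , x₂) → x₁ , [ x₂ , z ]) (Δ x)) ∘ Δ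
    id⊗Δ∘Δ = map (map₂ Δ) ∘ Δ

  module _ {m ℓm : Level} {M : LeftModule ring m ℓm} (H : RawBialgebra M) where
    open LeftModule M
    open RawBialgebra H
    private
      module M⊗M = LeftModule (M ⊗ M)
      module M⊗M⊗M = LeftModule (M ⊗ (M ⊗ M))

    record IsAlgebra : Set (k ⊔ m ⊔ ℓm) where
      field
        isRing     : IsRing _≈ᴹ_ _+ᴹ_ _∙_ -ᴹ_ 0ᴹ 𝟙
        *ₗ-∙-assoc : ∀ c x y → (c *ₗ x) ∙ y ≈ᴹ c *ₗ (x ∙ y)
        ∙-*ₗ-comm  : ∀ c x y → x ∙ (c *ₗ y) ≈ᴹ c *ₗ (x ∙ y)

    record IsCoalgebra : Set (k ⊔ ℓk ⊔ m ⊔ ℓm) where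
      field
        Δ-linear       : IsLinear M (M ⊗ M) Δ
        ε-linear       : IsLinear M (TensorUnit.leftModule {R = ring}) ε
        coassociative  : ∀ x → Δ⊗id∘Δ x M⊗M⊗M.≈ᴹ id⊗Δ∘Δ x
        counitalˡ      : ∀ x → lift (λ y z → ε y *ₗ z) (Δ x) ≈ᴹ x
        counitalʳ      : ∀ x → lift (λ y z → ε z *ₗ y) (Δ x) ≈ᴹ x

    record IsBialgebra : Set (k ⊔ ℓk ⊔ m ⊔ ℓm) where
      field
        isAlgebra   : IsAlgebra
        isCoalgebra : IsCoalgebra
        Δ-∙-homo    : ∀ x y → Δ (x ∙ y) M⊗M.≈ᴹ Δ x ∙⊗ Δ y
        Δ-𝟙-homo    : Δ 𝟙 M⊗M.≈ᴹ [ 𝟙 , 𝟙 ]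
        ε-∙-homo    : ∀ x y → ε (x ∙ y) ≈ᴷ ε x * ε y
        ε-𝟙-homo    : ε 𝟙 ≈ᴷ 1#

    record IsHopfAlgebra : Set (k ⊔ ℓk ⊔ m ⊔ ℓm) where
      field
        isBialgebra : IsBialgebra
        S           : Carrierᴹ → Carrierᴹ
        S-linear    : IsLinear M M S
        antipodeˡ   : ∀ x → lift (λ y z → S y ∙ z) (Δ x) ≈ᴹ ε x *ₗ 𝟙
        antipodeʳ   : ∀ x → lift (λ y z → y ∙ S z) (Δ x) ≈ᴹ ε x *ₗ 𝟙

  module _ {m ℓm : Level} (M : LeftModule ring m ℓm) where
    open LeftModule M

    record IsSubmodule {p : Level} (P : Pred Carrierᴹ p) : Set (k ⊔ m ⊔ ℓm ⊔ p) where
      field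
        resp-≈ : ∀ {x y} → x ≈ᴹ y → P x → P y
        0-∈    : P 0ᴹ
        +-∈    : ∀ {x y} → P x → P y → P (x +ᴹ y)
        *ₗ-∈   : ∀ c {x} → P x → P (c *ₗ x)

    -- M is the internal direct sum of the submodules P 0, P 1, …
    record IsGrading {p : Level} (P : ℕ → Pred Carrierᴹ p) : Set (k ⊔ m ⊔ ℓm ⊔ p) where
      field
        isSubmodule : ∀ n → IsSubmodule (P n)
        spanning    : ∀ x → ∃[ N ] Σ[ f ∈ (ℕ → Carrierᴹ) ] (∀ n → P n (f n)) × x ≈ᴹ ∑ M (map f (upTo N))
        independent : ∀ N (f : ℕ → Carrierᴹ) → (∀ n → P n (f n)) →
                      ∑ M (map f (upTo N)) ≈ᴹ 0ᴹ → ∀ n → n ℕ.< N → f n ≈ᴹ 0ᴹ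

  module _ {m ℓm : Level} {M : LeftModule ring m ℓm} (H : RawBialgebra M) where
    open LeftModule M
    open RawBialgebra H
    private module M⊗M = LeftModule (M ⊗ M)

    record IsGradedBialgebra {p : Level} (P : ℕ → Pred Carrierᴹ p) : Set (k ⊔ ℓk ⊔ m ⊔ ℓm ⊔ p) where
      field
        isBialgebra : IsBialgebra H
        isGrading   : IsGrading M P
        ∙-graded    : ∀ {i j x y} → P i x → P j y → P (i ℕ.+ j) (x ∙ y)
        𝟙-graded    : P 0 𝟙
        Δ-graded    : ∀ {n x} → P n x → ∃[ t ] Δ x M⊗M.≈ᴹ t ×
                      All (λ (y , z) → ∃[ i ] ∃[ j ] i ℕ.+ j ≡ n × P i y × P j z) t
        ε-graded    : ∀ {n x} → P n x → n ≢ 0 → ε x ≈ᴷ 0#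

    -- The unit map K → P 0 is bijective.
    record IsConnected {p : Level} (P : ℕ → Pred Carrierᴹ p) : Set (k ⊔ ℓk ⊔ m ⊔ ℓm ⊔ p) where
      field
        unit-surjective : ∀ {x} → P 0 x → ∃[ c ] x ≈ᴹ c *ₗ 𝟙
        unit-injective  : ∀ {c d} → c *ₗ 𝟙 ≈ᴹ d *ₗ 𝟙 → c ≈ᴷ d

module ColoredWords (ℓ : ℕ) where

  Color : Set
  Color = Fin ℓ

  -- A colored word (v , u), as the list of its biletters.
  Word : Set → Set
  Word X = List (X × Color)

  shuffles : ∀ {X : Set} → List X → List X → List (List X)
  shuffles []       ys       = [ ys ]
  shuffles (x ∷ xs) []       = [ x ∷ xs ]
  shuffles (x ∷ xs) (y ∷ ys) = map (x ∷_) (shuffles xs (y ∷ ys)) ++ map (y ∷_) (shuffles (x ∷ xs) ys)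

  record ColoredPerm : Set where
    constructor coloredPerm
    field
      {size} : ℕ
      perm   : Permutation′ size
      colors : Vec Color size

  open ColoredPerm public

  -- (σ , u) as a word of biletters. Letters are numbered from 0, both here
  -- and in the alphabet A = ℕ below.
  word : ColoredPerm → Word ℕ
  word (coloredPerm σ u) = tabulate λ i → toℕ (σ ⟨$⟩ʳ i) , Vec.lookup u i

  -- Colored permutations are identified with their words, since two values
  -- of Permutation′ n need not be propositionally equal when they agree
  -- pointwise.
  ColoredPerms : Setoid 0ℓ 0ℓ
  ColoredPerms = On.setoid (≡.setoid (Word ℕ)) word

  shift : ℕ → Word ℕ → Word ℕ
  shift k = map (map₁ (ℕ._+ k))

  infix 6 _⋓_
  _⋓_ : ColoredPerm → ColoredPerm → List (Word ℕ)
  α ⋓ β = shuffles (word α) (shift (size α) (word β))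

  module _ (X : StrictTotalOrder 0ℓ 0ℓ 0ℓ) where
    open StrictTotalOrder X using (_<_; _<?_) renaming (Carrier to Letter)

    -- 𝐒td w = (σ , u): σ has the same inversions as the word of letters of
    -- w, and u is the word of colors of w.
    record IsStd (w : Word Letter) (α : ColoredPerm) : Set where
      private
        letter : Fin (length w) → Letter
        letter i = proj₁ (lookup w i)
      field
        same-size       : length w ≡ size α
        same-inversions : ∀ i j → i Fin.< j →
          letter j < letter i ⇔ perm α ⟨$⟩ʳ cast same-size j Fin.< perm α ⟨$⟩ʳ cast same-size i
        same-colors     : map proj₂ w ≡ Vec.toList (colors α)

    isStd? : ∀ w α → Dec (IsStd w α)
    isStd? w α with length w ℕ.≟ size α
    ... | no  p = no (p ∘ IsStd.same-size)
    ... | yes p = map′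
      (λ (inv , col) → record { same-size = p ; same-inversions = inv ; same-colors = col })
      (λ s → IsStd.same-inversions s , IsStd.same-colors s)
      ((Fin.all? λ i → Fin.all? λ j → (i Fin.<? j) →-dec
          ((proj₁ (lookup w j) <? proj₁ (lookup w i)) ⇔-dec
           (perm α ⟨$⟩ʳ cast p j Fin.<? perm α ⟨$⟩ʳ cast p i)))
       ×-dec ≡-dec Fin._≟_ (map proj₂ w) (Vec.toList (colors α)))
      where
      _⇔-dec_ : ∀ {a b} {A : Set a} {B : Set b} → Dec A → Dec B → Dec (A ⇔ B)
      a? ⇔-dec b? = map′ (λ (f , g) → mk⇔ f g) (λ e → Equivalence.to e , Equivalence.from e)
        ((a? →-dec b?) ×-dec (b? →-dec a?))

module FreeQuasiSymmetric {k ℓk : Level} (K : CommutativeRing k ℓk) (ℓ : ℕ) where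

  open CommutativeRing K using (ring; _*_; 0#; 1#) renaming (Carrier to 𝕂; _≈_ to _≈ᴷ_)
  open LinearAlgebra K
  open ColoredWords ℓ public

  -- Formal, possibly infinite, sums of colored words over X, given by the
  -- coefficient of each word.
  Series : StrictTotalOrder 0ℓ 0ℓ 0ℓ → LeftModule ring k ℓk
  Series X = Functions (Word (StrictTotalOrder.Carrier X))

  𝐆 : ∀ X → ColoredPerm → LeftModule.Carrierᴹ (Series X)
  𝐆 X α w = if does (isStd? X w α) then 1# else 0#

  A : StrictTotalOrder 0ℓ 0ℓ 0ℓ
  A = ℕ.<-strictTotalOrder

  A′⊕A″ : StrictTotalOrder 0ℓ 0ℓ 0ℓ
  A′⊕A″ = ⊎-<-strictTotalOrder {d = 0ℓ} {e = 0ℓ} {f = 0ℓ} A A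

  FQSym : LeftModule ring k ℓk
  FQSym = Span (Series A) (𝐆 A)

  𝐅 : Set k
  𝐅 = LeftModule.Carrierᴹ FQSym

  G : ColoredPerm → 𝐅
  G α = [ 1# , α ]

  -- f(X), for f given as a linear combination of the G's.
  infix 9 _⟨_⟩
  _⟨_⟩ : 𝐅 → ∀ X → LeftModule.Carrierᴹ (Series X)
  f ⟨ X ⟩ = value (Series X) (𝐆 X) f

  infixl 7 _⋆_
  _⋆_ : Op₂ (Word ℕ → 𝕂)
  (f ⋆ g) w = ∑ᴷ (zipWith (λ p s → f p * g s) (inits w) (tails w))

  one : Word ℕ → 𝕂
  one []      = 1#
  one (_ ∷ _) = 0#

  -- Sums of monomials w′ w″ with w′ a word over 𝐀′ and w″ a word over 𝐀″,
  -- the letters of 𝐀′ commuting with those of 𝐀″.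
  Series₂ : LeftModule ring k ℓk
  Series₂ = Functions (Word ℕ × Word ℕ)

  -- The image of a series over 𝐀′ ⊕ 𝐀″ when the letters of 𝐀′ are made to
  -- commute with those of 𝐀″: the words becoming equal to w′ w″ are exactly
  -- the shuffles of w′ and w″, all distinct as 𝐀′ and 𝐀″ are disjoint.
  commuting : (Word (ℕ ⊎ ℕ) → 𝕂) → Word ℕ × Word ℕ → 𝕂
  commuting f (w′ , w″) = ∑ᴷ (map f (shuffles (map (map₁ inj₁) w′) (map (map₁ inj₂) w″)))

  -- The identification of f ⊗ g with f(𝐀′) g(𝐀″).
  identify : LeftModule.Carrierᴹ (FQSym ⊗ FQSym) → Word ℕ × Word ℕ → 𝕂
  identify t = ∑ Series₂ (map (λ (f , g) (w′ , w″) → (f ⟨ A ⟩) w′ * (g ⟨ A ⟩) w″) t)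

  -- The component of degree n: the span of the G's of size n.
  Degree : ℕ → Pred 𝐅 (k ⊔ ℓk)
  Degree n f = ∃[ g ] All (λ (_ , α) → size α ≡ n) g × f FQSym.≈ᴹ g
    where module FQSym = LeftModule FQSym

{-# OPTIONS --safe #-}
module Submission where

-- The coefficient of a word w in G_{σ,u} is 1 if std w = (σ,u) and 0 otherwise.
-- Hence the G's are linearly independent, and FQSym consists of the series of
-- bounded degree whose coefficient at w depends on std w only. Since the pieces
-- of a cut of std w have the same standardizations as the pieces of the same
-- cut of w, these series are closed under the product.
--
-- Standardizing the shuffles of w′ over 𝐀′ with w″ over 𝐀″ gives the shifted
-- shuffles of std w′ with std w″, and a permutation is a shifted shuffle of its
-- letters < k with its letters ≥ k, for each k, and in no other way. This is
-- the formula for Δ; coassociativity restricts the letters to three successive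
-- intervals. Δ is multiplicative because cutting a shuffle of two words amounts
-- to shuffling the pieces of a cut of each, and because identify is injective.
-- The antipode is the inverse of the identity for the convolution product.

open import Defs
open import Algebra.Bundles using (CommutativeRing)
open import Algebra.Module.Bundles using (LeftModule)
import Algebra.Module.Construct.TensorUnit as TensorUnit
open import Algebra.Module.Morphism.Structures using (module LeftModuleMorphisms)
import Algebra.Properties.AbelianGroup as AbelianGroupProperties
import Algebra.Properties.CommutativeSemigroup as CommutativeSemigroupProperties
open import Data.Bool.Base using (true; false; if_then_else_)
open import Data.Fin.Base as Fin using (Fin; zero; suc; toℕ; fromℕ<; cast; punchIn)
import Data.Fin.Permutation as Perm
import Data.Fin.Properties as Fin
open import Data.List.Base using (List; []; _∷_; [_]; _++_; map; foldr; filter; concatMap; cartesianProduct; cartesianProductWith; zipWith; inits; tails; length; lookup; tabulate; take; drop; applyUpTo; upTo; allFin; deduplicate)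
import Data.List.Properties as List
import Data.List.Membership.DecPropositional as DecMembership
open import Data.List.Membership.Propositional using (_∈_; _∉_)
import Data.List.Membership.Propositional.Properties as Mem
open import Data.List.Relation.Binary.Pointwise.Base using (Pointwise; []; _∷_)
open import Data.List.Relation.Unary.All as All using (All; []; _∷_)
import Data.List.Relation.Unary.All.Properties as All
import Data.List.Relation.Unary.AllPairs as AllPairs
open import Data.List.Relation.Unary.Any using (Any; here; there)
import Data.List.Relation.Unary.Any.Properties as Any
import Data.List.Relation.Unary.Unique.DecPropositional.Properties as DecUnique
open import Data.List.Relation.Unary.Unique.Propositional using (Unique)
import Data.List.Relation.Unary.Unique.Propositional.Properties as Unique
import Data.List.Relation.Unary.Unique.Setoid.Properties as SetoidUnique
open import Data.Nat.Base as ℕ using (ℕ; zero; suc; _∸_; _≤_; z≤n; s≤s; s≤s⁻¹)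
import Data.Nat.Properties as ℕ
open import Data.Product.Base using (Σ-syntax; ∃-syntax; _×_; _,_; proj₁; proj₂; map₁; map₂)
import Data.Product.Properties as Prod
open import Data.Product.Relation.Binary.Pointwise.NonDependent using (×-setoid)
open import Data.Sum.Base using (_⊎_; inj₁; inj₂)
import Data.Sum.Relation.Binary.LeftOrder as LeftOrder
open import Data.Vec.Base as Vec using (Vec)
open import Function.Base using (id; _∘_; case_of_)
open import Function.Bundles using (_⇔_; mk⇔; Equivalence)
import Function.Construct.Composition as Compose
open import Level using (Level; 0ℓ)
open import Relation.Binary.Bundles using (StrictTotalOrder)
open import Relation.Binary.Definitions using (DecidableEquality; tri<; tri≈; tri>)
open import Relation.Binary.PropositionalEquality as ≡ using (_≡_; _≢_; refl; sym; trans; cong; cong₂; subst; module ≡-Reasoning)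
open import Relation.Nullary using (¬_; Dec; yes; no; does; contradiction)
open import Relation.Nullary.Decidable using (does-⇔; _×-dec_)
open import Relation.Unary using (Pred; Decidable)

open LeftOrder using (₁∼₁; ₁∼₂; ₂∼₂)
open Equivalence using (to; from)

-- Two encodings shape the proof. Values of `Permutation′` that agree pointwise need not be equal,
-- so the combinatorics takes place on words of biletters. Both `std` and `IsPerm` insert the rank
-- of the first letter into the rest of the word, and most facts on restrictions and shuffles become
-- inductions in which a threshold meets one inserted value. Elements of `FQSym` are lists of scaled
-- generators, equal when their series over `A` are equal. A map defined on such lists, like the
-- coproduct or the antipode, must be shown to respect this equality; it does because the series,
-- evaluated at the word of a colored permutation, returns the total coefficient of that
-- permutation. The same reading of coefficients at pairs of words makes `identify` injective over
-- any commutative ring, where no dimension count is available. The product is not given by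
-- structure constants: it is the product of series, expanded again in the generators up to a degree
-- bound.

private
  _⟨⇔⟩_ : ∀ {a b c} {A : Set a} {B : Set b} {C : Set c} → A ⇔ B → B ⇔ C → A ⇔ C
  _⟨⇔⟩_ = Compose.equivalence

-- Increasing maps of the integers that skip one value

bump : ℕ → ℕ → ℕ
bump zero    s       = suc s
bump (suc r) zero    = zero
bump (suc r) (suc s) = suc (bump r s)

toℕ-punchIn : ∀ {n} (i : Fin (suc n)) j → toℕ (punchIn i j) ≡ bump (toℕ i) (toℕ j)
toℕ-punchIn zero    j       = refl
toℕ-punchIn (suc i) zero    = refl
toℕ-punchIn (suc i) (suc j) = cong suc (toℕ-punchIn i j)

bump-below : ∀ {r s} → s ℕ.< r → bump r s ≡ s
bump-below {suc r} {zero}  s<r       = refl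
bump-below {suc r} {suc s} (s≤s s<r) = cong suc (bump-below s<r)

bump-above : ∀ {r s} → r ≤ s → bump r s ≡ suc s
bump-above {zero}          r≤s       = refl
bump-above {suc r} {suc s} (s≤s r≤s) = cong suc (bump-above r≤s)

-- A threshold passes through the relabelling in two ways: at or below the gap r it stays, at or
-- above the gap it moves up by one. For t = r both versions hold, since r itself is not a value of
-- `bump r`.
bump-<-low : ∀ {r t} s → t ≤ r → s ℕ.< t ⇔ bump r s ℕ.< t
bump-<-low {r} s t≤r with ℕ.<-≤-connex s r
... | inj₁ s<r rewrite bump-below s<r = mk⇔ id id
... | inj₂ r≤s rewrite bump-above r≤s =
  mk⇔ (λ s<t → contradiction (ℕ.<-≤-trans s<t (ℕ.≤-trans t≤r r≤s)) (ℕ.<-irrefl refl)) (ℕ.<-trans (ℕ.n<1+n s))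

bump-<-high : ∀ {r t} s → r ≤ t → s ℕ.< t ⇔ bump r s ℕ.< suc t
bump-<-high {r} s r≤t with ℕ.<-≤-connex s r
... | inj₁ s<r rewrite bump-below s<r = mk⇔ ℕ.m<n⇒m<1+n (λ _ → ℕ.<-≤-trans s<r r≤t)
... | inj₂ r≤s rewrite bump-above r≤s = mk⇔ s≤s s≤s⁻¹

bump-mono-< : ∀ r s t → s ℕ.< t ⇔ bump r s ℕ.< bump r t
bump-mono-< r s t with ℕ.<-≤-connex t r
... | inj₁ t<r rewrite bump-below t<r = bump-<-low s (ℕ.<⇒≤ t<r)
... | inj₂ r≤t rewrite bump-above r≤t = bump-<-high s r≤t

bump-injective : ∀ r {s t} → bump r s ≡ bump r t → s ≡ t
bump-injective r {s} {t} eq with ℕ.<-cmp s t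
... | tri< s<t _ _ = contradiction eq (ℕ.<⇒≢ (to (bump-mono-< r s t) s<t))
... | tri≈ _ s≡t _ = s≡t
... | tri> _ _ t<s = contradiction (sym eq) (ℕ.<⇒≢ (to (bump-mono-< r t s) t<s))

bump-+ : ∀ k r s → bump (r ℕ.+ k) (s ℕ.+ k) ≡ bump r s ℕ.+ k
bump-+ k zero    s       = bump-above (ℕ.m≤n+m k s)
bump-+ k (suc r) zero    = bump-below {suc r ℕ.+ k} {k} (s≤s (ℕ.m≤n+m k r))
bump-+ k (suc r) (suc s) = cong suc (bump-+ k r s)

bump-∸ : ∀ {k} r s → k ≤ r → k ≤ s → bump r s ∸ k ≡ bump (r ∸ k) (s ∸ k)
bump-∸ r       s       z≤n       z≤n       = refl
bump-∸ (suc r) (suc s) (s≤s k≤r) (s≤s k≤s) = bump-∸ r s k≤r k≤s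

module _ {a b p q} {A : Set a} {B : Set b} {P : Pred A p} {Q : Pred B q}
         (P? : Decidable P) (Q? : Decidable Q) {f : A → B} where

  filter-map : (∀ x → P x ⇔ Q (f x)) → ∀ xs → filter Q? (map f xs) ≡ map f (filter P? xs)
  filter-map P⇔Q []       = refl
  filter-map P⇔Q (x ∷ xs) with P? x
  ... | yes px = trans (List.filter-accept Q? (to (P⇔Q x) px)) (cong (f x ∷_) (filter-map P⇔Q xs))
  ... | no ¬px = trans (List.filter-reject Q? (¬px ∘ from (P⇔Q x))) (filter-map P⇔Q xs)

module _ {a p q} {A : Set a} {P : Pred A p} {Q : Pred A q} (P? : Decidable P) (Q? : Decidable Q) where

  filter-filter : ∀ xs → filter P? (filter Q? xs) ≡ filter (λ x → P? x ×-dec Q? x) xs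
  filter-filter []       = refl
  filter-filter (x ∷ xs) with does (Q? x) | P? x
  ... | false | no  _  = filter-filter xs
  ... | false | yes _  = filter-filter xs
  ... | true  | yes px = trans (List.filter-accept P? px) (cong (x ∷_) (filter-filter xs))
  ... | true  | no ¬px = trans (List.filter-reject P? ¬px) (filter-filter xs)

-- Shuffles, ranks and standardization

module Words (ℓ : ℕ) where
  open ColoredWords ℓ

  map-shuffles : ∀ {X Y : Set} (f : X → Y) xs ys → shuffles (map f xs) (map f ys) ≡ map (map f) (shuffles xs ys)
  map-shuffles f []       ys       = refl
  map-shuffles f (x ∷ xs) []       = refl
  map-shuffles f (x ∷ xs) (y ∷ ys) = begin
    map (f x ∷_) (shuffles (map f xs) (map f (y ∷ ys))) ++ map (f y ∷_) (shuffles (map f (x ∷ xs)) (map f ys))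
      ≡⟨ cong₂ (λ u v → map (f x ∷_) u ++ map (f y ∷_) v) (map-shuffles f xs (y ∷ ys)) (map-shuffles f (x ∷ xs) ys) ⟩
    map (f x ∷_) (map (map f) (shuffles xs (y ∷ ys))) ++ map (f y ∷_) (map (map f) (shuffles (x ∷ xs) ys))
      ≡⟨ cong₂ _++_ (swap x (shuffles xs (y ∷ ys))) (swap y (shuffles (x ∷ xs) ys)) ⟩
    map (map f) (map (x ∷_) (shuffles xs (y ∷ ys))) ++ map (map f) (map (y ∷_) (shuffles (x ∷ xs) ys))
      ≡⟨ List.map-++ (map f) (map (x ∷_) (shuffles xs (y ∷ ys))) (map (y ∷_) (shuffles (x ∷ xs) ys)) ⟨
    map (map f) (shuffles (x ∷ xs) (y ∷ ys)) ∎
    where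
    open ≡-Reasoning
    swap : ∀ a zss → map (f a ∷_) (map (map f) zss) ≡ map (map f) (map (a ∷_) zss)
    swap a zss = trans (sym (List.map-∘ zss)) (List.map-∘ zss)

  shuffles-[] : ∀ {X : Set} (xs : List X) → shuffles xs [] ≡ [ xs ]
  shuffles-[] []       = refl
  shuffles-[] (x ∷ xs) = refl

  module _ (X : StrictTotalOrder 0ℓ 0ℓ 0ℓ) where
    open StrictTotalOrder X using (_<?_) renaming (Carrier to Letter)

    -- The strict comparison settles ties: a later letter equal to x is not counted, so `std`
    -- numbers equal letters from left to right.
    rank : Letter → Word Letter → ℕ
    rank x []            = 0
    rank x ((y , _) ∷ w) = if does (y <? x) then suc (rank x w) else rank x w

    -- The first letter is standardized to its rank among the others, which
    -- are standardized among themselves and then make room for it.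
    std : Word Letter → Word ℕ
    std []            = []
    std ((x , c) ∷ w) = (rank x w , c) ∷ map (map₁ (bump (rank x w))) (std w)

  Below : (X : StrictTotalOrder 0ℓ 0ℓ 0ℓ) → StrictTotalOrder.Carrier X → StrictTotalOrder.Carrier X × Color → Set
  Below X x (y , _) = StrictTotalOrder._<_ X y x

  module _ (X : StrictTotalOrder 0ℓ 0ℓ 0ℓ) where
    open StrictTotalOrder X using (_<_; _<?_) renaming (Carrier to Letter)
    private module X = StrictTotalOrder X

    rank-filter : ∀ x w → rank X x w ≡ length (filter (λ a → proj₁ a <? x) w)
    rank-filter x []            = refl
    rank-filter x ((y , _) ∷ w) with does (y <? x)
    ... | true  = cong suc (rank-filter x w)
    ... | false = rank-filter x w

    rank-≤ : ∀ x w → rank X x w ≤ length w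
    rank-≤ x []            = z≤n
    rank-≤ x ((y , _) ∷ w) with does (y <? x)
    ... | true  = s≤s (rank-≤ x w)
    ... | false = ℕ.m≤n⇒m≤1+n (rank-≤ x w)

    -- The hypothesis is an inclusion of strict lower sets, a form that covers x < y and x ≈ y
    -- alike.
    rank-mono : ∀ {x y} → (∀ z → z < x → z < y) → ∀ w → rank X x w ≤ rank X y w
    rank-mono         x⊆y []            = z≤n
    rank-mono {x} {y} x⊆y ((z , _) ∷ w) with z <? x | z <? y
    ... | yes z<x | yes z<y = s≤s (rank-mono x⊆y w)
    ... | yes z<x | no  z≮y = contradiction (x⊆y z z<x) z≮y
    ... | no  z≮x | yes z<y = ℕ.m≤n⇒m≤1+n (rank-mono x⊆y w)
    ... | no  z≮x | no  z≮y = rank-mono x⊆y w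

    rank-all : ∀ {x w} → All (Below X x) w → rank X x w ≡ length w
    rank-all []          = refl
    rank-all {x} {(y , _) ∷ _} (y<x ∷ w<x) with y <? x
    ... | yes _   = cong suc (rank-all w<x)
    ... | no  y≮x = contradiction y<x y≮x

    rank-none : ∀ {x w} → All (λ a → ¬ Below X x a) w → rank X x w ≡ 0
    rank-none []          = refl
    rank-none {x} {(y , _) ∷ _} (y≮x ∷ w≮x) with y <? x
    ... | yes y<x = contradiction y<x y≮x
    ... | no  _   = rank-none w≮x

    length-std : ∀ w → length (std X w) ≡ length w
    length-std []      = refl
    length-std (a ∷ w) = cong suc (trans (List.length-map _ (std X w)) (length-std w))

    rank-shuffles : ∀ x xs ys → All (λ z → rank X x z ≡ rank X x xs ℕ.+ rank X x ys) (shuffles xs ys)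
    rank-shuffles x []       ys       = refl ∷ []
    rank-shuffles x (a ∷ xs) []       = sym (ℕ.+-identityʳ _) ∷ []
    rank-shuffles x (a ∷ xs) (b ∷ ys) = All.++⁺
      (All.map⁺ (All.map (λ {z} → headˡ z) (rank-shuffles x xs (b ∷ ys))))
      (All.map⁺ (All.map (λ {z} → headʳ z) (rank-shuffles x (a ∷ xs) ys)))
      where
      headˡ : ∀ z → rank X x z ≡ rank X x xs ℕ.+ rank X x (b ∷ ys) → rank X x (a ∷ z) ≡ rank X x (a ∷ xs) ℕ.+ rank X x (b ∷ ys)
      headˡ z eq with does (proj₁ a <? x)
      ... | true  = cong suc eq
      ... | false = eq

      headʳ : ∀ z → rank X x z ≡ rank X x (a ∷ xs) ℕ.+ rank X x ys → rank X x (b ∷ z) ≡ rank X x (a ∷ xs) ℕ.+ rank X x (b ∷ ys)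
      headʳ z eq with does (proj₁ b <? x)
      ... | true  = trans (cong suc eq) (sym (ℕ.+-suc _ _))
      ... | false = eq

  -- Words with the same inversions

  module _ (X Y : StrictTotalOrder 0ℓ 0ℓ 0ℓ) where
    private
      module X = StrictTotalOrder X
      module Y = StrictTotalOrder Y

    SameSide : X.Carrier → Y.Carrier → X.Carrier × Color → Y.Carrier × Color → Set
    SameSide x y a b = Below X x a ⇔ Below Y y b

    -- Each inversion is recorded at the earlier of its two letters, which is compared with the rest
    -- of the word. The relation thus follows the recursion of `std` and passes to prefixes and
    -- suffixes structurally.
    data SameInversions : Word X.Carrier → Word Y.Carrier → Set where
      []  : SameInversions [] []
      _∷_ : ∀ {x y c w w′} → Pointwise (SameSide x y) w w′ → SameInversions w w′ → SameInversions ((x , c) ∷ w) ((y , c) ∷ w′)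

    rank-cong : ∀ {x y w w′} → Pointwise (SameSide x y) w w′ → rank X x w ≡ rank Y y w′
    rank-cong []       = refl
    rank-cong {x} {y} {(z , _) ∷ w} {(z′ , _) ∷ w′} (r ∷ rs) rewrite does-⇔ r (z X.<? x) (z′ Y.<? y) | rank-cong rs = refl

    std-cong : ∀ {w w′} → SameInversions w w′ → std X w ≡ std Y w′
    std-cong []       = refl
    std-cong (r ∷ rs) rewrite rank-cong r | std-cong rs = refl

    length-cong : ∀ {w w′} → SameInversions w w′ → length w ≡ length w′
    length-cong []       = refl
    length-cong (_ ∷ rs) = cong suc (length-cong rs)

    private
      take-PW : ∀ {R : X.Carrier × Color → Y.Carrier × Color → Set} i {w w′} → Pointwise R w w′ → Pointwise R (take i w) (take i w′)
      take-PW zero    rs       = []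
      take-PW (suc i) []       = []
      take-PW (suc i) (r ∷ rs) = r ∷ take-PW i rs

    take-cong : ∀ i {w w′} → SameInversions w w′ → SameInversions (take i w) (take i w′)
    take-cong zero    rs       = []
    take-cong (suc i) []       = []
    take-cong (suc i) (r ∷ rs) = take-PW i r ∷ take-cong i rs

    drop-cong : ∀ i {w w′} → SameInversions w w′ → SameInversions (drop i w) (drop i w′)
    drop-cong zero    rs       = rs
    drop-cong (suc i) []       = []
    drop-cong (suc i) (r ∷ rs) = drop-cong i rs

    module _ {f : X.Carrier → Y.Carrier} (f-mono : ∀ x y → (x X.< y) ⇔ (f x Y.< f y)) where

      map-sameSide : ∀ x w → Pointwise (SameSide x (f x)) w (map (map₁ f) w)
      map-sameSide x []            = []
      map-sameSide x ((y , _) ∷ w) = f-mono y x ∷ map-sameSide x w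

      map-sameInversions : ∀ w → SameInversions w (map (map₁ f) w)
      map-sameInversions []            = []
      map-sameInversions ((x , _) ∷ w) = map-sameSide x w ∷ map-sameInversions w

  ℕ< : StrictTotalOrder 0ℓ 0ℓ 0ℓ
  ℕ< = ℕ.<-strictTotalOrder

  module _ (X : StrictTotalOrder 0ℓ 0ℓ 0ℓ) where
    open StrictTotalOrder X using (_<_; _<?_; compare) renaming (Carrier to Letter)
    private module X = StrictTotalOrder X

    -- The induction compares x with the first letter y, whose rank is inserted into the
    -- standardized rest. If y < x, the gap `rank y` is at or below `rank x w`, and the threshold
    -- moves up by one just as the rank of x does; otherwise the gap is at or above it and neither
    -- moves.
    std-sameSide : ∀ x w → Pointwise (SameSide X ℕ< x (rank X x w)) w (std X w)
    std-sameSide x []            = []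
    std-sameSide x ((y , _) ∷ w) with y <? x
    ... | yes y<x = mk⇔ (λ _ → s≤s ry≤rx) (λ _ → y<x) ∷ tail (std-sameSide x w)
      where
      ry≤rx : rank X y w ≤ rank X x w
      ry≤rx = rank-mono X (λ z z<y → X.trans z<y y<x) w

      tail : ∀ {u v} → Pointwise (SameSide X ℕ< x (rank X x w)) u v →
             Pointwise (SameSide X ℕ< x (suc (rank X x w))) u (map (map₁ (bump (rank X y w))) v)
      tail []       = []
      tail (r ∷ rs) = (r ⟨⇔⟩ bump-<-high _ ry≤rx) ∷ tail rs
    ... | no  y≮x = mk⇔ (λ y<x → contradiction y<x y≮x) (λ ry<rx → contradiction (ℕ.<-≤-trans ry<rx rx≤ry) (ℕ.<-irrefl refl)) ∷ tail (std-sameSide x w)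
      where
      z<x⇒z<y : ∀ z → z < x → z < y
      z<x⇒z<y z z<x with compare x y
      ... | tri< x<y _ _ = X.trans z<x x<y
      ... | tri≈ _ x≈y _ = X.<-respʳ-≈ x≈y z<x
      ... | tri> _ _ y<x = contradiction y<x y≮x

      rx≤ry : rank X x w ≤ rank X y w
      rx≤ry = rank-mono X z<x⇒z<y w

      tail : ∀ {u v} → Pointwise (SameSide X ℕ< x (rank X x w)) u v →
             Pointwise (SameSide X ℕ< x (rank X x w)) u (map (map₁ (bump (rank X y w))) v)
      tail []       = []
      tail (r ∷ rs) = (r ⟨⇔⟩ bump-<-low _ rx≤ry) ∷ tail rs

    std-sameInversions : ∀ w → SameInversions X ℕ< w (std X w)
    std-sameInversions []            = []
    std-sameInversions ((x , _) ∷ w) = tail (std-sameSide x w) ∷ lift (std-sameInversions w)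
      where
      r = rank X x w

      tail : ∀ {u v} → Pointwise (SameSide X ℕ< x r) u v → Pointwise (SameSide X ℕ< x r) u (map (map₁ (bump r)) v)
      tail []       = []
      tail (e ∷ es) = (e ⟨⇔⟩ bump-<-low _ ℕ.≤-refl) ∷ tail es

      bump-PW : ∀ {y s u v} → Pointwise (SameSide X ℕ< y s) u v → Pointwise (SameSide X ℕ< y (bump r s)) u (map (map₁ (bump r)) v)
      bump-PW []       = []
      bump-PW (e ∷ es) = (e ⟨⇔⟩ bump-mono-< r _ _) ∷ bump-PW es

      lift : ∀ {u v} → SameInversions X ℕ< u v → SameInversions X ℕ< u (map (map₁ (bump r)) v)
      lift []       = []
      lift (e ∷ es) = bump-PW e ∷ lift es

  rank-map : ∀ {X Y} {f : StrictTotalOrder.Carrier X → StrictTotalOrder.Carrier Y} →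
             (∀ x y → StrictTotalOrder._<_ X x y ⇔ StrictTotalOrder._<_ Y (f x) (f y)) →
             ∀ x w → rank Y (f x) (map (map₁ f) w) ≡ rank X x w
  rank-map {X} {Y} f-mono x w = sym (rank-cong X Y (map-sameSide X Y f-mono x w))

  std-map : ∀ {X Y} {f : StrictTotalOrder.Carrier X → StrictTotalOrder.Carrier Y} →
            (∀ x y → StrictTotalOrder._<_ X x y ⇔ StrictTotalOrder._<_ Y (f x) (f y)) →
            ∀ w → std Y (map (map₁ f) w) ≡ std X w
  std-map {X} {Y} f-mono w = sym (std-cong X Y (map-sameInversions X Y f-mono w))

  std-take : ∀ X i w → std ℕ< (take i (std X w)) ≡ std X (take i w)
  std-take X i w = sym (std-cong X ℕ< (take-cong X ℕ< i (std-sameInversions X w)))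

  std-drop : ∀ X i w → std ℕ< (drop i (std X w)) ≡ std X (drop i w)
  std-drop X i w = sym (std-cong X ℕ< (drop-cong X ℕ< i (std-sameInversions X w)))

  -- Words of permutations

  -- A form of the Lehmer code: the first letter r is arbitrary within its bound, and the rest is a
  -- permutation relabelled to avoid r. No bijectivity has to be carried along, and induction on it
  -- matches the recursion of `std`.
  data IsPerm : Word ℕ → Set where
    []     : IsPerm []
    insert : ∀ {r c p} → r ≤ length p → IsPerm p → IsPerm ((r , c) ∷ map (map₁ (bump r)) p)

  std-isPerm : ∀ X w → IsPerm (std X w)
  std-isPerm X []            = []
  std-isPerm X ((x , c) ∷ w) =
    insert (subst (rank X x w ≤_) (sym (length-std X w)) (rank-≤ X x w)) (std-isPerm X w)

  length-bump : ∀ r p → length {A = ℕ × Color} (map (map₁ (bump r)) p) ≡ length p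
  length-bump r p = List.length-map _ p

  -- Restriction of a permutation to its small and its large letters

  lo : ℕ → Word ℕ → Word ℕ
  lo k = filter λ a → proj₁ a ℕ.<? k

  hi↑ : ℕ → Word ℕ → Word ℕ
  hi↑ k = filter λ a → k ℕ.≤? proj₁ a

  hi : ℕ → Word ℕ → Word ℕ
  hi k p = map (map₁ (_∸ k)) (hi↑ k p)

  lo-bump-low : ∀ {r k} → k ≤ r → ∀ p → lo k (map (map₁ (bump r)) p) ≡ lo k p
  lo-bump-low {r} {k} k≤r p = trans
    (filter-map (λ a → proj₁ a ℕ.<? k) (λ a → proj₁ a ℕ.<? k) (λ (s , _) → bump-<-low s k≤r) p)
    (List.map-id-local (All.map (λ s<k → cong (_, _) (bump-below (ℕ.<-≤-trans s<k k≤r))) (All.all-filter (λ a → proj₁ a ℕ.<? k) p)))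

  lo-bump-high : ∀ {r k} → r ≤ k → ∀ p → lo (suc k) (map (map₁ (bump r)) p) ≡ map (map₁ (bump r)) (lo k p)
  lo-bump-high {r} {k} r≤k = filter-map _ _ (λ (s , _) → bump-<-high s r≤k)

  private
    ≮⇔ : ∀ {s s′ k k′} → s ℕ.< k ⇔ s′ ℕ.< k′ → k ≤ s ⇔ k′ ≤ s′
    ≮⇔ e = mk⇔ (λ k≤s → ℕ.≮⇒≥ λ s′<k′ → ℕ.<⇒≱ (from e s′<k′) k≤s)
               (λ k′≤s′ → ℕ.≮⇒≥ λ s<k → ℕ.<⇒≱ (to e s<k) k′≤s′)

  hi-bump-low : ∀ {r k} → k ≤ r → ∀ p → hi k (map (map₁ (bump r)) p) ≡ map (map₁ (bump (r ∸ k))) (hi k p)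
  hi-bump-low {r} {k} k≤r p = begin
    map (map₁ (_∸ k)) (hi↑ k (map (map₁ (bump r)) p))
      ≡⟨ cong (map _) (filter-map (λ a → k ℕ.≤? proj₁ a) (λ a → k ℕ.≤? proj₁ a) (λ (s , _) → ≮⇔ (bump-<-low s k≤r)) p) ⟩
    map (map₁ (_∸ k)) (map (map₁ (bump r)) (hi↑ k p))
      ≡⟨ List.map-∘ (hi↑ k p) ⟨
    map (map₁ (_∸ k) ∘ map₁ (bump r)) (hi↑ k p)
      ≡⟨ List.map-cong-local (All.map (λ {(s , _)} k≤s → cong (_, _) (bump-∸ r s k≤r k≤s)) (All.all-filter (λ a → k ℕ.≤? proj₁ a) p)) ⟩
    map (map₁ (bump (r ∸ k)) ∘ map₁ (_∸ k)) (hi↑ k p)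
      ≡⟨ List.map-∘ (hi↑ k p) ⟩
    map (map₁ (bump (r ∸ k))) (hi k p) ∎
    where open ≡-Reasoning

  hi-bump-high : ∀ {r k} → r ≤ k → ∀ p → hi (suc k) (map (map₁ (bump r)) p) ≡ hi k p
  hi-bump-high {r} {k} r≤k p = begin
    map (map₁ (_∸ suc k)) (hi↑ (suc k) (map (map₁ (bump r)) p))
      ≡⟨ cong (map _) (filter-map (λ a → k ℕ.≤? proj₁ a) (λ a → suc k ℕ.≤? proj₁ a) (λ (s , _) → ≮⇔ (bump-<-high s r≤k)) p) ⟩
    map (map₁ (_∸ suc k)) (map (map₁ (bump r)) (hi↑ k p))
      ≡⟨ List.map-∘ (hi↑ k p) ⟨
    map (map₁ (_∸ suc k) ∘ map₁ (bump r)) (hi↑ k p)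
      ≡⟨ List.map-cong-local (All.map (λ {(s , c)} k≤s → cong (λ t → t ∸ suc k , c) (bump-above (ℕ.≤-trans r≤k k≤s))) (All.all-filter (λ a → k ℕ.≤? proj₁ a) p)) ⟩
    hi k p ∎
    where open ≡-Reasoning

  lo-insert-low : ∀ {r k} c p → k ≤ r → lo k ((r , c) ∷ map (map₁ (bump r)) p) ≡ lo k p
  lo-insert-low {r} {k} c p k≤r = trans (List.filter-reject (λ a → proj₁ a ℕ.<? k) (ℕ.≤⇒≯ k≤r)) (lo-bump-low k≤r p)

  lo-insert-high : ∀ {r k} c p → r ≤ k → lo (suc k) ((r , c) ∷ map (map₁ (bump r)) p) ≡ (r , c) ∷ map (map₁ (bump r)) (lo k p)
  lo-insert-high {r} {k} c p r≤k =
    trans (List.filter-accept (λ a → proj₁ a ℕ.<? suc k) (s≤s r≤k)) (cong ((r , c) ∷_) (lo-bump-high r≤k p))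

  hi-insert-low : ∀ {r k} c p → k ≤ r → hi k ((r , c) ∷ map (map₁ (bump r)) p) ≡ (r ∸ k , c) ∷ map (map₁ (bump (r ∸ k))) (hi k p)
  hi-insert-low {r} {k} c p k≤r =
    trans (cong (map _) (List.filter-accept (λ a → k ℕ.≤? proj₁ a) k≤r)) (cong ((r ∸ k , c) ∷_) (hi-bump-low k≤r p))

  hi-insert-high : ∀ {r k} c p → r ≤ k → hi (suc k) ((r , c) ∷ map (map₁ (bump r)) p) ≡ hi k p
  hi-insert-high {r} {k} c p r≤k =
    trans (cong (map _) (List.filter-reject (λ a → suc k ℕ.≤? proj₁ a) (ℕ.≤⇒≯ r≤k))) (hi-bump-high r≤k p)

  -- Deleting the first letter r turns the threshold k into k itself if k ≤ r and into k - 1 if r <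
  -- k. The same induction gives the next three lemmas.
  length-lo : ∀ {k p} → IsPerm p → k ≤ length p → length (lo k p) ≡ k
  length-lo {zero} []                         k≤n = refl
  length-lo {k}    (insert {r} {c} {p} r≤n h) k≤n with ℕ.≤-<-connex k r
  ... | inj₁ k≤r       = trans (cong length (lo-insert-low c p k≤r)) (length-lo h (ℕ.≤-trans k≤r r≤n))
  ... | inj₂ (s≤s r≤k) = trans (cong length (lo-insert-high c p r≤k)) (cong suc
    (trans (length-bump r (lo _ p)) (length-lo h (subst (_ ≤_) (length-bump r p) (s≤s⁻¹ k≤n)))))

  length-hi : ∀ {k p} → IsPerm p → k ≤ length p → length (hi k p) ≡ length p ∸ k
  length-hi {zero} []                         k≤n = refl
  length-hi {k}    (insert {r} {c} {p} r≤n h) k≤n with ℕ.≤-<-connex k r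
  ... | inj₁ k≤r = begin
    length (hi k ((r , c) ∷ map (map₁ (bump r)) p))   ≡⟨ cong length (hi-insert-low c p k≤r) ⟩
    suc (length (map (map₁ (bump (r ∸ k))) (hi k p))) ≡⟨ cong suc (length-bump (r ∸ k) (hi k p)) ⟩
    suc (length (hi k p))                             ≡⟨ cong suc (length-hi h k≤m) ⟩
    suc (length p ∸ k)                                ≡⟨ ℕ.+-∸-assoc 1 k≤m ⟨
    suc (length p) ∸ k                                ≡⟨ cong (λ n → suc n ∸ k) (length-bump r p) ⟨
    suc (length (map (map₁ (bump r)) p)) ∸ k          ∎
    where
    open ≡-Reasoning
    k≤m = ℕ.≤-trans k≤r r≤n
  ... | inj₂ (s≤s {n = k′} r≤k) = trans (cong length (hi-insert-high c p r≤k))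
    (trans (length-hi h (subst (_ ≤_) (length-bump r p) (s≤s⁻¹ k≤n))) (cong (_∸ k′) (sym (length-bump r p))))

  lo-isPerm : ∀ {k p} → IsPerm p → k ≤ length p → IsPerm (lo k p)
  lo-isPerm {zero} []                         k≤n = []
  lo-isPerm {k}    (insert {r} {c} {p} r≤n h) k≤n with ℕ.≤-<-connex k r
  ... | inj₁ k≤r       = subst IsPerm (sym (lo-insert-low c p k≤r)) (lo-isPerm h (ℕ.≤-trans k≤r r≤n))
  ... | inj₂ (s≤s {n = k′} r≤k) = subst IsPerm (sym (lo-insert-high c p r≤k))
    (insert (subst (r ≤_) (sym (length-lo h k≤m)) r≤k) (lo-isPerm h k≤m))
    where
    k≤m : k′ ≤ length p
    k≤m = subst (k′ ≤_) (length-bump r p) (s≤s⁻¹ k≤n)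

  hi-isPerm : ∀ {k p} → IsPerm p → k ≤ length p → IsPerm (hi k p)
  hi-isPerm {zero} []                         k≤n = []
  hi-isPerm {k}    (insert {r} {c} {p} r≤n h) k≤n with ℕ.≤-<-connex k r
  ... | inj₁ k≤r       = subst IsPerm (sym (hi-insert-low c p k≤r))
    (insert (subst (r ∸ k ≤_) (sym (length-hi h (ℕ.≤-trans k≤r r≤n))) (ℕ.∸-monoˡ-≤ k r≤n)) (hi-isPerm h (ℕ.≤-trans k≤r r≤n)))
  ... | inj₂ (s≤s r≤k) = subst IsPerm (sym (hi-insert-high c p r≤k))
    (hi-isPerm h (subst (_ ≤_) (length-bump r p) (s≤s⁻¹ k≤n)))

  rank-lo : ∀ k p → rank ℕ< k p ≡ length (lo k p)
  -- The two filters differ only in the decision procedure for the same order.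
  rank-lo k p = trans (rank-filter ℕ< k p) (cong length (List.filter-≐ _ (λ a → proj₁ a ℕ.<? k) (id , id) p))

  -- The first letter r of a permutation has exactly r smaller letters after it, by `length-lo`, so
  -- its rank is r.
  std-perm : ∀ {p} → IsPerm p → std ℕ< p ≡ p
  std-perm []                         = refl
  std-perm (insert {r} {c} {p} r≤n h) = cong₂ (λ s q → (s , c) ∷ map (map₁ (bump s)) q)
    (trans (rank-lo r (map (map₁ (bump r)) p)) (trans (cong length (lo-bump-low ℕ.≤-refl p)) (length-lo h r≤n)))
    (trans (std-map {ℕ<} {ℕ<} (bump-mono-< r) p) (std-perm h))

  perm-bounded : ∀ {p} → IsPerm p → All (λ a → proj₁ a ℕ.< length p) p
  perm-bounded []                         = []
  perm-bounded (insert {r} {c} {p} r≤n h) rewrite length-bump r p =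
    s≤s r≤n ∷ All.map⁺ (All.map (λ {(s , _)} → to (bump-<-high s r≤n)) (perm-bounded h))

  -- This and the next two identities describe the letters in the intervals [0, j), [j, j + i) and
  -- [j + i, ∞). With j and the width i as parameters, no difference of thresholds enters the
  -- statements.
  lo-lo : ∀ j i p → lo j (lo (j ℕ.+ i) p) ≡ lo j p
  lo-lo j i p = trans (filter-filter (λ a → proj₁ a ℕ.<? j) (λ a → proj₁ a ℕ.<? j ℕ.+ i) p)
    (List.filter-≐ _ (λ a → proj₁ a ℕ.<? j) (proj₁ , λ s<j → s<j , ℕ.<-≤-trans s<j (ℕ.m≤m+n j i)) p)

  hi-lo : ∀ j i p → hi j (lo (j ℕ.+ i) p) ≡ lo i (hi j p)
  hi-lo j i p = begin
    map (map₁ (_∸ j)) (hi↑ j (lo (j ℕ.+ i) p))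
      ≡⟨ cong (map _) (filter-filter (λ a → j ℕ.≤? proj₁ a) (λ a → proj₁ a ℕ.<? j ℕ.+ i) p) ⟩
    map (map₁ (_∸ j)) (filter (λ a → (j ℕ.≤? proj₁ a) ×-dec (proj₁ a ℕ.<? j ℕ.+ i)) p)
      -- Truncated subtraction sends every letter below j to 0, so the condition on `s ∸ j` is
      -- equivalent to s < j + i only together with j ≤ s.
      ≡⟨ cong (map _) (List.filter-≐ _ _
           ((λ {(s , _)} (j≤s , s<j+i) → ℕ.+-cancelˡ-< j (s ∸ j) i (subst (ℕ._< j ℕ.+ i) (sym (ℕ.m+[n∸m]≡n j≤s)) s<j+i) , j≤s)
           , (λ {(s , _)} (s-j<i , j≤s) → j≤s , subst (ℕ._< j ℕ.+ i) (ℕ.m+[n∸m]≡n j≤s) (ℕ.+-monoʳ-< j s-j<i))) p) ⟩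
    map (map₁ (_∸ j)) (filter (λ a → (proj₁ a ∸ j ℕ.<? i) ×-dec (j ℕ.≤? proj₁ a)) p)
      ≡⟨ cong (map _) (filter-filter (λ a → proj₁ a ∸ j ℕ.<? i) (λ a → j ℕ.≤? proj₁ a) p) ⟨
    map (map₁ (_∸ j)) (filter (λ a → proj₁ a ∸ j ℕ.<? i) (hi↑ j p))
      ≡⟨ filter-map (λ a → proj₁ a ∸ j ℕ.<? i) (λ a → proj₁ a ℕ.<? i) (λ _ → mk⇔ id id) (hi↑ j p) ⟨
    lo i (hi j p) ∎
    where open ≡-Reasoning

  hi-hi : ∀ j i p → hi i (hi j p) ≡ hi (j ℕ.+ i) p
  hi-hi j i p = begin
    map (map₁ (_∸ i)) (hi↑ i (map (map₁ (_∸ j)) (hi↑ j p)))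
      ≡⟨ cong (map _) (filter-map (λ a → i ℕ.≤? proj₁ a ∸ j) (λ a → i ℕ.≤? proj₁ a) (λ _ → mk⇔ id id) (hi↑ j p)) ⟩
    map (map₁ (_∸ i)) (map (map₁ (_∸ j)) (filter (λ a → i ℕ.≤? proj₁ a ∸ j) (hi↑ j p)))
      ≡⟨ List.map-∘ (filter (λ a → i ℕ.≤? proj₁ a ∸ j) (hi↑ j p)) ⟨
    map (map₁ (λ s → s ∸ j ∸ i)) (filter (λ a → i ℕ.≤? proj₁ a ∸ j) (hi↑ j p))
      ≡⟨ List.map-cong (λ (s , c) → cong (_, c) (ℕ.∸-+-assoc s j i)) _ ⟩
    map (map₁ (_∸ (j ℕ.+ i))) (filter (λ a → i ℕ.≤? proj₁ a ∸ j) (hi↑ j p))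
      ≡⟨ cong (map _) (filter-filter (λ a → i ℕ.≤? proj₁ a ∸ j) (λ a → j ℕ.≤? proj₁ a) p) ⟩
    map (map₁ (_∸ (j ℕ.+ i))) (filter (λ a → (i ℕ.≤? proj₁ a ∸ j) ×-dec (j ℕ.≤? proj₁ a)) p)
      ≡⟨ cong (map _) (List.filter-≐ _ (λ a → j ℕ.+ i ℕ.≤? proj₁ a)
           ((λ {(s , _)} (i≤s-j , j≤s) → subst (j ℕ.+ i ≤_) (ℕ.m+[n∸m]≡n j≤s) (ℕ.+-monoʳ-≤ j i≤s-j))
           , (λ {(s , _)} j+i≤s → ℕ.m+n≤o⇒m≤o∸n i (subst (_≤ s) (ℕ.+-comm j i) j+i≤s) , ℕ.m+n≤o⇒m≤o j j+i≤s)) p) ⟩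
    hi (j ℕ.+ i) p ∎
    where open ≡-Reasoning

  -- Enumeration of the colored permutations of each size

  perms : ℕ → List (Word ℕ)
  perms zero    = [ [] ]
  perms (suc n) = cartesianProductWith (λ a p → a ∷ map (map₁ (bump (proj₁ a))) p)
    (cartesianProduct (upTo (suc n)) (allFin ℓ)) (perms n)

  private
    map-bump-injective : ∀ r {p q : Word ℕ} → map (map₁ (bump r)) p ≡ map (map₁ (bump r)) q → p ≡ q
    map-bump-injective r = List.map-injective λ {(s , c)} {(t , d)} eq →
      cong₂ _,_ (bump-injective r (Prod.,-injectiveˡ eq)) (Prod.,-injectiveʳ eq)

  perms-unique : ∀ n → Unique (perms n)
  perms-unique zero    = [] AllPairs.∷ AllPairs.[]
  perms-unique (suc n) = Unique.cartesianProductWith⁺ _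
    (λ { {a} eq → case-∷ a (List.∷-injective eq) })
    (Unique.cartesianProduct⁺ (Unique.upTo⁺ (suc n)) (Unique.allFin⁺ ℓ)) (perms-unique n)
    where
    case-∷ : ∀ a {b} {p q : Word ℕ} → a ≡ b × map (map₁ (bump (proj₁ a))) p ≡ map (map₁ (bump (proj₁ b))) q → a ≡ b × p ≡ q
    case-∷ (r , _) (refl , eq) = refl , map-bump-injective r eq

  ∈-perms : ∀ {p} → IsPerm p → p ∈ perms (length p)
  ∈-perms []                         = here refl
  ∈-perms (insert {r} {c} {p} r≤n h) rewrite length-bump r p =
    Mem.∈-cartesianProductWith⁺ (λ a p → a ∷ map (map₁ (bump (proj₁ a))) p)
      (Mem.∈-cartesianProduct⁺ (Mem.∈-upTo⁺ (s≤s r≤n)) (Mem.∈-allFin c)) (∈-perms h)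

  perms-isPerm : ∀ n {p} → p ∈ perms n → IsPerm p × length p ≡ n
  perms-isPerm zero    (here refl) = [] , refl
  perms-isPerm (suc n) p∈
    with (r , c) , p , rc∈ , p∈′ , refl ← Mem.∈-cartesianProductWith⁻ (λ a p → a ∷ map (map₁ (bump (proj₁ a))) p)
           (cartesianProduct (upTo (suc n)) (allFin ℓ)) (perms n) p∈
    with h , refl ← perms-isPerm n p∈′ =
      insert (s≤s⁻¹ (Mem.∈-upTo⁻ (proj₁ (Mem.∈-cartesianProduct⁻ (upTo (suc n)) (allFin ℓ) rc∈)))) h , cong suc (length-bump r p)

  -- Passage between colored permutations and words

  toPerm : (w : Word ℕ) → Perm.Permutation′ (length w)
  toPerm []            = Perm.id
  toPerm ((x , _) ∷ w) = Perm.insert zero (fromℕ< (s≤s (rank-≤ ℕ< x w))) (toPerm w)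

  toColors : (w : Word ℕ) → Vec Color (length w)
  toColors []            = Vec.[]
  toColors ((_ , c) ∷ w) = c Vec.∷ toColors w

  -- Total on words: a word that is not a permutation yields the colored permutation of its
  -- standardization, so no proof of `IsPerm` enters the elements built from it.
  toColoredPerm : Word ℕ → ColoredPerm
  toColoredPerm w = coloredPerm (toPerm w) (toColors w)

  word-toColoredPerm : ∀ w → word (toColoredPerm w) ≡ std ℕ< w
  word-toColoredPerm []            = refl
  word-toColoredPerm ((x , c) ∷ w) = cong₂ _∷_
    (cong (_, c) (Fin.toℕ-fromℕ< (s≤s (rank-≤ ℕ< x w))))
    (begin
      tabulate (λ i → toℕ (toPerm ((x , c) ∷ w) Perm.⟨$⟩ʳ suc i) , Vec.lookup (toColors w) i)
        ≡⟨ List.tabulate-cong (λ i → cong (_, _) (step i)) ⟩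
      tabulate (λ i → map₁ (bump (rank ℕ< x w)) (toℕ (toPerm w Perm.⟨$⟩ʳ i) , Vec.lookup (toColors w) i))
        ≡⟨ List.map-tabulate _ _ ⟨
      map (map₁ (bump (rank ℕ< x w))) (word (toColoredPerm w))
        ≡⟨ cong (map _) (word-toColoredPerm w) ⟩
      map (map₁ (bump (rank ℕ< x w))) (std ℕ< w) ∎)
    where
    open ≡-Reasoning
    r : Fin (suc (length w))
    r = fromℕ< (s≤s (rank-≤ ℕ< x w))

    step : ∀ i → toℕ (toPerm ((x , c) ∷ w) Perm.⟨$⟩ʳ suc i) ≡ bump (rank ℕ< x w) (toℕ (toPerm w Perm.⟨$⟩ʳ i))
    step i = begin
      toℕ (Perm.insert zero r (toPerm w) Perm.⟨$⟩ʳ suc i)   ≡⟨ cong toℕ (Perm.insert-punchIn zero r (toPerm w) i) ⟩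
      toℕ (punchIn r (toPerm w Perm.⟨$⟩ʳ i))                ≡⟨ toℕ-punchIn r _ ⟩
      bump (toℕ r) (toℕ (toPerm w Perm.⟨$⟩ʳ i))             ≡⟨ cong (λ s → bump s _) (Fin.toℕ-fromℕ< (s≤s (rank-≤ ℕ< x w))) ⟩
      bump (rank ℕ< x w) (toℕ (toPerm w Perm.⟨$⟩ʳ i))       ∎

  word-toColoredPerm-perm : ∀ {p} → IsPerm p → word (toColoredPerm p) ≡ p
  word-toColoredPerm-perm {p} h = trans (word-toColoredPerm p) (std-perm h)

  length-word : ∀ α → length (word α) ≡ size α
  length-word α = List.length-tabulate _

  private
    permWord : ∀ {n} → Perm.Permutation′ n → Vec Color n → Word ℕ
    permWord π u = word (coloredPerm π u)

    -- `Perm.remove zero` deletes the first position and closes the gap left by its value r;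
    -- reopening that gap with `punchIn r` is the constructor `insert`.
    permWord-isPerm : ∀ {n} π (u : Vec Color n) → IsPerm (permWord π u)
    permWord-isPerm {zero}  π u           = []
    permWord-isPerm {suc n} π (c Vec.∷ u) = subst (λ q → IsPerm ((toℕ r , c) ∷ q)) eq
      (insert (subst (toℕ r ≤_) (sym (length-word (coloredPerm π′ u))) (s≤s⁻¹ (Fin.toℕ<n r))) (permWord-isPerm π′ u))
      where
      r : Fin (suc n)
      r = π Perm.⟨$⟩ʳ zero

      π′ : Perm.Permutation′ n
      π′ = Perm.remove zero π

      eq : map (map₁ (bump (toℕ r))) (permWord π′ u) ≡ tabulate (λ i → toℕ (π Perm.⟨$⟩ʳ suc i) , Vec.lookup u i)
      eq = trans (List.map-tabulate _ _) (List.tabulate-cong λ i → cong (_, _) (sym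
        (trans (cong toℕ (Perm.punchIn-permute π zero i)) (toℕ-punchIn r _))))

  word-isPerm : ∀ α → IsPerm (word α)
  word-isPerm α = permWord-isPerm (perm α) (colors α)

  -- Standardization as a relation and as a function

  module _ (X : StrictTotalOrder 0ℓ 0ℓ 0ℓ) where
    private
      module X = StrictTotalOrder X

      module _ {R : X.Carrier × Color → ℕ × Color → Set} where
        PW-tabulate⁺ : ∀ {n w} (t : Fin n → ℕ × Color) (eq : length w ≡ n) →
                       (∀ j → R (lookup w j) (t (cast eq j))) → Pointwise R w (tabulate t)
        PW-tabulate⁺ {zero}  {[]}    t eq Rw = []
        PW-tabulate⁺ {suc n} {a ∷ w} t eq Rw = Rw zero ∷ PW-tabulate⁺ (t ∘ suc) (ℕ.suc-injective eq) (Rw ∘ suc)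

        PW-tabulate⁻ : ∀ {n w} (t : Fin n → ℕ × Color) (eq : length w ≡ n) →
                       Pointwise R w (tabulate t) → ∀ j → R (lookup w j) (t (cast eq j))
        PW-tabulate⁻ {suc n} {a ∷ w} t eq (r ∷ rs) zero    = r
        PW-tabulate⁻ {suc n} {a ∷ w} t eq (r ∷ rs) (suc j) = PW-tabulate⁻ (t ∘ suc) (ℕ.suc-injective eq) rs j

    Inversions : ∀ {n} w → length w ≡ n → (Fin n → ℕ × Color) → Set
    Inversions w eq t = ∀ i j → i Fin.< j →
      Below X (proj₁ (lookup w i)) (lookup w j) ⇔ Below ℕ< (proj₁ (t (cast eq i))) (t (cast eq j))

    tabulate-sameInversions⁺ : ∀ {n w} (t : Fin n → ℕ × Color) (eq : length w ≡ n) → Inversions w eq t →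
      map proj₂ w ≡ tabulate (proj₂ ∘ t) → SameInversions X ℕ< w (tabulate t)
    tabulate-sameInversions⁺ {zero}  {[]}    t eq inv col = []
    tabulate-sameInversions⁺ {suc n} {a ∷ w} t eq inv col with refl , col′ ← List.∷-injective col =
      PW-tabulate⁺ (t ∘ suc) (ℕ.suc-injective eq) (λ j → inv zero (suc j) ℕ.z<s)
      ∷ tabulate-sameInversions⁺ (t ∘ suc) (ℕ.suc-injective eq) (λ i j i<j → inv (suc i) (suc j) (s≤s i<j)) col′

    tabulate-sameInversions⁻ : ∀ {n w} (t : Fin n → ℕ × Color) (eq : length w ≡ n) →
      SameInversions X ℕ< w (tabulate t) → Inversions w eq t
    tabulate-sameInversions⁻ {suc n} {a ∷ w} t eq (r ∷ rs) zero    (suc j) i<j       = PW-tabulate⁻ (t ∘ suc) (ℕ.suc-injective eq) r j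
    tabulate-sameInversions⁻ {suc n} {a ∷ w} t eq (r ∷ rs) (suc i) (suc j) (s≤s i<j) =
      tabulate-sameInversions⁻ (t ∘ suc) (ℕ.suc-injective eq) rs i j i<j

    colors-sameInversions : ∀ {w w′} → SameInversions X ℕ< w w′ → map proj₂ w ≡ map proj₂ w′
    colors-sameInversions []       = refl
    colors-sameInversions (_ ∷ rs) = cong (_ ∷_) (colors-sameInversions rs)

  tabulate-lookup : ∀ {n} (u : Vec Color n) → tabulate (Vec.lookup u) ≡ Vec.toList u
  tabulate-lookup Vec.[]      = refl
  tabulate-lookup (c Vec.∷ u) = cong (c ∷_) (tabulate-lookup u)

  -- A word has the same inversions as its standardization, and a permutation is its own
  -- standardization. Hence having the inversions and colors of `word α` amounts to standardizing to
  -- it.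
  isStd⇔std≡ : ∀ X w α → IsStd X w α ⇔ std X w ≡ word α
  isStd⇔std≡ X w α = mk⇔
    (λ s → trans (std-cong X ℕ< (tabulate-sameInversions⁺ X _ (IsStd.same-size s) (IsStd.same-inversions s)
                   (trans (IsStd.same-colors s) (sym (tabulate-lookup (colors α))))))
                 (std-perm (word-isPerm α)))
    (λ eq → let r = subst (SameInversions X ℕ< w) eq (std-sameInversions X w)
                n = trans (length-cong X ℕ< r) (length-word α)
            in record
      { same-size       = n
      ; same-inversions = tabulate-sameInversions⁻ X _ n r
      ; same-colors     = trans (colors-sameInversions X r) (trans (List.map-tabulate _ proj₂) (tabulate-lookup (colors α)))
      })

  -- Shuffles of words with disjoint sets of letters

  module _ {X : Set} where

    ∈-shuffles-left : ∀ {x p} (xs ys : List X) → p ∈ shuffles xs ys → x ∷ p ∈ shuffles (x ∷ xs) ys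
    ∈-shuffles-left xs []       p∈ with here refl ← subst (_ ∈_) (shuffles-[] xs) p∈ = here refl
    ∈-shuffles-left xs (y ∷ ys) p∈ = Mem.∈-++⁺ˡ (Mem.∈-map⁺ _ p∈)

    ∈-shuffles-right : ∀ {y p} (xs ys : List X) → p ∈ shuffles xs ys → y ∷ p ∈ shuffles xs (y ∷ ys)
    ∈-shuffles-right []       ys (here refl) = here refl
    ∈-shuffles-right (x ∷ xs) ys p∈          = Mem.∈-++⁺ʳ (map (x ∷_) (shuffles xs (_ ∷ ys))) (Mem.∈-map⁺ _ p∈)

    module _ {P : Pred X 0ℓ} (P? : Decidable P) where

      filter-shuffles-left : ∀ {xs ys} → All P xs → All (¬_ ∘ P) ys → All (λ z → filter P? z ≡ xs) (shuffles xs ys)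
      filter-shuffles-left []         ¬pys         = List.filter-none P? ¬pys ∷ []
      filter-shuffles-left (px ∷ pxs) []           = List.filter-all P? (px ∷ pxs) ∷ []
      filter-shuffles-left (px ∷ pxs) (¬py ∷ ¬pys) = All.++⁺
        (All.map⁺ (All.map (λ eq → trans (List.filter-accept P? px) (cong (_ ∷_) eq)) (filter-shuffles-left pxs (¬py ∷ ¬pys))))
        (All.map⁺ (All.map (trans (List.filter-reject P? ¬py)) (filter-shuffles-left (px ∷ pxs) ¬pys)))

      filter-shuffles-right : ∀ {xs ys} → All (¬_ ∘ P) xs → All P ys → All (λ z → filter P? z ≡ ys) (shuffles xs ys)
      filter-shuffles-right []           pys        = List.filter-all P? pys ∷ []
      filter-shuffles-right (¬px ∷ ¬pxs) []         = List.filter-none P? (¬px ∷ ¬pxs) ∷ []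
      filter-shuffles-right (¬px ∷ ¬pxs) (py ∷ pys) = All.++⁺
        (All.map⁺ (All.map (trans (List.filter-reject P? ¬px)) (filter-shuffles-right ¬pxs (py ∷ pys))))
        (All.map⁺ (All.map (λ eq → trans (List.filter-accept P? py) (cong (_ ∷_) eq)) (filter-shuffles-right (¬px ∷ ¬pxs) pys)))

    -- P tells from the first letter of a shuffle which word that letter came from, so the two
    -- halves of the recursion are disjoint.
    shuffles-unique : ∀ {P : Pred X 0ℓ} {xs ys} → All P xs → All (¬_ ∘ P) ys → Unique (shuffles xs ys)
    shuffles-unique []         ¬pys         = [] AllPairs.∷ AllPairs.[]
    shuffles-unique (px ∷ pxs) []           = [] AllPairs.∷ AllPairs.[]
    shuffles-unique (px ∷ pxs) (¬py ∷ ¬pys) = Unique.++⁺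
      (Unique.map⁺ List.∷-injectiveʳ (shuffles-unique pxs (¬py ∷ ¬pys)))
      (Unique.map⁺ List.∷-injectiveʳ (shuffles-unique (px ∷ pxs) ¬pys))
      λ (z∈ˡ , z∈ʳ) → case Mem.∈-map⁻ _ z∈ˡ , Mem.∈-map⁻ _ z∈ʳ of λ
        { ((_ , _ , refl) , (_ , _ , eq)) → ¬py (subst _ (List.∷-injectiveˡ eq) px) }

  shift-hi : ∀ k p → shift k (hi k p) ≡ hi↑ k p
  shift-hi k p = trans (sym (List.map-∘ (hi↑ k p)))
    (List.map-id-local (All.map (λ {(s , c)} k≤s → cong (_, c) (ℕ.m∸n+n≡m k≤s)) (All.all-filter (λ a → k ℕ.≤? proj₁ a) p)))

  ∈-shuffles-lo-hi : ∀ k p → p ∈ shuffles (lo k p) (hi↑ k p)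
  ∈-shuffles-lo-hi k []      = here refl
  ∈-shuffles-lo-hi k (a ∷ p) with ℕ.<-≤-connex (proj₁ a) k
  ... | inj₁ s<k rewrite List.filter-accept (λ a → proj₁ a ℕ.<? k) {a} {p} s<k
                       | List.filter-reject (λ a → k ℕ.≤? proj₁ a) {a} {p} (ℕ.<⇒≱ s<k) = ∈-shuffles-left (lo k p) (hi↑ k p) (∈-shuffles-lo-hi k p)
  ... | inj₂ k≤s rewrite List.filter-reject (λ a → proj₁ a ℕ.<? k) {a} {p} (ℕ.≤⇒≯ k≤s)
                       | List.filter-accept (λ a → k ℕ.≤? proj₁ a) {a} {p} k≤s = ∈-shuffles-right (lo k p) (hi↑ k p) (∈-shuffles-lo-hi k p)

  shift-bounded : ∀ k p → All (λ a → k ≤ proj₁ a) (shift k p)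
  shift-bounded k p = All.map⁺ (All.universal (λ (s , _) → ℕ.m≤n+m k s) p)

  shifted-shuffles-unique : ∀ {q} r → IsPerm q → Unique (shuffles q (shift (length q) r))
  shifted-shuffles-unique {q} r h = shuffles-unique (perm-bounded h) (All.map ℕ.≤⇒≯ (shift-bounded (length q) r))

  -- The letters of q are below its length and those of the shifted r are not, so filtering recovers
  -- both; conversely every word is a shuffle of its small and large letters. The inequality places
  -- `length q` in the index range of the coproduct.
  ∈-shifted-shuffles : ∀ {p q r} → IsPerm q →
    p ∈ shuffles q (shift (length q) r) ⇔ (length q ≤ length p × lo (length q) p ≡ q × hi (length q) p ≡ r)
  ∈-shifted-shuffles {p} {q} {r} h = mk⇔
    (λ p∈ →
      let k   = length q
          lo≡ = All.lookup (filter-shuffles-left (λ a → proj₁ a ℕ.<? k) (perm-bounded h) (All.map ℕ.≤⇒≯ (shift-bounded k r))) p∈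
          hi≡ = All.lookup (filter-shuffles-right (λ a → k ℕ.≤? proj₁ a) (All.map ℕ.<⇒≱ (perm-bounded h)) (shift-bounded k r)) p∈
      in subst (λ q′ → length q′ ≤ length p) lo≡ (List.length-filter (λ a → proj₁ a ℕ.<? k) p)
       , lo≡
       , trans (cong (map _) hi≡) (trans (sym (List.map-∘ r)) (List.map-id-local (All.universal (λ (s , c) → cong (_, c) (ℕ.m+n∸n≡m s k)) r))))
    (λ (_ , lo≡ , hi≡) → subst (p ∈_) (lo-hi lo≡ hi≡) (∈-shuffles-lo-hi (length q) p))
    where
    lo-hi : lo (length q) p ≡ q → hi (length q) p ≡ r → shuffles (lo (length q) p) (hi↑ (length q) p) ≡ shuffles q (shift (length q) r)
    lo-hi lo≡ hi≡ = cong₂ shuffles lo≡ (trans (sym (shift-hi (length q) p)) (cong (shift (length q)) hi≡))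

  -- Standardization over the ordered sum of two alphabets

  ℕ⊕ℕ : StrictTotalOrder 0ℓ 0ℓ 0ℓ
  ℕ⊕ℕ = LeftOrder.⊎-<-strictTotalOrder {d = 0ℓ} {e = 0ℓ} {f = 0ℓ} ℕ< ℕ<

  private
    inj₁-mono : ∀ x y → x ℕ.< y ⇔ StrictTotalOrder._<_ ℕ⊕ℕ (inj₁ x) (inj₁ y)
    inj₁-mono x y = mk⇔ ₁∼₁ LeftOrder.drop-inj₁

    inj₂-mono : ∀ x y → x ℕ.< y ⇔ StrictTotalOrder._<_ ℕ⊕ℕ (inj₂ x) (inj₂ y)
    inj₂-mono x y = mk⇔ ₂∼₂ LeftOrder.drop-inj₂

  left right : Word ℕ → Word (ℕ ⊎ ℕ)
  left  = map (map₁ inj₁)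
  right = map (map₁ inj₂)

  std-left : ∀ w → std ℕ⊕ℕ (left w) ≡ std ℕ< w
  std-left = std-map {ℕ<} {ℕ⊕ℕ} inj₁-mono

  std-right : ∀ w → std ℕ⊕ℕ (right w) ≡ std ℕ< w
  std-right = std-map {ℕ<} {ℕ⊕ℕ} inj₂-mono

  rank-left : ∀ x v w → All (λ z → rank ℕ⊕ℕ (inj₁ x) z ≡ rank ℕ< x v) (shuffles (left v) (right w))
  rank-left x v w = All.map (λ eq → trans eq (trans
    (cong₂ ℕ._+_ (rank-map {ℕ<} {ℕ⊕ℕ} inj₁-mono x v) (rank-none ℕ⊕ℕ (All.map⁺ (All.universal (λ _ ()) w))))
    (ℕ.+-identityʳ _))) (rank-shuffles ℕ⊕ℕ (inj₁ x) (left v) (right w))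

  -- Every letter of v lies below `inj₂ y`; this is the origin of the shift by `length v`.
  rank-right : ∀ y v w → All (λ z → rank ℕ⊕ℕ (inj₂ y) z ≡ rank ℕ< y w ℕ.+ length v) (shuffles (left v) (right w))
  rank-right y v w = All.map (λ eq → trans eq (trans
    (cong₂ ℕ._+_ (trans (rank-all ℕ⊕ℕ (All.map⁺ (All.universal (λ _ → ₁∼₂) v))) (List.length-map _ v)) (rank-map {ℕ<} {ℕ⊕ℕ} inj₂-mono y w))
    (ℕ.+-comm (length v) _))) (rank-shuffles ℕ⊕ℕ (inj₂ y) (left v) (right w))

  -- The equality is one of lists, so sums over shuffles transfer at once. All shuffles in one half
  -- of the recursion give their first letter the same rank, so a single `bump` passes inside
  -- `shuffles`. A first letter from the left has rank at most n, which turns the shift by n of the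
  -- right word into a shift by n + 1; a first letter from the right ranks above all left letters
  -- and fixes them.
  std-shuffles : ∀ v w → map (std ℕ⊕ℕ) (shuffles (left v) (right w)) ≡ shuffles (std ℕ< v) (shift (length v) (std ℕ< w))
  std-shuffles []            w             = cong [_] (trans (std-right w)
    (sym (List.map-id-local (All.universal (λ (s , c) → cong (_, c) (ℕ.+-identityʳ s)) (std ℕ< w)))))
  std-shuffles ((x , c) ∷ v) []            = cong [_] (std-left ((x , c) ∷ v))
  std-shuffles ((x , c) ∷ v) ((y , d) ∷ w) = begin
    map (std ℕ⊕ℕ) (map ((inj₁ x , c) ∷_) (shuffles (left v) (right (b ∷ w))) ++ map ((inj₂ y , d) ∷_) (shuffles (left (a ∷ v)) (right w)))
      ≡⟨ List.map-++ (std ℕ⊕ℕ) (map _ (shuffles (left v) (right (b ∷ w)))) _ ⟩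
    map (std ℕ⊕ℕ) (map ((inj₁ x , c) ∷_) (shuffles (left v) (right (b ∷ w)))) ++ map (std ℕ⊕ℕ) (map ((inj₂ y , d) ∷_) (shuffles (left (a ∷ v)) (right w)))
      ≡⟨ cong₂ _++_
           (head-std (inj₁ x) c r _ (std ℕ< v) (shift n (std ℕ< (b ∷ w))) (rank-left x v (b ∷ w)) (std-shuffles v ((y , d) ∷ w)))
           (head-std (inj₂ y) d (s ℕ.+ suc n) _ (std ℕ< (a ∷ v)) (shift (suc n) (std ℕ< w)) (rank-right y (a ∷ v) w) (std-shuffles ((x , c) ∷ v) w)) ⟩
    map ((r , c) ∷_) (shuffles (bumps r (std ℕ< v)) (bumps r (shift n (std ℕ< (b ∷ w)))))
    ++ map ((s ℕ.+ suc n , d) ∷_) (shuffles (bumps (s ℕ.+ suc n) (std ℕ< (a ∷ v))) (bumps (s ℕ.+ suc n) (shift (suc n) (std ℕ< w))))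
      ≡⟨ cong₂ (λ u t → map ((r , c) ∷_) (shuffles (bumps r (std ℕ< v)) u) ++ map ((s ℕ.+ suc n , d) ∷_) t)
           shift-suc (cong₂ shuffles bumps-std bumps-shift) ⟩
    shuffles (std ℕ< (a ∷ v)) (shift (suc n) (std ℕ< (b ∷ w))) ∎
    where
    open ≡-Reasoning
    a b : ℕ × Color
    a = x , c
    b = y , d

    n r s : ℕ
    n = length v
    r = rank ℕ< x v
    s = rank ℕ< y w

    bumps : ℕ → Word ℕ → Word ℕ
    bumps t = map (map₁ (bump t))

    head-std : ∀ x c t L p q → All (λ z → rank ℕ⊕ℕ x z ≡ t) L → map (std ℕ⊕ℕ) L ≡ shuffles p q →
               map (std ℕ⊕ℕ) (map ((x , c) ∷_) L) ≡ map ((t , c) ∷_) (shuffles (bumps t p) (bumps t q))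
    head-std x c t L p q ranks eq = begin
      map (std ℕ⊕ℕ) (map ((x , c) ∷_) L)                      ≡⟨ List.map-∘ L ⟨
      map (λ z → std ℕ⊕ℕ ((x , c) ∷ z)) L                     ≡⟨ List.map-cong-local (All.map (λ {z} → cong λ t → (t , c) ∷ bumps t (std ℕ⊕ℕ z)) ranks) ⟩
      map (λ z → (t , c) ∷ bumps t (std ℕ⊕ℕ z)) L             ≡⟨ List.map-∘ L ⟩
      map ((t , c) ∷_) (map (bumps t ∘ std ℕ⊕ℕ) L)            ≡⟨ cong (map _) (List.map-∘ L) ⟩
      map ((t , c) ∷_) (map (bumps t) (map (std ℕ⊕ℕ) L))      ≡⟨ cong (map _ ∘ map _) eq ⟩
      map ((t , c) ∷_) (map (bumps t) (shuffles p q))         ≡⟨ cong (map _) (map-shuffles (map₁ (bump t)) p q) ⟨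
      map ((t , c) ∷_) (shuffles (bumps t p) (bumps t q))     ∎

    shift-suc : bumps r (shift n (std ℕ< (b ∷ w))) ≡ shift (suc n) (std ℕ< (b ∷ w))
    shift-suc = trans (sym (List.map-∘ (std ℕ< (b ∷ w)))) (List.map-cong
      (λ (t , e) → cong (_, e) (trans (bump-above (ℕ.≤-trans (rank-≤ ℕ< x v) (ℕ.m≤n+m n t))) (sym (ℕ.+-suc t n)))) (std ℕ< (b ∷ w)))

    bumps-std : bumps (s ℕ.+ suc n) (std ℕ< (a ∷ v)) ≡ std ℕ< (a ∷ v)
    bumps-std = List.map-id-local (All.map (λ {(t , e)} t<n → cong (_, e)
      (bump-below (ℕ.<-≤-trans (subst (t ℕ.<_) (length-std ℕ< (a ∷ v)) t<n) (ℕ.m≤n+m (suc n) s))))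
      (perm-bounded (std-isPerm ℕ< (a ∷ v))))

    bumps-shift : bumps (s ℕ.+ suc n) (shift (suc n) (std ℕ< w)) ≡ shift (suc n) (bumps s (std ℕ< w))
    bumps-shift = trans (sym (List.map-∘ (std ℕ< w))) (trans
      (List.map-cong (λ (t , e) → cong (_, e) (bump-+ (suc n) s t)) (std ℕ< w)) (List.map-∘ (std ℕ< w)))

-- Linear maps and finite sums

module Linear {k ℓk : Level} (K : CommutativeRing k ℓk) where
  open CommutativeRing K using (ring; _*_; 0#; 1#) renaming (Carrier to 𝕂; _≈_ to _≈ᴷ_)
  private module K = CommutativeRing K
  open LinearAlgebra K

  𝕂ᴹ : LeftModule ring k ℓk
  𝕂ᴹ = TensorUnit.leftModule

  module _ {m ℓm n ℓn} (M : LeftModule ring m ℓm) (N : LeftModule ring n ℓn) where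
    private
      module M = LeftModule M
      module N = LeftModule N
      module N-group = AbelianGroupProperties N.+ᴹ-abelianGroup

    mkLinear : (f : M.Carrierᴹ → N.Carrierᴹ) →
      (∀ {x y} → x M.≈ᴹ y → f x N.≈ᴹ f y) →
      (∀ x y → f (x M.+ᴹ y) N.≈ᴹ f x N.+ᴹ f y) →
      (∀ c x → f (c M.*ₗ x) N.≈ᴹ c N.*ₗ f x) → IsLinear M N f
    mkLinear f f-cong f-+ f-* = record
      { +ᴹ-isGroupHomomorphism = record
        { isMonoidHomomorphism = record
          { isMagmaHomomorphism = record { isRelHomomorphism = record { cong = f-cong } ; homo = f-+ }
          ; ε-homo = f-0
          }
        ; ⁻¹-homo = λ x → N-group.inverseˡ-unique _ _
            (N.≈ᴹ-trans (N.≈ᴹ-sym (f-+ _ _)) (N.≈ᴹ-trans (f-cong (M.-ᴹ‿inverseˡ x)) f-0))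
        }
      ; *ₗ-homo = f-*
      }
      where
      f-0 : f M.0ᴹ N.≈ᴹ N.0ᴹ
      f-0 = N.≈ᴹ-trans (f-cong (M.≈ᴹ-sym (M.*ₗ-zeroˡ M.0ᴹ))) (N.≈ᴹ-trans (f-* 0# M.0ᴹ) (N.*ₗ-zeroˡ _))

  module IsLinear {m ℓm n ℓn} {M : LeftModule ring m ℓm} {N : LeftModule ring n ℓn} {f} (f-linear : IsLinear M N f) where
    private
      module M = LeftModule M
      module N = LeftModule N
    open LeftModuleMorphisms.IsLeftModuleHomomorphism f-linear public using (⟦⟧-cong; +ᴹ-homo; *ₗ-homo; 0ᴹ-homo)

    ∑-homo : ∀ xs → f (∑ M xs) N.≈ᴹ ∑ N (map f xs)
    ∑-homo []       = 0ᴹ-homo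
    ∑-homo (x ∷ xs) = N.≈ᴹ-trans (+ᴹ-homo x _) (N.+ᴹ-congˡ (∑-homo xs))

    value-homo : ∀ {i} {I : Set i} (e : I → M.Carrierᴹ) xs → f (value M e xs) N.≈ᴹ value N (f ∘ e) xs
    value-homo e []             = 0ᴹ-homo
    value-homo e ((c , i) ∷ xs) = N.≈ᴹ-trans (+ᴹ-homo _ _) (N.+ᴹ-cong (*ₗ-homo c (e i)) (value-homo e xs))

    ∑<-homo : ∀ n (g : ℕ → M.Carrierᴹ) → f (∑ M (applyUpTo g n)) N.≈ᴹ ∑ N (applyUpTo (f ∘ g) n)
    ∑<-homo n g = N.≈ᴹ-trans (∑-homo (applyUpTo g n)) (N.≈ᴹ-reflexive (cong (∑ N) (List.map-applyUpTo g f n)))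

  module _ {m ℓm n ℓn} {M : LeftModule ring m ℓm} {N : LeftModule ring n ℓn} where
    private module N = LeftModule N

    linear-resp : ∀ {f g} → (∀ x → f x N.≈ᴹ g x) → IsLinear M N f → IsLinear M N g
    linear-resp f≈g f-linear = mkLinear M N _
      (λ x≈y → N.≈ᴹ-trans (N.≈ᴹ-sym (f≈g _)) (N.≈ᴹ-trans (f.⟦⟧-cong x≈y) (f≈g _)))
      (λ x y → N.≈ᴹ-trans (N.≈ᴹ-sym (f≈g _)) (N.≈ᴹ-trans (f.+ᴹ-homo x y) (N.+ᴹ-cong (f≈g x) (f≈g y))))
      (λ c x → N.≈ᴹ-trans (N.≈ᴹ-sym (f≈g _)) (N.≈ᴹ-trans (f.*ₗ-homo c x) (N.*ₗ-congˡ (f≈g x))))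
      where module f = IsLinear {M = M} {N = N} f-linear

  module _ {l ℓl m ℓm n ℓn} {L : LeftModule ring l ℓl} {M : LeftModule ring m ℓm} {N : LeftModule ring n ℓn} where
    private module N = LeftModule N

    ∘-linear : ∀ {f g} → IsLinear M N g → IsLinear L M f → IsLinear L N (g ∘ f)
    ∘-linear g-linear f-linear = mkLinear L N _ (g.⟦⟧-cong ∘ f.⟦⟧-cong)
      (λ x y → N.≈ᴹ-trans (g.⟦⟧-cong (f.+ᴹ-homo x y)) (g.+ᴹ-homo _ _))
      (λ c x → N.≈ᴹ-trans (g.⟦⟧-cong (f.*ₗ-homo c x)) (g.*ₗ-homo c _))
      where
      module f = IsLinear {M = L} {N = M} f-linear
      module g = IsLinear {M = M} {N = N} g-linear

  module Sums {m ℓm} (M : LeftModule ring m ℓm) where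
    open LeftModule M
    open import Relation.Binary.Reasoning.Setoid ≈ᴹ-setoid

    +ᴹ-interchange : ∀ w x y z → (w +ᴹ x) +ᴹ (y +ᴹ z) ≈ᴹ (w +ᴹ y) +ᴹ (x +ᴹ z)
    +ᴹ-interchange w x y z = begin
      (w +ᴹ x) +ᴹ (y +ᴹ z) ≈⟨ +ᴹ-assoc w x _ ⟩
      w +ᴹ (x +ᴹ (y +ᴹ z)) ≈⟨ +ᴹ-congˡ (+ᴹ-assoc x y z) ⟨
      w +ᴹ ((x +ᴹ y) +ᴹ z) ≈⟨ +ᴹ-congˡ (+ᴹ-congʳ (+ᴹ-comm x y)) ⟩
      w +ᴹ ((y +ᴹ x) +ᴹ z) ≈⟨ +ᴹ-congˡ (+ᴹ-assoc y x z) ⟩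
      w +ᴹ (y +ᴹ (x +ᴹ z)) ≈⟨ +ᴹ-assoc w y _ ⟨
      (w +ᴹ y) +ᴹ (x +ᴹ z) ∎

    ∑-++ : ∀ xs ys → ∑ M (xs ++ ys) ≈ᴹ ∑ M xs +ᴹ ∑ M ys
    ∑-++ []       ys = ≈ᴹ-sym (+ᴹ-identityˡ _)
    ∑-++ (x ∷ xs) ys = ≈ᴹ-trans (+ᴹ-congˡ (∑-++ xs ys)) (≈ᴹ-sym (+ᴹ-assoc _ _ _))

    module _ {a} {A : Set a} where

      ∑-cong : ∀ {f g : A → Carrierᴹ} xs → (∀ {x} → x ∈ xs → f x ≈ᴹ g x) → ∑ M (map f xs) ≈ᴹ ∑ M (map g xs)
      ∑-cong []       f≈g = ≈ᴹ-refl
      ∑-cong (x ∷ xs) f≈g = +ᴹ-cong (f≈g (here refl)) (∑-cong xs (f≈g ∘ there))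

      ∑-0 : ∀ {f : A → Carrierᴹ} xs → (∀ {x} → x ∈ xs → f x ≈ᴹ 0ᴹ) → ∑ M (map f xs) ≈ᴹ 0ᴹ
      ∑-0 []       f≈0 = ≈ᴹ-refl
      ∑-0 (x ∷ xs) f≈0 = ≈ᴹ-trans (+ᴹ-cong (f≈0 (here refl)) (∑-0 xs (f≈0 ∘ there))) (+ᴹ-identityˡ _)

      ∑-+ : ∀ (f g : A → Carrierᴹ) xs → ∑ M (map (λ x → f x +ᴹ g x) xs) ≈ᴹ ∑ M (map f xs) +ᴹ ∑ M (map g xs)
      ∑-+ f g []       = ≈ᴹ-sym (+ᴹ-identityˡ _)
      ∑-+ f g (x ∷ xs) = ≈ᴹ-trans (+ᴹ-congˡ (∑-+ f g xs)) (+ᴹ-interchange _ _ _ _)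

      ∑-* : ∀ c (f : A → Carrierᴹ) xs → ∑ M (map (λ x → c *ₗ f x) xs) ≈ᴹ c *ₗ ∑ M (map f xs)
      ∑-* c f []       = ≈ᴹ-sym (*ₗ-zeroʳ c)
      ∑-* c f (x ∷ xs) = ≈ᴹ-trans (+ᴹ-congˡ (∑-* c f xs)) (≈ᴹ-sym (*ₗ-distribˡ c _ _))

    ∑< : ℕ → (ℕ → Carrierᴹ) → Carrierᴹ
    ∑< n f = ∑ M (applyUpTo f n)

    ∑<-cong : ∀ {n f g} → (∀ {i} → i ℕ.< n → f i ≈ᴹ g i) → ∑< n f ≈ᴹ ∑< n g
    ∑<-cong {zero}  f≈g = ≈ᴹ-refl
    ∑<-cong {suc n} f≈g = +ᴹ-cong (f≈g ℕ.z<s) (∑<-cong (f≈g ∘ s≤s))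

    ∑<-0 : ∀ {n f} → (∀ {i} → i ℕ.< n → f i ≈ᴹ 0ᴹ) → ∑< n f ≈ᴹ 0ᴹ
    ∑<-0 {zero}  f≈0 = ≈ᴹ-refl
    ∑<-0 {suc n} f≈0 = ≈ᴹ-trans (+ᴹ-cong (f≈0 ℕ.z<s) (∑<-0 {n} (f≈0 ∘ s≤s))) (+ᴹ-identityˡ _)

    ∑<-+ : ∀ n f g → ∑< n (λ i → f i +ᴹ g i) ≈ᴹ ∑< n f +ᴹ ∑< n g
    ∑<-+ zero    f g = ≈ᴹ-sym (+ᴹ-identityˡ _)
    ∑<-+ (suc n) f g = ≈ᴹ-trans (+ᴹ-congˡ (∑<-+ n (f ∘ suc) (g ∘ suc))) (+ᴹ-interchange _ _ _ _)

    ∑<-* : ∀ n c f → ∑< n (λ i → c *ₗ f i) ≈ᴹ c *ₗ ∑< n f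
    ∑<-* zero    c f = ≈ᴹ-sym (*ₗ-zeroʳ c)
    ∑<-* (suc n) c f = ≈ᴹ-trans (+ᴹ-congˡ (∑<-* n c (f ∘ suc))) (≈ᴹ-sym (*ₗ-distribˡ c _ _))

    ∑<-single : ∀ {n f i} → i ℕ.< n → (∀ {j} → j ℕ.< n → j ≢ i → f j ≈ᴹ 0ᴹ) → ∑< n f ≈ᴹ f i
    ∑<-single {suc n} {i = zero}  i<n       f≈0 = ≈ᴹ-trans (+ᴹ-congˡ (∑<-0 {n} (λ j<n → f≈0 (s≤s j<n) λ ()))) (+ᴹ-identityʳ _)
    ∑<-single {suc n} {i = suc i} (s≤s i<n) f≈0 = ≈ᴹ-trans
      (+ᴹ-cong (f≈0 ℕ.z<s λ ()) (∑<-single {n} i<n (λ j<n j≢i → f≈0 (s≤s j<n) (j≢i ∘ ℕ.suc-injective)))) (+ᴹ-identityˡ _)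

    -- Both sides run over the pairs j, i with j + i ≤ n, on the left with k = j + i; the induction
    -- splits off the terms with j = 0.
    ∑<-triangle : ∀ n (F : ℕ → ℕ → Carrierᴹ) →
      ∑< (suc n) (λ k → ∑< (suc k) λ j → F j (k ∸ j)) ≈ᴹ ∑< (suc n) (λ j → ∑< (suc (n ∸ j)) (F j))
    ∑<-triangle zero    F = ≈ᴹ-refl
    ∑<-triangle (suc n) F = begin
      (F 0 0 +ᴹ 0ᴹ) +ᴹ ∑< (suc n) (λ k → F 0 (suc k) +ᴹ ∑< (suc k) (λ j → F (suc j) (k ∸ j)))
        ≈⟨ +ᴹ-cong (+ᴹ-identityʳ _) (∑<-+ (suc n) (F 0 ∘ suc) (λ k → ∑< (suc k) λ j → F (suc j) (k ∸ j))) ⟩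
      F 0 0 +ᴹ (∑< (suc n) (F 0 ∘ suc) +ᴹ ∑< (suc n) (λ k → ∑< (suc k) λ j → F (suc j) (k ∸ j)))
        ≈⟨ +ᴹ-assoc _ _ _ ⟨
      ∑< (suc (suc n)) (F 0) +ᴹ ∑< (suc n) (λ k → ∑< (suc k) λ j → F (suc j) (k ∸ j))
        ≈⟨ +ᴹ-congˡ (∑<-triangle n (F ∘ suc)) ⟩
      ∑< (suc (suc n)) (λ j → ∑< (suc (suc n ∸ j)) (F j)) ∎

  module _ {m ℓm n ℓn} {M : LeftModule ring m ℓm} {N : LeftModule ring n ℓn} {a} {A : Set a}
           {φ : A → LeftModule.Carrierᴹ M → LeftModule.Carrierᴹ N} where
    open Sums N

    ∑-linear : (∀ a → IsLinear M N (φ a)) → ∀ xs → IsLinear M N (λ x → ∑ N (map (λ a → φ a x) xs))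
    ∑-linear φ-linear xs = mkLinear M N _
      (λ x≈y → ∑-cong xs λ {a} _ → φ.⟦⟧-cong a x≈y)
      (λ x y → N.≈ᴹ-trans (∑-cong xs λ {a} _ → φ.+ᴹ-homo a x y) (∑-+ _ _ xs))
      (λ c x → N.≈ᴹ-trans (∑-cong xs λ {a} _ → φ.*ₗ-homo a c x) (∑-* c _ xs))
      where
      module N = LeftModule N
      module φ a = IsLinear {M = M} {N = N} (φ-linear a)

  -- Coefficients of formal linear combinations

  module Delta {j} {J : Set j} (_≟_ : DecidableEquality J) where

    δ : J → J → 𝕂
    δ i j = if does (i ≟ j) then 1# else 0#

    δ-≡ : ∀ {i j} → i ≡ j → δ i j ≡ 1#
    δ-≡ {i} {j} i≡j with i ≟ j
    ... | yes _  = refl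
    ... | no i≢j = contradiction i≡j i≢j

    δ-≢ : ∀ {i j} → i ≢ j → δ i j ≡ 0#
    δ-≢ {i} {j} i≢j with i ≟ j
    ... | yes i≡j = contradiction i≡j i≢j
    ... | no  _   = refl

    δ-sym : ∀ i j → δ i j ≡ δ j i
    δ-sym i j = cong (if_then 1# else 0#) (does-⇔ (mk⇔ sym sym) (i ≟ j) (j ≟ i))

    -- A list may name the same vector several times, so entries are collected by a key with
    -- decidable equality. For colored permutations the key is the word.
    coefficient : ∀ {i} {I : Set i} → (I → J) → List (𝕂 × I) → J → 𝕂
    coefficient key xs j = value 𝕂ᴹ (λ i → δ (key i) j) xs

    module _ {n ℓn} (N : LeftModule ring n ℓn) (F : J → LeftModule.Carrierᴹ N) where
      open LeftModule N
      open Sums N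

      δ-≢-*ₗ : ∀ {i j} → i ≢ j → δ i j *ₗ F j ≈ᴹ 0ᴹ
      δ-≢-*ₗ i≢j rewrite δ-≢ i≢j = *ₗ-zeroˡ _

      ∑-δ-∉ : ∀ {i U} → i ∉ U → ∑ N (map (λ j → δ i j *ₗ F j) U) ≈ᴹ 0ᴹ
      ∑-δ-∉ {i} {U} i∉U = ∑-0 U λ {j} j∈U → δ-≢-*ₗ {i} {j} λ { refl → i∉U j∈U }

      ∑-δ : ∀ {i U} → Unique U → i ∈ U → ∑ N (map (λ j → δ i j *ₗ F j) U) ≈ᴹ F i
      ∑-δ {i} (i≢ AllPairs.∷ _) (here refl) rewrite δ-≡ {i} refl = ≈ᴹ-trans
        (+ᴹ-cong (*ₗ-identityˡ _) (∑-δ-∉ λ i∈ → All.lookup i≢ i∈ refl)) (+ᴹ-identityʳ _)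
      ∑-δ (i≢ AllPairs.∷ U!) (there i∈) = ≈ᴹ-trans
        (+ᴹ-cong (δ-≢-*ₗ λ { refl → All.lookup i≢ i∈ refl }) (∑-δ U! i∈)) (+ᴹ-identityˡ _)

      module _ {i} {I : Set i} (key : I → J) where
        open import Relation.Binary.Reasoning.Setoid ≈ᴹ-setoid

        private
          keys : List (𝕂 × I) → List J
          keys = map (key ∘ proj₂)

        value-as-∑ : ∀ {U} → Unique U → ∀ xs → (∀ {j} → j ∈ keys xs → j ∈ U) →
                     value N (F ∘ key) xs ≈ᴹ ∑ N (map (λ j → coefficient key xs j *ₗ F j) U)
        value-as-∑ {U} U! []             ⊆U = ≈ᴹ-sym (∑-0 U λ {j} _ → *ₗ-zeroˡ (F j))
        value-as-∑ {U} U! ((c , i) ∷ xs) ⊆U = begin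
          c *ₗ F (key i) +ᴹ value N (F ∘ key) xs
            ≈⟨ +ᴹ-cong (*ₗ-congˡ (≈ᴹ-sym (∑-δ U! (⊆U (here refl))))) (value-as-∑ U! xs (⊆U ∘ there)) ⟩
          c *ₗ ∑ N (map (λ j → δ (key i) j *ₗ F j) U) +ᴹ ∑ N (map (λ j → coefficient key xs j *ₗ F j) U)
            ≈⟨ +ᴹ-congʳ (∑-* c _ U) ⟨
          ∑ N (map (λ j → c *ₗ (δ (key i) j *ₗ F j)) U) +ᴹ ∑ N (map (λ j → coefficient key xs j *ₗ F j) U)
            ≈⟨ ∑-+ _ _ U ⟨
          ∑ N (map (λ j → c *ₗ (δ (key i) j *ₗ F j) +ᴹ coefficient key xs j *ₗ F j) U)
            ≈⟨ ∑-cong U (λ {j} _ → ≈ᴹ-trans (*ₗ-distribʳ (F j) _ _) (+ᴹ-congʳ (*ₗ-assoc c _ _))) ⟨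
          ∑ N (map (λ j → coefficient key ((c , i) ∷ xs) j *ₗ F j) U) ∎

        -- Both combinations are rewritten over the finite set U of all keys that occur in either.
        -- Only coefficients at keys of generators are compared, as these are the ones that
        -- evaluation reads off. This is what makes maps out of a span well defined.
        value-determined : ∀ xs ys → (∀ i → coefficient key xs (key i) ≈ᴷ coefficient key ys (key i)) →
                           value N (F ∘ key) xs ≈ᴹ value N (F ∘ key) ys
        value-determined xs ys xs≈ys = begin
          value N (F ∘ key) xs                           ≈⟨ value-as-∑ U! xs (Mem.∈-deduplicate⁺ _≟_ ∘ Mem.∈-++⁺ˡ) ⟩
          ∑ N (map (λ j → coefficient key xs j *ₗ F j) U)    ≈⟨ ∑-cong U step ⟩
          ∑ N (map (λ j → coefficient key ys j *ₗ F j) U)    ≈⟨ value-as-∑ U! ys (Mem.∈-deduplicate⁺ _≟_ ∘ Mem.∈-++⁺ʳ (keys xs)) ⟨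
          value N (F ∘ key) ys                           ∎
          where
          U : List J
          U = deduplicate _≟_ (keys xs ++ keys ys)

          U! : Unique U
          U! = DecUnique.deduplicate-! _≟_ (keys xs ++ keys ys)

          step : ∀ {j} → j ∈ U → coefficient key xs j *ₗ F j ≈ᴹ coefficient key ys j *ₗ F j
          step j∈U with subst (_ ∈_) (sym (List.map-++ (key ∘ proj₂) xs ys)) (Mem.∈-deduplicate⁻ _≟_ (keys xs ++ keys ys) j∈U)
          ... | j∈ with (_ , i) , _ , refl ← Mem.∈-map⁻ (key ∘ proj₂) j∈ = *ₗ-congʳ (xs≈ys i)

  module _ {v ℓv i} (V : LeftModule ring v ℓv) {I : Set i} where
    open LeftModule V

    value-cong : ∀ {e e′ : I → Carrierᴹ} → (∀ i → e i ≈ᴹ e′ i) → ∀ xs → value V e xs ≈ᴹ value V e′ xs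
    value-cong e≈e′ []             = ≈ᴹ-refl
    value-cong e≈e′ ((c , i) ∷ xs) = +ᴹ-cong (*ₗ-congˡ (e≈e′ i)) (value-cong e≈e′ xs)

    module _ (e : I → Carrierᴹ) where

      value-++ : ∀ xs ys → value V e (xs ++ ys) ≈ᴹ value V e xs +ᴹ value V e ys
      value-++ []       ys = ≈ᴹ-sym (+ᴹ-identityˡ _)
      value-++ (x ∷ xs) ys = ≈ᴹ-trans (+ᴹ-congˡ (value-++ xs ys)) (≈ᴹ-sym (+ᴹ-assoc _ _ _))

      value-scale : ∀ c xs → value V e (map (map₁ (c *_)) xs) ≈ᴹ c *ₗ value V e xs
      value-scale c []       = ≈ᴹ-sym (*ₗ-zeroʳ c)
      value-scale c (x ∷ xs) = ≈ᴹ-trans (+ᴹ-cong (*ₗ-assoc _ _ _) (value-scale c xs)) (≈ᴹ-sym (*ₗ-distribˡ c _ _))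

    value-map : ∀ {j} {J : Set j} (e : J → Carrierᴹ) (g : I → J) (d : I → 𝕂) xs →
                value V e (map (λ i → d i , g i) xs) ≈ᴹ ∑ V (map (λ i → d i *ₗ e (g i)) xs)
    value-map e g d []       = ≈ᴹ-refl
    value-map e g d (x ∷ xs) = +ᴹ-congˡ (value-map e g d xs)

    value-cartesianProduct : ∀ {j} {J : Set j} (e : I × J → Carrierᴹ) xs ys →
      value V e (cartesianProductWith (λ (c , i) (d , j) → c * d , (i , j)) xs ys) ≈ᴹ value V (λ i → value V (λ j → e (i , j)) ys) xs
    value-cartesianProduct e []             ys = ≈ᴹ-refl
    value-cartesianProduct e ((c , i) ∷ xs) ys = ≈ᴹ-trans (vpp ys)
      (+ᴹ-congˡ (value-cartesianProduct e xs ys))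
      where
      rest = cartesianProductWith (λ (c , i) (d , j) → c * d , (i , j)) xs ys

      vpp : ∀ zs → value V e (map (λ (d , j) → c * d , (i , j)) zs ++ rest) ≈ᴹ c *ₗ value V (λ j → e (i , j)) zs +ᴹ value V e rest
      vpp []             = ≈ᴹ-sym (≈ᴹ-trans (+ᴹ-congʳ (*ₗ-zeroʳ c)) (+ᴹ-identityˡ _))
      vpp ((d , j) ∷ zs) = ≈ᴹ-trans (+ᴹ-cong (*ₗ-assoc c d _) (vpp zs))
        (≈ᴹ-trans (≈ᴹ-sym (+ᴹ-assoc _ _ _)) (+ᴹ-congʳ (≈ᴹ-sym (*ₗ-distribˡ c _ _))))

  -- Bilinear maps and tensor products

  module _ {m ℓm n ℓn} (M : LeftModule ring m ℓm) (N : LeftModule ring n ℓn) where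
    private
      module M = LeftModule M
      module N = LeftModule N
    open Tensor M N

    ⊗-linearˡ : ∀ y → IsLinear M (M ⊗ N) (λ x → [ x , y ])
    ⊗-linearˡ y = mkLinear M (M ⊗ N) _ (λ x≈x′ → ⊗-cong x≈x′ N.≈ᴹ-refl) (λ x x′ → ⊗-addˡ x x′ y) (λ c x → reflᵀ)

    ⊗-linearʳ : ∀ x → IsLinear N (M ⊗ N) (λ y → [ x , y ])
    ⊗-linearʳ x = mkLinear N (M ⊗ N) _ (⊗-cong M.≈ᴹ-refl) (⊗-addʳ x) (λ c y → symᵀ (⊗-scalar c x y))

    module _ {p ℓp} (P : LeftModule ring p ℓp) {B : M.Carrierᴹ → N.Carrierᴹ → LeftModule.Carrierᴹ P}
             (B-linearˡ : ∀ y → IsLinear M P (λ x → B x y)) (B-linearʳ : ∀ x → IsLinear N P (B x)) where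
      private
        module P = LeftModule P
        module Bˡ y = IsLinear {M = M} {N = P} (B-linearˡ y)
        module Bʳ x = IsLinear {M = N} {N = P} (B-linearʳ x)
      open Sums P

      private
        φ : LeftModule.Carrierᴹ (M ⊗ N) → P.Carrierᴹ
        φ t = ∑ P (map (λ (x , y) → B x y) t)

        φ-++ : ∀ s t → φ (s ++ t) P.≈ᴹ φ s P.+ᴹ φ t
        φ-++ s t = P.≈ᴹ-trans (P.≈ᴹ-reflexive (cong (∑ P) (List.map-++ _ s t))) (∑-++ (map _ s) (map _ t))

        φ-cong : ∀ {s t} → s ≈ᵀ t → φ s P.≈ᴹ φ t
        φ-cong reflᵀ            = P.≈ᴹ-refl
        φ-cong (symᵀ e)         = P.≈ᴹ-sym (φ-cong e)
        φ-cong (transᵀ e e′)    = P.≈ᴹ-trans (φ-cong e) (φ-cong e′)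
        φ-cong (+-congᵀ {s} {s′} {t} {t′} e e′) =
          P.≈ᴹ-trans (φ-++ s t) (P.≈ᴹ-trans (P.+ᴹ-cong (φ-cong e) (φ-cong e′)) (P.≈ᴹ-sym (φ-++ s′ t′)))
        φ-cong (+-commᵀ s t)    = P.≈ᴹ-trans (φ-++ s t) (P.≈ᴹ-trans (P.+ᴹ-comm _ _) (P.≈ᴹ-sym (φ-++ t s)))
        φ-cong (⊗-cong {x} {x′} {y} {y′} e e′) = P.+ᴹ-congʳ (P.≈ᴹ-trans (Bˡ.⟦⟧-cong y e) (Bʳ.⟦⟧-cong x′ e′))
        φ-cong (⊗-zeroˡ y)      = P.≈ᴹ-trans (P.+ᴹ-identityʳ _) (Bˡ.0ᴹ-homo y)
        φ-cong (⊗-addˡ x x′ y)  = P.≈ᴹ-trans (P.+ᴹ-congʳ (Bˡ.+ᴹ-homo y x x′)) (P.+ᴹ-assoc _ _ _)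
        φ-cong (⊗-addʳ x y y′)  = P.≈ᴹ-trans (P.+ᴹ-congʳ (Bʳ.+ᴹ-homo x y y′)) (P.+ᴹ-assoc _ _ _)
        φ-cong (⊗-scalar c x y) = P.+ᴹ-congʳ (P.≈ᴹ-trans (Bˡ.*ₗ-homo y c x) (P.≈ᴹ-sym (Bʳ.*ₗ-homo x c y)))

        φ-scale : ∀ c t → φ (map (map₁ (c M.*ₗ_)) t) P.≈ᴹ c P.*ₗ φ t
        φ-scale c []            = P.≈ᴹ-sym (P.*ₗ-zeroʳ c)
        φ-scale c ((x , y) ∷ t) = P.≈ᴹ-trans (P.+ᴹ-cong (Bˡ.*ₗ-homo y c x) (φ-scale c t)) (P.≈ᴹ-sym (P.*ₗ-distribˡ c _ _))

      -- The universal property of the tensor product. Each generator of the congruence is respected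
      -- because B is linear in the argument concerned.
      ⊗-lift-linear : IsLinear (M ⊗ N) P (λ t → ∑ P (map (λ (x , y) → B x y) t))
      ⊗-lift-linear = mkLinear (M ⊗ N) P φ φ-cong φ-++ φ-scale

  module _ {v ℓv i} (V : LeftModule ring v ℓv) {I : Set i} (e : I → LeftModule.Carrierᴹ V) where
    private
      M : LeftModule ring _ _
      M = Span V e

      module M = LeftModule M
      module M⊗M = LeftModule (M ⊗ M)

    generator : I → M.Carrierᴹ
    generator i = [ 1# , i ]

    span-by-generators : ∀ f → f M.≈ᴹ value M generator f
    span-by-generators []            = M.≈ᴹ-refl {[]}
    span-by-generators ((c , i) ∷ f) = M.+ᴹ-cong {[ c , i ]} {[ c * 1# , i ]} {f} {value M generator f}
      (LeftModule.+ᴹ-congʳ V (LeftModule.*ₗ-congʳ V (K.sym (K.*-identityʳ c)))) (span-by-generators f)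

    module _ {n ℓn} {N : LeftModule ring n ℓn} where
      private module N = LeftModule N

      linear-ext : ∀ {φ ψ} → IsLinear M N φ → IsLinear M N ψ → (∀ i → φ (generator i) N.≈ᴹ ψ (generator i)) → ∀ f → φ f N.≈ᴹ ψ f
      linear-ext {φ} {ψ} φ-linear ψ-linear φ≈ψ f = begin
        φ f                         ≈⟨ φ.⟦⟧-cong (span-by-generators f) ⟩
        φ (value M generator f)     ≈⟨ φ.value-homo generator f ⟩
        value N (φ ∘ generator) f   ≈⟨ value-cong N φ≈ψ f ⟩
        value N (ψ ∘ generator) f   ≈⟨ ψ.value-homo generator f ⟨
        ψ (value M generator f)     ≈⟨ ψ.⟦⟧-cong (span-by-generators f) ⟨
        ψ f                         ∎
        where
        open import Relation.Binary.Reasoning.Setoid N.≈ᴹ-setoid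
        module φ = IsLinear {M = M} {N = N} φ-linear
        module ψ = IsLinear {M = M} {N = N} ψ-linear

    monomials : M⊗M.Carrierᴹ → List (𝕂 × (I × I))
    monomials = concatMap λ (f , g) → cartesianProductWith (λ (c , i) (d , j) → c * d , (i , j)) f g

    ⊗-generator : I × I → M⊗M.Carrierᴹ
    ⊗-generator (i , j) = [ generator i , generator j ]

    tensor-by-generators : ∀ t → t M⊗M.≈ᴹ value (M ⊗ M) ⊗-generator (monomials t)
    tensor-by-generators []            = M⊗M.≈ᴹ-refl
    tensor-by-generators ((f , g) ∷ t) = begin
      [ f , g ] ++ t
        ≈⟨ M⊗M.+ᴹ-cong pure (tensor-by-generators t) ⟩
      value (M ⊗ M) ⊗-generator (cartesianProductWith _ f g) ++ value (M ⊗ M) ⊗-generator (monomials t)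
        ≈⟨ value-++ (M ⊗ M) ⊗-generator (cartesianProductWith _ f g) (monomials t) ⟨
      value (M ⊗ M) ⊗-generator (monomials ((f , g) ∷ t)) ∎
      where
      open import Relation.Binary.Reasoning.Setoid M⊗M.≈ᴹ-setoid
      open Tensor M M using (⊗-cong)
      pure : [ f , g ] M⊗M.≈ᴹ value (M ⊗ M) ⊗-generator (cartesianProductWith (λ (c , i) (d , j) → c * d , (i , j)) f g)
      pure = begin
        [ f , g ]
          ≈⟨ ⊗-cong (span-by-generators f) (M.≈ᴹ-refl {g}) ⟩
        [ value M generator f , g ]
          ≈⟨ IsLinear.value-homo (⊗-linearˡ M M g) generator f ⟩
        value (M ⊗ M) (λ i → [ generator i , g ]) f
          ≈⟨ value-cong (M ⊗ M) (λ i → begin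
            [ generator i , g ]                              ≈⟨ ⊗-cong (M.≈ᴹ-refl {generator i}) (span-by-generators g) ⟩
            [ generator i , value M generator g ]            ≈⟨ IsLinear.value-homo (⊗-linearʳ M M (generator i)) generator g ⟩
            value (M ⊗ M) (λ j → ⊗-generator (i , j)) g      ∎) f ⟩
        value (M ⊗ M) (λ i → value (M ⊗ M) (λ j → ⊗-generator (i , j)) g) f
          ≈⟨ value-cartesianProduct (M ⊗ M) ⊗-generator f g ⟨
        value (M ⊗ M) ⊗-generator (cartesianProductWith _ f g) ∎

-- Products of series as sums over the cuts of a word

module Convolution {k ℓk : Level} (K : CommutativeRing k ℓk) where
  open CommutativeRing K using (_+_; _*_; 0#; _≈_; +-cong; +-congˡ; +-congʳ; *-cong; *-congʳ; setoid) renaming (Carrier to 𝕂)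
  private module K = CommutativeRing K
  open LinearAlgebra K
  open Linear K
  open Sums 𝕂ᴹ
  open import Relation.Binary.Reasoning.Setoid setoid

  module _ {X : Set} where

    -- Recursion on the word, in place of a sum over `inits` and `tails`, lets the first letter act
    -- on products like a twisted derivation: it is absorbed by the left factor, except for one
    -- boundary term with an empty left part. The inductions below rest on this.
    cutSum : (List X → List X → 𝕂) → List X → 𝕂
    cutSum F []      = F [] []
    cutSum F (a ∷ w) = F [] (a ∷ w) + cutSum (F ∘ (a ∷_)) w

    cutSum-∑< : ∀ F w → cutSum F w ≈ ∑< (suc (length w)) λ i → F (take i w) (drop i w)
    cutSum-∑< F []      = K.sym (K.+-identityʳ _)
    cutSum-∑< F (a ∷ w) = +-congˡ (cutSum-∑< (F ∘ (a ∷_)) w)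

    cutSum-cong : ∀ {F F′} → (∀ u v → F u v ≈ F′ u v) → ∀ w → cutSum F w ≈ cutSum F′ w
    cutSum-cong F≈F′ []      = F≈F′ [] []
    cutSum-cong F≈F′ (a ∷ w) = +-cong (F≈F′ [] (a ∷ w)) (cutSum-cong (F≈F′ ∘ (a ∷_)) w)

    cutSum-+ : ∀ F F′ w → cutSum (λ u v → F u v + F′ u v) w ≈ cutSum F w + cutSum F′ w
    cutSum-+ F F′ []      = K.refl
    cutSum-+ F F′ (a ∷ w) = K.trans (+-congˡ (cutSum-+ (F ∘ (a ∷_)) (F′ ∘ (a ∷_)) w)) (+ᴹ-interchange _ _ _ _)

    cutSum-* : ∀ c F w → cutSum (λ u v → c * F u v) w ≈ c * cutSum F w
    cutSum-* c F []      = K.refl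
    cutSum-* c F (a ∷ w) = K.trans (+-congˡ (cutSum-* c (F ∘ (a ∷_)) w)) (K.sym (K.distribˡ c _ _))

    cutSum-0 : ∀ F w → (∀ u v → length u ℕ.+ length v ≡ length w → F u v ≈ 0#) → cutSum F w ≈ 0#
    cutSum-0 F []      F≈0 = F≈0 [] [] refl
    cutSum-0 F (a ∷ w) F≈0 = K.trans
      (+-cong (F≈0 [] (a ∷ w) refl) (cutSum-0 (F ∘ (a ∷_)) w λ u v eq → F≈0 (a ∷ u) v (cong suc eq))) (K.+-identityˡ 0#)

    infixl 7 _✶_
    _✶_ : (List X → 𝕂) → (List X → 𝕂) → List X → 𝕂
    f ✶ g = cutSum λ u v → f u * g v

    ✶-cong : ∀ {f f′ g g′} → (∀ u → f u ≈ f′ u) → (∀ u → g u ≈ g′ u) → ∀ w → (f ✶ g) w ≈ (f′ ✶ g′) w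
    ✶-cong f≈f′ g≈g′ = cutSum-cong λ u v → *-cong (f≈f′ u) (g≈g′ v)

    ✶-distribʳ : ∀ f f′ g w → ((λ u → f u + f′ u) ✶ g) w ≈ (f ✶ g) w + (f′ ✶ g) w
    ✶-distribʳ f f′ g w = K.trans (cutSum-cong (λ u v → K.distribʳ (g v) (f u) (f′ u)) w) (cutSum-+ _ _ w)

    ✶-distribˡ : ∀ f g g′ w → (f ✶ (λ u → g u + g′ u)) w ≈ (f ✶ g) w + (f ✶ g′) w
    ✶-distribˡ f g g′ w = K.trans (cutSum-cong (λ u v → K.distribˡ (f u) (g v) (g′ v)) w) (cutSum-+ _ _ w)

    ✶-scaleˡ : ∀ c f g w → ((λ u → c * f u) ✶ g) w ≈ c * (f ✶ g) w
    ✶-scaleˡ c f g w = K.trans (cutSum-cong (λ u v → K.*-assoc c (f u) (g v)) w) (cutSum-* c _ w)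

    ✶-scaleʳ : ∀ c f g w → (f ✶ (λ u → c * g u)) w ≈ c * (f ✶ g) w
    ✶-scaleʳ c f g w = K.trans (cutSum-cong (λ u v → swap (f u) (g v)) w) (cutSum-* c _ w)
      where
      swap : ∀ a b → a * (c * b) ≈ c * (a * b)
      swap a b = K.trans (K.sym (K.*-assoc a c b)) (K.trans (*-congʳ (K.*-comm a c)) (K.*-assoc c a b))

    ✶-assoc : ∀ f g h w → ((f ✶ g) ✶ h) w ≈ (f ✶ (g ✶ h)) w
    ✶-assoc f g h []      = K.*-assoc _ _ _
    ✶-assoc f g h (a ∷ w) = begin
      f [] * g [] * h (a ∷ w) + ((λ u → f [] * gₐ u + (fₐ ✶ g) u) ✶ h) w
      ≈⟨ +-cong (K.*-assoc _ _ _)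
                (K.trans (✶-distribʳ _ _ h w) (+-cong (✶-scaleˡ (f []) gₐ h w) (✶-assoc fₐ g h w))) ⟩
      f [] * (g [] * h (a ∷ w)) + (f [] * (gₐ ✶ h) w + (fₐ ✶ (g ✶ h)) w)
        ≈⟨ K.+-assoc _ _ _ ⟨
      f [] * (g [] * h (a ∷ w)) + f [] * (gₐ ✶ h) w + (fₐ ✶ (g ✶ h)) w
        ≈⟨ +-congʳ (K.distribˡ (f []) _ _) ⟨
      (f ✶ (g ✶ h)) (a ∷ w) ∎
      where
      fₐ gₐ : List X → 𝕂
      fₐ = f ∘ (a ∷_)
      gₐ = g ∘ (a ∷_)

  -- The map h stands for prepending the letters already read: `inits (a ∷ w)` contains `inits w`
  -- with a prepended throughout, so the induction needs this generality.
  ∑ᴷ-inits-tails : ∀ {X Y : Set} (F : List Y → List X → 𝕂) (h : List X → List Y) w →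
    ∑ᴷ (zipWith F (map h (inits w)) (tails w)) ≈ cutSum (F ∘ h) w
  ∑ᴷ-inits-tails F h []      = K.+-identityʳ _
  ∑ᴷ-inits-tails F h (a ∷ w) = +-congˡ (K.trans
    (K.reflexive (cong (λ us → ∑ᴷ (zipWith F us (tails w))) (≡.sym (List.map-∘ (inits w))))) (∑ᴷ-inits-tails F (h ∘ (a ∷_)) w))

  cutSum-map : ∀ {X Y : Set} (h : X → Y) F w → cutSum F (map h w) ≡ cutSum (λ u v → F (map h u) (map h v)) w
  cutSum-map h F []      = refl
  cutSum-map h F (a ∷ w) = cong (F [] (map h (a ∷ w)) +_) (cutSum-map h (F ∘ (h a ∷_)) w)

  -- Cuts of shuffles

  module Shuffles (ℓ : ℕ) where
    open ColoredWords ℓ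
    open Words ℓ using (shuffles-[])

    module _ {X : Set} where

      shuffleSum : (List X → 𝕂) → List X → List X → 𝕂
      shuffleSum h xs ys = ∑ᴷ (map h (shuffles xs ys))

      shuffleSum-cong : ∀ {h h′} → (∀ z → h z ≈ h′ z) → ∀ xs ys → shuffleSum h xs ys ≈ shuffleSum h′ xs ys
      shuffleSum-cong h≈h′ xs ys = ∑-cong (shuffles xs ys) λ _ → h≈h′ _

      shuffleSum-[] : ∀ h xs → shuffleSum h xs [] ≈ h xs
      shuffleSum-[] h xs = K.trans (K.reflexive (cong (∑ᴷ ∘ map h) (shuffles-[] xs))) (K.+-identityʳ _)

      shuffleSum-∷ : ∀ h x xs y ys → shuffleSum h (x ∷ xs) (y ∷ ys) ≈
                     shuffleSum (h ∘ (x ∷_)) xs (y ∷ ys) + shuffleSum (h ∘ (y ∷_)) (x ∷ xs) ys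
      shuffleSum-∷ h x xs y ys = begin
        ∑ᴷ (map h (map (x ∷_) L ++ map (y ∷_) R))                ≡⟨ cong ∑ᴷ (List.map-++ h (map (x ∷_) L) _) ⟩
        ∑ᴷ (map h (map (x ∷_) L) ++ map h (map (y ∷_) R))        ≈⟨ ∑-++ (map h (map (x ∷_) L)) _ ⟩
        ∑ᴷ (map h (map (x ∷_) L)) + ∑ᴷ (map h (map (y ∷_) R))    ≡⟨ cong₂ (λ s t → ∑ᴷ s + ∑ᴷ t) (List.map-∘ L) (List.map-∘ R) ⟨
        ∑ᴷ (map (h ∘ (x ∷_)) L) + ∑ᴷ (map (h ∘ (y ∷_)) R)        ∎
        where
        L = shuffles xs (y ∷ ys)
        R = shuffles (x ∷ xs) ys

      infixl 7 _✶✶_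
      -- The product of series in two sets of letters that commute with each other: the two words of
      -- a pair are cut independently.
      _✶✶_ : (List X → List X → 𝕂) → (List X → List X → 𝕂) → List X → List X → 𝕂
      (F ✶✶ G) xs ys = cutSum (λ x₁ x₂ → cutSum (λ y₁ y₂ → F x₁ y₁ * G x₂ y₂) ys) xs

      ✶✶-cong : ∀ {F F′ G G′} → (∀ x y → F x y ≈ F′ x y) → (∀ x y → G x y ≈ G′ x y) → ∀ xs ys → (F ✶✶ G) xs ys ≈ (F′ ✶✶ G′) xs ys
      ✶✶-cong F≈F′ G≈G′ xs ys = cutSum-cong (λ x₁ x₂ → cutSum-cong (λ y₁ y₂ → *-cong (F≈F′ x₁ y₁) (G≈G′ x₂ y₂)) ys) xs

      ✶✶-distribʳ : ∀ F F′ G xs ys → ((λ x y → F x y + F′ x y) ✶✶ G) xs ys ≈ (F ✶✶ G) xs ys + (F′ ✶✶ G) xs ys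
      ✶✶-distribʳ F F′ G xs ys = K.trans
        (cutSum-cong (λ x₁ x₂ → K.trans (cutSum-cong (λ y₁ y₂ → K.distribʳ (G x₂ y₂) (F x₁ y₁) (F′ x₁ y₁)) ys) (cutSum-+ _ _ ys)) xs)
        (cutSum-+ _ _ xs)

      ✶✶-distribˡ : ∀ F G G′ xs ys → (F ✶✶ (λ x y → G x y + G′ x y)) xs ys ≈ (F ✶✶ G) xs ys + (F ✶✶ G′) xs ys
      ✶✶-distribˡ F G G′ xs ys = K.trans
        (cutSum-cong (λ x₁ x₂ → K.trans (cutSum-cong (λ y₁ y₂ → K.distribˡ (F x₁ y₁) (G x₂ y₂) (G′ x₂ y₂)) ys) (cutSum-+ _ _ ys)) xs)
        (cutSum-+ _ _ xs)

      ✶✶-zeroˡ : ∀ G xs ys → ((λ _ _ → 0#) ✶✶ G) xs ys ≈ 0#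
      ✶✶-zeroˡ G xs ys = cutSum-0 _ xs λ _ x₂ _ → cutSum-0 (λ _ y₂ → 0# * G x₂ y₂) ys λ _ _ _ → K.zeroˡ _

      ✶✶-zeroʳ : ∀ F xs ys → (F ✶✶ (λ _ _ → 0#)) xs ys ≈ 0#
      ✶✶-zeroʳ F xs ys = cutSum-0 _ xs λ x₁ _ _ → cutSum-0 (λ y₁ _ → F x₁ y₁ * 0#) ys λ _ _ _ → K.zeroʳ _

      ✶-*-✶ : ∀ f g f′ g′ xs ys → (f ✶ g) xs * (f′ ✶ g′) ys ≈ ((λ x y → f x * f′ y) ✶✶ (λ x y → g x * g′ y)) xs ys
      ✶-*-✶ f g f′ g′ xs ys = begin
        (f ✶ g) xs * (f′ ✶ g′) ys
          ≈⟨ K.trans (K.*-comm _ _) (K.sym (cutSum-* ((f′ ✶ g′) ys) (λ x₁ x₂ → f x₁ * g x₂) xs)) ⟩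
        cutSum (λ x₁ x₂ → (f′ ✶ g′) ys * (f x₁ * g x₂)) xs
          ≈⟨ cutSum-cong (λ x₁ x₂ → K.trans (K.*-comm _ _) (K.sym (cutSum-* (f x₁ * g x₂) (λ y₁ y₂ → f′ y₁ * g′ y₂) ys))) xs ⟩
        cutSum (λ x₁ x₂ → cutSum (λ y₁ y₂ → (f x₁ * g x₂) * (f′ y₁ * g′ y₂)) ys) xs
          ≈⟨ cutSum-cong (λ x₁ x₂ → cutSum-cong (λ y₁ y₂ → *-interchange (f x₁) (g x₂) (f′ y₁) (g′ y₂)) ys) xs ⟩
        ((λ x y → f x * f′ y) ✶✶ (λ x y → g x * g′ y)) xs ys ∎
        where open CommutativeSemigroupProperties K.*-commutativeSemigroup using () renaming (interchange to *-interchange)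

      -- Cutting a shuffle amounts to cutting both words and shuffling the
      -- left parts and the right parts.
      shuffleSum-✶ : ∀ f g xs ys → shuffleSum (f ✶ g) xs ys ≈ (shuffleSum f ✶✶ shuffleSum g) xs ys
      shuffleSum-✶ f g []       ys = K.trans (K.+-identityʳ _) (✶-cong (λ u → K.sym (K.+-identityʳ (f u))) (λ u → K.sym (K.+-identityʳ (g u))) ys)
      shuffleSum-✶ f g (x ∷ xs) [] = K.trans (K.+-identityʳ _)
        (cutSum-cong (λ u v → K.sym (*-cong (shuffleSum-[] f u) (shuffleSum-[] g v))) (x ∷ xs))
      shuffleSum-✶ f g (x ∷ xs) (y ∷ ys) = begin
        shuffleSum (f ✶ g) (x ∷ xs) (y ∷ ys)
          ≈⟨ shuffleSum-∷ (f ✶ g) x xs y ys ⟩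
        shuffleSum ((f ✶ g) ∘ (x ∷_)) xs (y ∷ ys) + shuffleSum ((f ✶ g) ∘ (y ∷_)) (x ∷ xs) ys
          ≈⟨ +-cong (step x xs (y ∷ ys) (shuffleSum-✶ fˣ g xs (y ∷ ys))) (step y (x ∷ xs) ys (shuffleSum-✶ fʸ g (x ∷ xs) ys)) ⟩
        (f [] * shuffleSum gˣ xs (y ∷ ys) + cutSum (λ x₁ x₂ → a x₁ x₂ + b x₁ x₂) xs) + (f [] * shuffleSum gʸ (x ∷ xs) ys + (P + cutSum c xs))
          ≈⟨ +ᴹ-interchange _ _ _ _ ⟩
        (f [] * shuffleSum gˣ xs (y ∷ ys) + f [] * shuffleSum gʸ (x ∷ xs) ys) + (cutSum (λ x₁ x₂ → a x₁ x₂ + b x₁ x₂) xs + (P + cutSum c xs))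
          ≈⟨ +-cong (K.sym (K.distribˡ (f []) _ _)) (K.trans (K.sym (K.+-assoc _ _ _)) (K.trans (+-congʳ (K.+-comm _ P)) (K.+-assoc _ _ _))) ⟩
        f [] * (shuffleSum gˣ xs (y ∷ ys) + shuffleSum gʸ (x ∷ xs) ys) + (P + (cutSum (λ x₁ x₂ → a x₁ x₂ + b x₁ x₂) xs + cutSum c xs))
          ≈⟨ K.+-assoc _ _ _ ⟨
        f [] * (shuffleSum gˣ xs (y ∷ ys) + shuffleSum gʸ (x ∷ xs) ys) + P + (cutSum (λ x₁ x₂ → a x₁ x₂ + b x₁ x₂) xs + cutSum c xs)
          ≈⟨ +-cong (+-congʳ (*-cong (K.sym (K.+-identityʳ _)) (K.sym (shuffleSum-∷ g x xs y ys)))) (K.sym (cutSum-+ _ c xs)) ⟩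
        shuffleSum f [] [] * shuffleSum g (x ∷ xs) (y ∷ ys) + P + cutSum (λ x₁ x₂ → a x₁ x₂ + b x₁ x₂ + c x₁ x₂) xs
          ≈⟨ +-congˡ (cutSum-cong split xs) ⟩
        (shuffleSum f ✶✶ shuffleSum g) (x ∷ xs) (y ∷ ys) ∎
        where
        fˣ fʸ gˣ gʸ : List X → 𝕂
        fˣ = f ∘ (x ∷_)
        fʸ = f ∘ (y ∷_)
        gˣ = g ∘ (x ∷_)
        gʸ = g ∘ (y ∷_)

        -- The cuts of both words are sorted by which left parts are empty. `P` has only that of
        -- `x ∷ xs` empty, `a` only that of `y ∷ ys`; when neither is empty, the left shuffle begins
        -- with x in `b` and with y in `c`.
        P : 𝕂
        P = cutSum (λ y₁ y₂ → shuffleSum fʸ [] y₁ * shuffleSum g (x ∷ xs) y₂) ys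

        a b c : List X → List X → 𝕂
        a x₁ x₂ = shuffleSum fˣ x₁ [] * shuffleSum g x₂ (y ∷ ys)
        b x₁ x₂ = cutSum (λ y₁ y₂ → shuffleSum fˣ x₁ (y ∷ y₁) * shuffleSum g x₂ y₂) ys
        c x₁ x₂ = cutSum (λ y₁ y₂ → shuffleSum fʸ (x ∷ x₁) y₁ * shuffleSum g x₂ y₂) ys

        step : ∀ z us vs {r} → shuffleSum ((f ∘ (z ∷_)) ✶ g) us vs ≈ r →
               shuffleSum ((f ✶ g) ∘ (z ∷_)) us vs ≈ f [] * shuffleSum (g ∘ (z ∷_)) us vs + r
        step z us vs eq = K.trans (∑-+ _ _ (shuffles us vs)) (+-cong (∑-* (f []) (g ∘ (z ∷_)) (shuffles us vs)) eq)

        split : ∀ x₁ x₂ → a x₁ x₂ + b x₁ x₂ + c x₁ x₂ ≈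
                cutSum (λ y₁ y₂ → shuffleSum f (x ∷ x₁) y₁ * shuffleSum g x₂ y₂) (y ∷ ys)
        split x₁ x₂ = begin
          a x₁ x₂ + b x₁ x₂ + c x₁ x₂
            ≈⟨ K.+-assoc _ _ _ ⟩
          a x₁ x₂ + (b x₁ x₂ + c x₁ x₂)
            ≈⟨ +-cong (*-congʳ (K.trans (shuffleSum-[] fˣ x₁) (K.sym (shuffleSum-[] f (x ∷ x₁))))) (K.sym (cutSum-+ _ _ ys)) ⟩
          shuffleSum f (x ∷ x₁) [] * shuffleSum g x₂ (y ∷ ys)
          + cutSum (λ y₁ y₂ → shuffleSum fˣ x₁ (y ∷ y₁) * shuffleSum g x₂ y₂ + shuffleSum fʸ (x ∷ x₁) y₁ * shuffleSum g x₂ y₂) ys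
            ≈⟨ +-congˡ (cutSum-cong (λ y₁ y₂ → K.trans (K.sym (K.distribʳ _ _ _)) (*-congʳ (K.sym (shuffleSum-∷ f x x₁ y y₁)))) ys) ⟩
          cutSum (λ y₁ y₂ → shuffleSum f (x ∷ x₁) y₁ * shuffleSum g x₂ y₂) (y ∷ ys) ∎

-- Splittings of a permutation by value

module Splittings (ℓ : ℕ) where
  open ColoredWords ℓ
  open Words ℓ

  length-0 : ∀ {X : Set} {p : List X} → length p ≡ 0 → p ≡ []
  length-0 {p = []} _ = refl

  lo-zero : ∀ {p} → IsPerm p → lo 0 p ≡ []
  lo-zero h = length-0 (length-lo h z≤n)

  hi-zero : ∀ p → hi 0 p ≡ p
  hi-zero p = ≡.trans (List.map-id (hi↑ 0 p)) (List.filter-all (λ a → 0 ℕ.≤? proj₁ a) (All.universal (λ _ → z≤n) p))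

  lo-length : ∀ {p} → IsPerm p → lo (length p) p ≡ p
  lo-length {p} h = List.filter-all (λ a → proj₁ a ℕ.<? length p) (perm-bounded h)

  hi-length : ∀ {p} → IsPerm p → hi (length p) p ≡ []
  hi-length {p} h = length-0 (≡.trans (length-hi h ℕ.≤-refl) (ℕ.n∸n≡0 (length p)))

  module _ {k ℓk : Level} (K : CommutativeRing k ℓk) where
    open CommutativeRing K using (ring; 1#; -_)
    private module K = CommutativeRing K
    open LinearAlgebra K
    open Linear K

    module _ {n ℓn} (N : LeftModule ring n ℓn) where
      open LeftModule N
      open Sums N
      open import Relation.Binary.Reasoning.Setoid ≈ᴹ-setoid

      -- Cutting at k and the lower part again at j gives the same three pieces as cutting at j and
      -- the upper part at k - j; `∑<-triangle` reindexes. Ψ is arbitrary because the lemma serves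
      -- both the coassociativity of the coproduct and the associativity of convolution.
      ∑-coassoc : ∀ (Ψ : Word ℕ → Word ℕ → Word ℕ → Carrierᴹ) {p} → IsPerm p →
        ∑< (suc (length p)) (λ k → ∑< (suc (length (lo k p))) λ j → Ψ (lo j (lo k p)) (hi j (lo k p)) (hi k p))
        ≈ᴹ ∑< (suc (length p)) (λ j → ∑< (suc (length (hi j p))) λ i → Ψ (lo j p) (lo i (hi j p)) (hi i (hi j p)))
      ∑-coassoc Ψ {p} h = begin
        ∑< (suc (length p)) (λ k → ∑< (suc (length (lo k p))) λ j → L k j)
          ≈⟨ ∑<-cong {suc (length p)} (λ {k} k<n → ≈ᴹ-trans
               (≈ᴹ-reflexive (cong (λ m → ∑< (suc m) (L k)) (length-lo h (ℕ.s≤s⁻¹ k<n))))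
               (∑<-cong {suc k} {L k} {λ j → E j (k ∸ j)} λ {j} j<k → ≈ᴹ-reflexive
                 (subst (λ m → L m j ≡ E j (k ∸ j)) (ℕ.m+[n∸m]≡n (ℕ.s≤s⁻¹ j<k)) (split j (k ∸ j))))) ⟩
        ∑< (suc (length p)) (λ k → ∑< (suc k) λ j → E j (k ∸ j))
          ≈⟨ ∑<-triangle (length p) E ⟩
        ∑< (suc (length p)) (λ j → ∑< (suc (length p ∸ j)) λ i → E j i)
          ≈⟨ ∑<-cong {suc (length p)} (λ {j} j<n → ≈ᴹ-reflexive (cong (λ m → ∑< (suc m) (E j)) (length-hi h (ℕ.s≤s⁻¹ j<n)))) ⟨
        ∑< (suc (length p)) (λ j → ∑< (suc (length (hi j p))) λ i → E j i) ∎
        where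
        L E : ℕ → ℕ → Carrierᴹ
        L k j = Ψ (lo j (lo k p)) (hi j (lo k p)) (hi k p)
        E j i = Ψ (lo j p) (lo i (hi j p)) (hi i (hi j p))

        split : ∀ j i → L (j ℕ.+ i) j ≡ E j i
        split j i rewrite lo-lo j i p | hi-lo j i p | hi-hi j i p = refl

    -- The convolution algebra of maps on permutations

    module Convolutions {m ℓm} (M : LeftModule ring m ℓm)
      (_∙_ : LeftModule.Carrierᴹ M → LeftModule.Carrierᴹ M → LeftModule.Carrierᴹ M) (𝟙 : LeftModule.Carrierᴹ M)
      (∙-linearˡ : ∀ y → IsLinear M M (_∙ y)) (∙-linearʳ : ∀ x → IsLinear M M (x ∙_))
      (∙-assoc : ∀ x y z → LeftModule._≈ᴹ_ M ((x ∙ y) ∙ z) (x ∙ (y ∙ z)))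
      (∙-identityˡ : ∀ x → LeftModule._≈ᴹ_ M (𝟙 ∙ x) x) (∙-identityʳ : ∀ x → LeftModule._≈ᴹ_ M (x ∙ 𝟙) x) where
      open LeftModule M
      open Sums M
      open import Relation.Binary.Reasoning.Setoid ≈ᴹ-setoid
      private
        module ∙ˡ y = IsLinear {M = M} {N = M} (∙-linearˡ y)
        module ∙ʳ x = IsLinear {M = M} {N = M} (∙-linearʳ x)

        ∙-cong : ∀ {x x′ y y′} → x ≈ᴹ x′ → y ≈ᴹ y′ → x ∙ y ≈ᴹ x′ ∙ y′
        ∙-cong x≈x′ y≈y′ = ≈ᴹ-trans (∙ˡ.⟦⟧-cong _ x≈x′) (∙ʳ.⟦⟧-cong _ y≈y′)

      infix 4 _≗_
      -- Equality is asked on permutations only: the laws below rest on the lengths of `lo k p` and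
      -- `hi k p`, which are guaranteed to be k and n - k only there.
      _≗_ : (φ ψ : Word ℕ → Carrierᴹ) → Set ℓm
      φ ≗ ψ = ∀ {p} → IsPerm p → φ p ≈ᴹ ψ p

      infixl 7 _⊛_
      _⊛_ : (φ ψ : Word ℕ → Carrierᴹ) → Word ℕ → Carrierᴹ
      (φ ⊛ ψ) p = ∑< (suc (length p)) λ k → φ (lo k p) ∙ ψ (hi k p)

      ⊛-cong : ∀ {φ φ′ ψ ψ′} → φ ≗ φ′ → ψ ≗ ψ′ → φ ⊛ ψ ≗ φ′ ⊛ ψ′
      ⊛-cong φ≗φ′ ψ≗ψ′ {p} h = ∑<-cong {suc (length p)} λ k<n →
        ∙-cong (φ≗φ′ (lo-isPerm h (ℕ.s≤s⁻¹ k<n))) (ψ≗ψ′ (hi-isPerm h (ℕ.s≤s⁻¹ k<n)))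

      ⊛-assoc : ∀ φ ψ χ → (φ ⊛ ψ) ⊛ χ ≗ φ ⊛ (ψ ⊛ χ)
      ⊛-assoc φ ψ χ {p} h = begin
        ((φ ⊛ ψ) ⊛ χ) p
          ≈⟨ ∑<-cong {suc (length p)} (λ {k} _ → ∙ˡ.∑<-homo (χ (hi k p)) (suc (length (lo k p))) (λ j → φ (lo j (lo k p)) ∙ ψ (hi j (lo k p)))) ⟩
        ∑< (suc (length p)) (λ k → ∑< (suc (length (lo k p))) λ j → (φ (lo j (lo k p)) ∙ ψ (hi j (lo k p))) ∙ χ (hi k p))
          ≈⟨ ∑-coassoc M (λ a b c → (φ a ∙ ψ b) ∙ χ c) h ⟩
        ∑< (suc (length p)) (λ j → ∑< (suc (length (hi j p))) λ i → (φ (lo j p) ∙ ψ (lo i (hi j p))) ∙ χ (hi i (hi j p)))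
          ≈⟨ ∑<-cong {suc (length p)} (λ {j} _ → ≈ᴹ-trans
               (∑<-cong {suc (length (hi j p))} {λ i → (φ (lo j p) ∙ ψ (lo i (hi j p))) ∙ χ (hi i (hi j p))}
                 {λ i → φ (lo j p) ∙ (ψ (lo i (hi j p)) ∙ χ (hi i (hi j p)))} (λ _ → ∙-assoc _ _ _))
               (≈ᴹ-sym (∙ʳ.∑<-homo (φ (lo j p)) (suc (length (hi j p))) (λ i → ψ (lo i (hi j p)) ∙ χ (hi i (hi j p)))))) ⟩
        (φ ⊛ (ψ ⊛ χ)) p ∎

      ⊛-distribʳ : ∀ φ φ′ ψ → (λ p → φ p +ᴹ φ′ p) ⊛ ψ ≗ λ p → (φ ⊛ ψ) p +ᴹ (φ′ ⊛ ψ) p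
      ⊛-distribʳ φ φ′ ψ {p} h = begin
        ((λ p → φ p +ᴹ φ′ p) ⊛ ψ) p
          ≈⟨ ∑<-cong {suc (length p)} (λ {k} _ → ∙ˡ.+ᴹ-homo (ψ (hi k p)) (φ (lo k p)) (φ′ (lo k p))) ⟩
        ∑< (suc (length p)) (λ k → φ (lo k p) ∙ ψ (hi k p) +ᴹ φ′ (lo k p) ∙ ψ (hi k p))
          ≈⟨ ∑<-+ (suc (length p)) (λ k → φ (lo k p) ∙ ψ (hi k p)) (λ k → φ′ (lo k p) ∙ ψ (hi k p)) ⟩
        (φ ⊛ ψ) p +ᴹ (φ′ ⊛ ψ) p ∎

      ⊛-distribˡ : ∀ φ ψ ψ′ → φ ⊛ (λ p → ψ p +ᴹ ψ′ p) ≗ λ p → (φ ⊛ ψ) p +ᴹ (φ ⊛ ψ′) p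
      ⊛-distribˡ φ ψ ψ′ {p} h = begin
        (φ ⊛ (λ p → ψ p +ᴹ ψ′ p)) p
          ≈⟨ ∑<-cong {suc (length p)} (λ {k} _ → ∙ʳ.+ᴹ-homo (φ (lo k p)) (ψ (hi k p)) (ψ′ (hi k p))) ⟩
        ∑< (suc (length p)) (λ k → φ (lo k p) ∙ ψ (hi k p) +ᴹ φ (lo k p) ∙ ψ′ (hi k p))
          ≈⟨ ∑<-+ (suc (length p)) (λ k → φ (lo k p) ∙ ψ (hi k p)) (λ k → φ (lo k p) ∙ ψ′ (hi k p)) ⟩
        (φ ⊛ ψ) p +ᴹ (φ ⊛ ψ′) p ∎

      ⊛-scaleˡ : ∀ c φ ψ → (λ p → c *ₗ φ p) ⊛ ψ ≗ λ p → c *ₗ (φ ⊛ ψ) p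
      ⊛-scaleˡ c φ ψ {p} h = begin
        ((λ p → c *ₗ φ p) ⊛ ψ) p
          ≈⟨ ∑<-cong {suc (length p)} (λ {k} _ → ∙ˡ.*ₗ-homo (ψ (hi k p)) c (φ (lo k p))) ⟩
        ∑< (suc (length p)) (λ k → c *ₗ (φ (lo k p) ∙ ψ (hi k p)))
          ≈⟨ ∑<-* (suc (length p)) c (λ k → φ (lo k p) ∙ ψ (hi k p)) ⟩
        c *ₗ (φ ⊛ ψ) p ∎

      ⊛-scaleʳ : ∀ c φ ψ → φ ⊛ (λ p → c *ₗ ψ p) ≗ λ p → c *ₗ (φ ⊛ ψ) p
      ⊛-scaleʳ c φ ψ {p} h = begin
        (φ ⊛ (λ p → c *ₗ ψ p)) p
          ≈⟨ ∑<-cong {suc (length p)} (λ {k} _ → ∙ʳ.*ₗ-homo (φ (lo k p)) c (ψ (hi k p))) ⟩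
        ∑< (suc (length p)) (λ k → c *ₗ (φ (lo k p) ∙ ψ (hi k p)))
          ≈⟨ ∑<-* (suc (length p)) c (λ k → φ (lo k p) ∙ ψ (hi k p)) ⟩
        c *ₗ (φ ⊛ ψ) p ∎

      -- On permutation words, the counit followed by the unit.
      η : Word ℕ → Carrierᴹ
      η []      = 𝟙
      η (_ ∷ _) = 0ᴹ

      private
        η-nonempty : ∀ p → length p ≢ 0 → η p ≈ᴹ 0ᴹ
        η-nonempty []      ∣p∣≢0 = contradiction refl ∣p∣≢0
        η-nonempty (_ ∷ _) ∣p∣≢0 = ≈ᴹ-refl

      -- As `lo k p` has length k, η leaves only the term k = 0; in `⊛-identityʳ` it leaves only k =
      -- `length p`.
      ⊛-identityˡ : ∀ φ → η ⊛ φ ≗ φ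
      ⊛-identityˡ φ {p} h = ≈ᴹ-trans
        (∑<-single {suc (length p)} {λ k → η (lo k p) ∙ φ (hi k p)} {0} ℕ.z<s λ {k} k<n k≢0 → ≈ᴹ-trans
          (∙ˡ.⟦⟧-cong _ (η-nonempty (lo k p) (k≢0 ∘ ≡.trans (≡.sym (length-lo h (ℕ.s≤s⁻¹ k<n)))))) (∙ˡ.0ᴹ-homo _))
        (≈ᴹ-trans (≈ᴹ-reflexive (cong₂ (λ u v → η u ∙ φ v) (lo-zero h) (hi-zero p))) (∙-identityˡ _))

      ⊛-identityʳ : ∀ φ → φ ⊛ η ≗ φ
      ⊛-identityʳ φ {p} h = ≈ᴹ-trans
        (∑<-single {suc (length p)} {λ k → φ (lo k p) ∙ η (hi k p)} {length p} (ℕ.n<1+n _) λ {k} k<n k≢n → ≈ᴹ-trans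
          (∙ʳ.⟦⟧-cong _ (η-nonempty (hi k p) λ ∣hi∣≡0 → k≢n (ℕ.≤-antisym (ℕ.s≤s⁻¹ k<n)
            (ℕ.m∸n≡0⇒m≤n (≡.trans (≡.sym (length-hi h (ℕ.s≤s⁻¹ k<n))) ∣hi∣≡0))))) (∙ʳ.0ᴹ-homo _))
        (≈ᴹ-trans (≈ᴹ-reflexive (cong₂ (λ u v → φ u ∙ η v) (lo-length h) (hi-length h))) (∙-identityʳ _))

      -- The convolution inverse of g = η + J is the geometric series
      -- η - J + J ⊛ J - …, of which only finitely many terms matter on a
      -- given word, since J vanishes on the empty word.
      module Inverse (g : Word ℕ → Carrierᴹ) (g-[] : g [] ≈ᴹ 𝟙) where

        private
          J : Word ℕ → Carrierᴹ
          J []      = 0ᴹ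
          J (a ∷ p) = g (a ∷ p)

          g≗η+J : g ≗ λ p → η p +ᴹ J p
          g≗η+J {[]}    h = ≈ᴹ-trans g-[] (≈ᴹ-sym (+ᴹ-identityʳ _))
          g≗η+J {a ∷ p} h = ≈ᴹ-sym (+ᴹ-identityˡ _)

          S : ℕ → Word ℕ → Carrierᴹ
          S zero    p = η p
          S (suc n) p = η p +ᴹ (- 1#) *ₗ (S n ⊛ J) p

          -- Each `S n` is a polynomial in J, hence commutes with J although the algebra is not
          -- assumed commutative. One series thus inverts g on both sides.
          S-J-comm : ∀ n → S n ⊛ J ≗ J ⊛ S n
          S-J-comm zero    h = ≈ᴹ-trans (⊛-identityˡ J h) (≈ᴹ-sym (⊛-identityʳ J h))
          S-J-comm (suc n) {p} h = begin
            (S (suc n) ⊛ J) p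
              ≈⟨ ⊛-distribʳ η (λ p → (- 1#) *ₗ (S n ⊛ J) p) J h ⟩
            (η ⊛ J) p +ᴹ ((λ p → (- 1#) *ₗ (S n ⊛ J) p) ⊛ J) p
              ≈⟨ +ᴹ-cong (S-J-comm zero h) (⊛-scaleˡ (- 1#) (S n ⊛ J) J h) ⟩
            (J ⊛ η) p +ᴹ (- 1#) *ₗ ((S n ⊛ J) ⊛ J) p
              ≈⟨ +ᴹ-congˡ (*ₗ-congˡ (≈ᴹ-trans (⊛-cong {S n ⊛ J} {J ⊛ S n} {J} {J} (S-J-comm n) (λ _ → ≈ᴹ-refl) h) (⊛-assoc J (S n) J h))) ⟩
            (J ⊛ η) p +ᴹ (- 1#) *ₗ (J ⊛ (S n ⊛ J)) p
              ≈⟨ +ᴹ-congˡ (⊛-scaleʳ (- 1#) J (S n ⊛ J) h) ⟨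
            (J ⊛ η) p +ᴹ (J ⊛ (λ p → (- 1#) *ₗ (S n ⊛ J) p)) p
              ≈⟨ ⊛-distribˡ J η (λ p → (- 1#) *ₗ (S n ⊛ J) p) h ⟨
            (J ⊛ S (suc n)) p ∎

          S-[] : ∀ n → S n [] ≈ᴹ 𝟙
          S-[] zero    = ≈ᴹ-refl
          S-[] (suc n) = ≈ᴹ-trans (+ᴹ-congˡ (≈ᴹ-trans
            (*ₗ-congˡ (≈ᴹ-trans (+ᴹ-identityʳ _) (∙ʳ.0ᴹ-homo _))) (*ₗ-zeroʳ _))) (+ᴹ-identityʳ _)

          -- The term of `S n ⊛ J` with empty upper part vanishes, so `S (suc n)` at p involves
          -- `S n` on strictly shorter words only. The value is therefore settled once the index
          -- reaches the length.
          S-stable : ∀ n m {p} → IsPerm p → length p ℕ.≤ n → length p ℕ.≤ m → S n p ≈ᴹ S m p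
          S-stable zero    m       {[]} h p≤n p≤m = ≈ᴹ-sym (S-[] m)
          S-stable (suc n) zero    {[]} h p≤n p≤m = S-[] (suc n)
          S-stable (suc n) (suc m) {p}  h p≤n p≤m = +ᴹ-congˡ (*ₗ-congˡ (∑<-cong {suc (length p)} λ k<n → term (ℕ.m≤n⇒m<n∨m≡n (ℕ.s≤s⁻¹ k<n))))
            where
            term : ∀ {k} → k ℕ.< length p ⊎ k ≡ length p → S n (lo k p) ∙ J (hi k p) ≈ᴹ S m (lo k p) ∙ J (hi k p)
            term (inj₁ k<p) = ∙ˡ.⟦⟧-cong _ (S-stable n m (lo-isPerm h (ℕ.<⇒≤ k<p))
              (subst (ℕ._≤ n) (≡.sym (length-lo h (ℕ.<⇒≤ k<p))) (ℕ.s≤s⁻¹ (ℕ.≤-trans k<p p≤n)))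
              (subst (ℕ._≤ m) (≡.sym (length-lo h (ℕ.<⇒≤ k<p))) (ℕ.s≤s⁻¹ (ℕ.≤-trans k<p p≤m))))
            term (inj₂ refl) rewrite hi-length h = ≈ᴹ-trans (∙ʳ.0ᴹ-homo _) (≈ᴹ-sym (∙ʳ.0ᴹ-homo _))

          S+S⊛J : ∀ {p} → IsPerm p → S (length p) p +ᴹ (S (length p) ⊛ J) p ≈ᴹ η p
          S+S⊛J {p} h = begin
            S n p +ᴹ (S n ⊛ J) p                                        ≈⟨ +ᴹ-congʳ (S-stable n (suc n) h ℕ.≤-refl (ℕ.n≤1+n n)) ⟩
            η p +ᴹ (- 1#) *ₗ (S n ⊛ J) p +ᴹ (S n ⊛ J) p                 ≈⟨ +ᴹ-assoc _ _ _ ⟩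
            η p +ᴹ ((- 1#) *ₗ (S n ⊛ J) p +ᴹ (S n ⊛ J) p)               ≈⟨ +ᴹ-congˡ (+ᴹ-congˡ (*ₗ-identityˡ _)) ⟨
            η p +ᴹ ((- 1#) *ₗ (S n ⊛ J) p +ᴹ 1# *ₗ (S n ⊛ J) p)         ≈⟨ +ᴹ-congˡ (*ₗ-distribʳ _ _ _) ⟨
            η p +ᴹ (- 1# K.+ 1#) *ₗ (S n ⊛ J) p                         ≈⟨ +ᴹ-congˡ (≈ᴹ-trans (*ₗ-congʳ (K.-‿inverseˡ 1#)) (*ₗ-zeroˡ _)) ⟩
            η p +ᴹ 0ᴹ                                                   ≈⟨ +ᴹ-identityʳ _ ⟩
            η p                                                         ∎
            where
            n : ℕ
            n = length p

        inverse : Word ℕ → Carrierᴹ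
        inverse p = S (length p) p

        inverseˡ : inverse ⊛ g ≗ η
        inverseˡ {p} h = begin
          (inverse ⊛ g) p
            -- The index of S depends on the term. Stability replaces it by the common `length p`,
            -- and the sum becomes a genuine convolution.
            ≈⟨ ∑<-cong {suc (length p)} (λ {k} k<n → ∙-cong
                 (S-stable _ _ (lo-isPerm h (ℕ.s≤s⁻¹ k<n)) ℕ.≤-refl (subst (ℕ._≤ length p) (≡.sym (length-lo h (ℕ.s≤s⁻¹ k<n))) (ℕ.s≤s⁻¹ k<n)))
                 (g≗η+J (hi-isPerm h (ℕ.s≤s⁻¹ k<n)))) ⟩
          (S (length p) ⊛ (λ p → η p +ᴹ J p)) p
            ≈⟨ ⊛-distribˡ (S (length p)) η J h ⟩
          (S (length p) ⊛ η) p +ᴹ (S (length p) ⊛ J) p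
            ≈⟨ +ᴹ-congʳ (⊛-identityʳ (S (length p)) h) ⟩
          S (length p) p +ᴹ (S (length p) ⊛ J) p
            ≈⟨ S+S⊛J h ⟩
          η p ∎

        inverseʳ : g ⊛ inverse ≗ η
        inverseʳ {p} h = begin
          (g ⊛ inverse) p
            ≈⟨ ∑<-cong {suc (length p)} (λ {k} k<n → ∙-cong
                 (g≗η+J (lo-isPerm h (ℕ.s≤s⁻¹ k<n)))
                 (S-stable _ _ (hi-isPerm h (ℕ.s≤s⁻¹ k<n)) ℕ.≤-refl (subst (ℕ._≤ length p) (≡.sym (length-hi h (ℕ.s≤s⁻¹ k<n))) (ℕ.m∸n≤m (length p) k)))) ⟩
          ((λ p → η p +ᴹ J p) ⊛ S (length p)) p
            ≈⟨ ⊛-distribʳ η J (S (length p)) h ⟩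
          (η ⊛ S (length p)) p +ᴹ (J ⊛ S (length p)) p
            ≈⟨ +ᴹ-cong (⊛-identityˡ (S (length p)) h) (≈ᴹ-sym (S-J-comm (length p) h)) ⟩
          S (length p) p +ᴹ (S (length p) ⊛ J) p
            ≈⟨ S+S⊛J h ⟩
          η p ∎

-- Elements of FQSym and their series

module Hopf {k ℓk : Level} (K : CommutativeRing k ℓk) (ℓ : ℕ) where
  open CommutativeRing K using (ring; _+_; _*_; 0#; 1#; +-cong; +-congʳ; *-cong; *-congˡ; *-congʳ) renaming (Carrier to 𝕂; _≈_ to _≈ᴷ_)
  private module K = CommutativeRing K
  open LinearAlgebra K
  open FreeQuasiSymmetric K ℓ
  open Words ℓ
  open Linear K
  open Convolution K
  open Shuffles ℓ
  open Splittings ℓ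
  private
    module S = Sums 𝕂ᴹ
    module F = LeftModule FQSym
    module F⊗F = LeftModule (FQSym ⊗ FQSym)

  _≟ᵂ_ : DecidableEquality (Word ℕ)
  _≟ᵂ_ = List.≡-dec (Prod.≡-dec ℕ._≟_ Fin._≟_)

  open Delta _≟ᵂ_

  coeff : 𝐅 → Word ℕ → 𝕂
  coeff = coefficient word

  𝐆-δ : ∀ X α w → 𝐆 X α w ≡ δ (word α) (std X w)
  𝐆-δ X α w = cong (if_then 1# else 0#) (does-⇔
    (mk⇔ (≡.sym ∘ Equivalence.to (isStd⇔std≡ X w α)) (Equivalence.from (isStd⇔std≡ X w α) ∘ ≡.sym))
    (isStd? X w α) (word α ≟ᵂ std X w))

  eval-coeff : ∀ X f w → (f ⟨ X ⟩) w ≈ᴷ coeff f (std X w)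
  eval-coeff X []            w = K.refl
  eval-coeff X ((c , α) ∷ f) w = +-cong (*-congˡ (K.reflexive (𝐆-δ X α w))) (eval-coeff X f w)

  eval-perm : ∀ f {p} → IsPerm p → (f ⟨ A ⟩) p ≈ᴷ coeff f p
  eval-perm f {p} h = K.trans (eval-coeff A f p) (K.reflexive (cong (coeff f) (std-perm h)))

  -- The series over `A` determines the series over every other alphabet. Equality in `FQSym`,
  -- defined over `A`, thus carries over to `A′⊕A″`.
  eval-std : ∀ X f w → (f ⟨ X ⟩) w ≈ᴷ (f ⟨ A ⟩) (std X w)
  eval-std X f w = K.trans (eval-coeff X f w) (K.sym (eval-perm f (std-isPerm X w)))

  eval-linear : ∀ X → IsLinear FQSym (Series X) (_⟨ X ⟩)
  eval-linear X = mkLinear FQSym (Series X) (_⟨ X ⟩)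
    (λ {f} {g} f≈g w → K.trans (eval-std X f w) (K.trans (f≈g (std X w)) (K.sym (eval-std X g w))))
    (value-++ (Series X) (𝐆 X)) (value-scale (Series X) (𝐆 X))

  at-linear : ∀ {a} {B : Set a} (b : B) → IsLinear (Functions B) 𝕂ᴹ (λ f → f b)
  at-linear {B = B} b = mkLinear (Functions B) 𝕂ᴹ (λ f → f b) (λ f≈g → f≈g b) (λ _ _ → K.refl) (λ _ _ → K.refl)

  eval-at-linear : ∀ X w → IsLinear FQSym 𝕂ᴹ (λ f → (f ⟨ X ⟩) w)
  eval-at-linear X w = ∘-linear {L = FQSym} {M = Series X} {N = 𝕂ᴹ} (at-linear w) (eval-linear X)

  private
    module eval-at w = IsLinear {M = FQSym} {N = 𝕂ᴹ} (eval-at-linear A w)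

  -- Generators indexed by words: equal words give the same element definitionally up to rewriting,
  -- whereas distinct colored permutations may share a word.
  𝐠 : Word ℕ → 𝐅
  𝐠 p = G (toColoredPerm p)

  eval-G : ∀ X α w → (G α ⟨ X ⟩) w ≈ᴷ δ (word α) (std X w)
  eval-G X α w = K.trans (eval-coeff X (G α) w) (K.trans (K.+-identityʳ _) (K.*-identityˡ _))

  eval-𝐠 : ∀ X {p} → IsPerm p → ∀ w → (𝐠 p ⟨ X ⟩) w ≈ᴷ δ p (std X w)
  eval-𝐠 X {p} h w = K.trans (eval-G X (toColoredPerm p) w) (K.reflexive (cong (λ q → δ q (std X w)) (word-toColoredPerm-perm h)))

  G≈𝐠 : ∀ α → G α F.≈ᴹ 𝐠 (word α)
  G≈𝐠 α w = K.trans (eval-G A α w) (K.sym (eval-𝐠 A (word-isPerm α) w))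

  -- The element of degree n with coefficient `h p` at each permutation word p; the sum is finite
  -- because the set of colors is.
  homogeneousPart : ℕ → (Word ℕ → 𝕂) → 𝐅
  homogeneousPart n h = map (λ p → h p , toColoredPerm p) (perms n)

  private
    eval-homogeneousPart : ∀ n h X w → (homogeneousPart n h ⟨ X ⟩) w ≈ᴷ ∑ᴷ (map (λ p → δ (std X w) p * h p) (perms n))
    eval-homogeneousPart n h X w = begin
      (homogeneousPart n h ⟨ X ⟩) w
        ≈⟨ eval-coeff X (homogeneousPart n h) w ⟩
      coeff (homogeneousPart n h) (std X w)
        ≈⟨ value-map 𝕂ᴹ (λ α → δ (word α) (std X w)) toColoredPerm h (perms n) ⟩
      ∑ᴷ (map (λ p → h p * δ (word (toColoredPerm p)) (std X w)) (perms n))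
        ≈⟨ S.∑-cong (perms n) (λ {p} p∈ → K.trans (K.*-comm _ _) (*-congʳ (K.reflexive
             (≡.trans (cong (λ q → δ q (std X w)) (word-toColoredPerm-perm (proj₁ (perms-isPerm n p∈)))) (δ-sym p (std X w)))))) ⟩
      ∑ᴷ (map (λ p → δ (std X w) p * h p) (perms n)) ∎
      where open import Relation.Binary.Reasoning.Setoid K.setoid

  homogeneousPart-same : ∀ {n} h X w → length w ≡ n → (homogeneousPart n h ⟨ X ⟩) w ≈ᴷ h (std X w)
  homogeneousPart-same h X w refl = K.trans (eval-homogeneousPart (length w) h X w)
    (∑-δ 𝕂ᴹ h {std X w} (perms-unique (length w))
      (subst (λ n → std X w ∈ perms n) (length-std X w) (∈-perms (std-isPerm X w))))

  homogeneousPart-other : ∀ {n} h X w → length w ≢ n → (homogeneousPart n h ⟨ X ⟩) w ≈ᴷ 0#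
  homogeneousPart-other {n} h X w ∣w∣≢n = K.trans (eval-homogeneousPart n h X w)
    (∑-δ-∉ 𝕂ᴹ h {std X w} λ std∈ → ∣w∣≢n (≡.trans (≡.sym (length-std X w)) (proj₂ (perms-isPerm n std∈))))

  -- Returns from series to elements: a series that depends on standardizations only and vanishes
  -- from length N on is realized in `FQSym`.
  assemble : ℕ → (Word ℕ → 𝕂) → 𝐅
  assemble N h = ∑ FQSym (map (λ n → homogeneousPart n h) (upTo N))

  assemble-eval : ∀ N h X w → (N ℕ.≤ length w → h (std X w) ≈ᴷ 0#) → (assemble N h ⟨ X ⟩) w ≈ᴷ h (std X w)
  assemble-eval N h X w h≈0 = begin
    (assemble N h ⟨ X ⟩) w
      ≈⟨ IsLinear.∑-homo {M = FQSym} {N = 𝕂ᴹ} (eval-at-linear X w) (map part (upTo N)) ⟩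
    ∑ᴷ (map (λ f → (f ⟨ X ⟩) w) (map part (upTo N)))
      ≡⟨ cong ∑ᴷ (≡.trans (≡.sym (List.map-∘ (upTo N))) (List.map-upTo _ N)) ⟩
    S.∑< N (λ n → (part n ⟨ X ⟩) w)
      ≈⟨ cases (ℕ.<-≤-connex (length w) N) ⟩
    h (std X w) ∎
    where
    open import Relation.Binary.Reasoning.Setoid K.setoid
    part : ℕ → 𝐅
    part n = homogeneousPart n h

    cases : length w ℕ.< N ⊎ N ℕ.≤ length w → S.∑< N (λ n → (part n ⟨ X ⟩) w) ≈ᴷ h (std X w)
    cases (inj₁ ∣w∣<N) = K.trans (S.∑<-single ∣w∣<N λ _ n≢∣w∣ → homogeneousPart-other h X w (n≢∣w∣ ∘ ≡.sym))
      (homogeneousPart-same h X w refl)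
    cases (inj₂ N≤∣w∣) = K.trans (S.∑<-0 {N} λ n<N → homogeneousPart-other h X w
      λ ∣w∣≡n → ℕ.<⇒≱ n<N (subst (N ℕ.≤_) ∣w∣≡n N≤∣w∣)) (K.sym (h≈0 N≤∣w∣))

  𝐆-other-size : ∀ α w → length w ≢ size α → 𝐆 A α w ≈ᴷ 0#
  𝐆-other-size α w ∣w∣≢ = K.trans (K.reflexive (𝐆-δ A α w)) (K.reflexive (δ-≢ {word α} {std A w} λ eq → ∣w∣≢
    (≡.trans (≡.sym (length-std A w)) (≡.trans (cong length (≡.sym eq)) (length-word α)))))

  -- A bound read off the representing list. Equal elements may have different bounds, which is
  -- harmless, as it serves only to truncate.
  degree : 𝐅 → ℕ
  degree = foldr (λ (_ , α) n → size α ℕ.⊔ n) 0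

  eval-above-degree : ∀ f w → degree f ℕ.< length w → (f ⟨ A ⟩) w ≈ᴷ 0#
  eval-above-degree []            w d<∣w∣ = K.refl
  eval-above-degree ((c , α) ∷ f) w d<∣w∣ = K.trans
    (+-cong (K.trans (*-congˡ (𝐆-other-size α w (ℕ.>⇒≢ (ℕ.≤-<-trans (ℕ.m≤m⊔n (size α) (degree f)) d<∣w∣)))) (K.zeroʳ c))
            (eval-above-degree f w (ℕ.≤-<-trans (ℕ.m≤n⊔m (size α) (degree f)) d<∣w∣)))
    (K.+-identityˡ 0#)

  eval-degree : ∀ {n} f → Degree n f → ∀ w → length w ≢ n → (f ⟨ A ⟩) w ≈ᴷ 0#
  eval-degree {n} f (g , sizes , f≈g) w ∣w∣≢n = K.trans (f≈g w) (vanish g sizes)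
    where
    vanish : ∀ g → All (λ (_ , α) → size α ≡ n) g → (g ⟨ A ⟩) w ≈ᴷ 0#
    vanish []            []             = K.refl
    vanish ((c , α) ∷ g) (refl ∷ sizes) = K.trans
      (+-cong (K.trans (*-congˡ (𝐆-other-size α w ∣w∣≢n)) (K.zeroʳ c)) (vanish g sizes)) (K.+-identityˡ 0#)

  homogeneousPart-sizes : ∀ n h → All (λ (_ , α) → size α ≡ n) (homogeneousPart n h)
  homogeneousPart-sizes n h = All.map⁺ (All.tabulate λ p∈ → proj₂ (perms-isPerm n p∈))

  -- Membership in `Degree n` asks for a representing list; here it becomes a vanishing condition on
  -- the words of other lengths, which sums, multiples and products visibly inherit.
  degree-from-eval : ∀ {n} f → (∀ w → length w ≢ n → (f ⟨ A ⟩) w ≈ᴷ 0#) → Degree n f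
  degree-from-eval {n} f f≈0 = homogeneousPart n (f ⟨ A ⟩) , homogeneousPart-sizes n (f ⟨ A ⟩) , eq
    where
    eq : f F.≈ᴹ homogeneousPart n (f ⟨ A ⟩)
    eq w with length w ℕ.≟ n
    ... | yes ∣w∣≡n = K.trans (eval-std A f w) (K.sym (homogeneousPart-same (f ⟨ A ⟩) A w ∣w∣≡n))
    ... | no  ∣w∣≢n = K.trans (f≈0 w ∣w∣≢n) (K.sym (homogeneousPart-other (f ⟨ A ⟩) A w ∣w∣≢n))

  -- The product

  infixl 7 _∙_
  _∙_ : 𝐅 → 𝐅 → 𝐅
  -- `assemble N` covers the degrees below N, while the product may reach the sum of the two bounds;
  -- hence the `suc`.
  f ∙ g = assemble (suc (degree f ℕ.+ degree g)) (f ⟨ A ⟩ ✶ g ⟨ A ⟩)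

  ✶-std : ∀ X f g w → (f ⟨ A ⟩ ✶ g ⟨ A ⟩) (std X w) ≈ᴷ (f ⟨ X ⟩ ✶ g ⟨ X ⟩) w
  ✶-std X f g w = begin
    (f ⟨ A ⟩ ✶ g ⟨ A ⟩) (std X w)
      ≈⟨ cutSum-∑< _ (std X w) ⟩
    S.∑< (suc (length (std X w))) (λ i → (f ⟨ A ⟩) (take i (std X w)) * (g ⟨ A ⟩) (drop i (std X w)))
      ≡⟨ cong (λ n → S.∑< (suc n) (λ i → (f ⟨ A ⟩) (take i (std X w)) * (g ⟨ A ⟩) (drop i (std X w)))) (length-std X w) ⟩
    S.∑< (suc (length w)) (λ i → (f ⟨ A ⟩) (take i (std X w)) * (g ⟨ A ⟩) (drop i (std X w)))
      ≈⟨ S.∑<-cong {suc (length w)} (λ {i} _ → *-cong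
           (step f (std-take X i w)) (step g (std-drop X i w))) ⟩
    S.∑< (suc (length w)) (λ i → (f ⟨ X ⟩) (take i w) * (g ⟨ X ⟩) (drop i w))
      ≈⟨ cutSum-∑< _ w ⟨
    (f ⟨ X ⟩ ✶ g ⟨ X ⟩) w ∎
    where
    open import Relation.Binary.Reasoning.Setoid K.setoid
    step : ∀ f {u v} → std A u ≡ std X v → (f ⟨ A ⟩) u ≈ᴷ (f ⟨ X ⟩) v
    step f {u} {v} eq = K.trans (eval-std A f u) (K.trans (K.reflexive (cong (f ⟨ A ⟩) eq)) (K.sym (eval-std X f v)))

  ∙-eval : ∀ X f g w → ((f ∙ g) ⟨ X ⟩) w ≈ᴷ (f ⟨ X ⟩ ✶ g ⟨ X ⟩) w
  ∙-eval X f g w = K.trans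
    (assemble-eval (suc (degree f ℕ.+ degree g)) (f ⟨ A ⟩ ✶ g ⟨ A ⟩) X w λ d<∣w∣ → cutSum-0 (λ u v → (f ⟨ A ⟩) u * (g ⟨ A ⟩) v) (std X w) λ u v eq →
      vanish u v (subst (degree f ℕ.+ degree g ℕ.<_) (≡.trans (≡.sym (length-std X w)) (≡.sym eq)) d<∣w∣))
    (✶-std X f g w)
    where
    vanish : ∀ u v → degree f ℕ.+ degree g ℕ.< length u ℕ.+ length v → (f ⟨ A ⟩) u * (g ⟨ A ⟩) v ≈ᴷ 0#
    vanish u v d<∣uv∣ with ℕ.<-≤-connex (degree f) (length u)
    ... | inj₁ df<∣u∣ = K.trans (*-congʳ (eval-above-degree f u df<∣u∣)) (K.zeroˡ _)
    ... | inj₂ ∣u∣≤df = K.trans (*-congˡ (eval-above-degree g v (ℕ.+-cancelˡ-< (degree f) _ _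
      (ℕ.<-≤-trans d<∣uv∣ (ℕ.+-monoˡ-≤ (length v) ∣u∣≤df))))) (K.zeroʳ _)

  𝟙 : 𝐅
  𝟙 = 𝐠 []

  𝟙-eval : ∀ w → (𝟙 ⟨ A ⟩) w ≈ᴷ one w
  𝟙-eval []      = eval-𝐠 A [] []
  𝟙-eval (a ∷ w) = eval-𝐠 A [] (a ∷ w)

  one-✶ : ∀ h w → (one ✶ h) w ≈ᴷ h w
  one-✶ h []      = K.*-identityˡ _
  one-✶ h (a ∷ w) = K.trans (+-cong (K.*-identityˡ _) (cutSum-0 (λ _ v → 0# * h v) w λ _ v _ → K.zeroˡ (h v))) (K.+-identityʳ _)

  ✶-one : ∀ h w → (h ✶ one) w ≈ᴷ h w
  ✶-one h []      = K.*-identityʳ _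
  ✶-one h (a ∷ w) = K.trans (+-cong (K.zeroʳ _) (✶-one (h ∘ (a ∷_)) w)) (K.+-identityˡ _)

  ∙-cong : ∀ {f f′ g g′} → f F.≈ᴹ f′ → g F.≈ᴹ g′ → f ∙ g F.≈ᴹ f′ ∙ g′
  ∙-cong {f} {f′} {g} {g′} f≈f′ g≈g′ w = K.trans (∙-eval A f g w) (K.trans (✶-cong f≈f′ g≈g′ w) (K.sym (∙-eval A f′ g′ w)))

  ∙-assoc : ∀ f g h → (f ∙ g) ∙ h F.≈ᴹ f ∙ (g ∙ h)
  ∙-assoc f g h w = begin
    (((f ∙ g) ∙ h) ⟨ A ⟩) w            ≈⟨ ∙-eval A (f ∙ g) h w ⟩
    ((f ∙ g) ⟨ A ⟩ ✶ h ⟨ A ⟩) w        ≈⟨ ✶-cong (∙-eval A f g) (λ _ → K.refl) w ⟩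
    (f ⟨ A ⟩ ✶ g ⟨ A ⟩ ✶ h ⟨ A ⟩) w    ≈⟨ ✶-assoc (f ⟨ A ⟩) (g ⟨ A ⟩) (h ⟨ A ⟩) w ⟩
    (f ⟨ A ⟩ ✶ (g ⟨ A ⟩ ✶ h ⟨ A ⟩)) w  ≈⟨ ✶-cong (λ _ → K.refl) (∙-eval A g h) w ⟨
    (f ⟨ A ⟩ ✶ (g ∙ h) ⟨ A ⟩) w        ≈⟨ ∙-eval A f (g ∙ h) w ⟨
    ((f ∙ (g ∙ h)) ⟨ A ⟩) w            ∎
    where open import Relation.Binary.Reasoning.Setoid K.setoid

  ∙-identityˡ : ∀ f → 𝟙 ∙ f F.≈ᴹ f
  ∙-identityˡ f w = K.trans (∙-eval A 𝟙 f w) (K.trans (✶-cong 𝟙-eval (λ _ → K.refl) w) (one-✶ (f ⟨ A ⟩) w))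

  ∙-identityʳ : ∀ f → f ∙ 𝟙 F.≈ᴹ f
  ∙-identityʳ f w = K.trans (∙-eval A f 𝟙 w) (K.trans (✶-cong (λ _ → K.refl) 𝟙-eval w) (✶-one (f ⟨ A ⟩) w))

  ∙-linearˡ : ∀ g → IsLinear FQSym FQSym (_∙ g)
  ∙-linearˡ g = mkLinear FQSym FQSym (_∙ g)
    (λ {f} {f′} f≈f′ → ∙-cong {f} {f′} {g} {g} f≈f′ (λ _ → K.refl))
    (λ f f′ w → begin
      (((f F.+ᴹ f′) ∙ g) ⟨ A ⟩) w                                  ≈⟨ ∙-eval A (f F.+ᴹ f′) g w ⟩
      ((f F.+ᴹ f′) ⟨ A ⟩ ✶ g ⟨ A ⟩) w                              ≈⟨ ✶-cong (IsLinear.+ᴹ-homo {M = FQSym} {N = Series A} (eval-linear A) f f′) (λ _ → K.refl) w ⟩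
      ((λ u → (f ⟨ A ⟩) u + (f′ ⟨ A ⟩) u) ✶ g ⟨ A ⟩) w             ≈⟨ ✶-distribʳ (f ⟨ A ⟩) (f′ ⟨ A ⟩) (g ⟨ A ⟩) w ⟩
      (f ⟨ A ⟩ ✶ g ⟨ A ⟩) w + (f′ ⟨ A ⟩ ✶ g ⟨ A ⟩) w               ≈⟨ +-cong (∙-eval A f g w) (∙-eval A f′ g w) ⟨
      ((f ∙ g) ⟨ A ⟩) w + ((f′ ∙ g) ⟨ A ⟩) w                       ≈⟨ eval-at.+ᴹ-homo w (f ∙ g) (f′ ∙ g) ⟨
      ((f ∙ g F.+ᴹ f′ ∙ g) ⟨ A ⟩) w                                ∎)
    (λ c f w → begin
      (((c F.*ₗ f) ∙ g) ⟨ A ⟩) w                  ≈⟨ ∙-eval A (c F.*ₗ f) g w ⟩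
      ((c F.*ₗ f) ⟨ A ⟩ ✶ g ⟨ A ⟩) w              ≈⟨ ✶-cong (IsLinear.*ₗ-homo {M = FQSym} {N = Series A} (eval-linear A) c f) (λ _ → K.refl) w ⟩
      ((λ u → c * (f ⟨ A ⟩) u) ✶ g ⟨ A ⟩) w       ≈⟨ ✶-scaleˡ c (f ⟨ A ⟩) (g ⟨ A ⟩) w ⟩
      c * (f ⟨ A ⟩ ✶ g ⟨ A ⟩) w                   ≈⟨ *-congˡ (∙-eval A f g w) ⟨
      c * ((f ∙ g) ⟨ A ⟩) w                       ≈⟨ eval-at.*ₗ-homo w c (f ∙ g) ⟨
      ((c F.*ₗ (f ∙ g)) ⟨ A ⟩) w                  ∎)
    where open import Relation.Binary.Reasoning.Setoid K.setoid

  ∙-linearʳ : ∀ f → IsLinear FQSym FQSym (f ∙_)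
  ∙-linearʳ f = mkLinear FQSym FQSym (f ∙_)
    (λ {g} {g′} → ∙-cong {f} {f} {g} {g′} (λ _ → K.refl))
    (λ g g′ w → begin
      ((f ∙ (g F.+ᴹ g′)) ⟨ A ⟩) w                                  ≈⟨ ∙-eval A f (g F.+ᴹ g′) w ⟩
      (f ⟨ A ⟩ ✶ (g F.+ᴹ g′) ⟨ A ⟩) w                              ≈⟨ ✶-cong (λ _ → K.refl) (IsLinear.+ᴹ-homo {M = FQSym} {N = Series A} (eval-linear A) g g′) w ⟩
      (f ⟨ A ⟩ ✶ (λ u → (g ⟨ A ⟩) u + (g′ ⟨ A ⟩) u)) w             ≈⟨ ✶-distribˡ (f ⟨ A ⟩) (g ⟨ A ⟩) (g′ ⟨ A ⟩) w ⟩
      (f ⟨ A ⟩ ✶ g ⟨ A ⟩) w + (f ⟨ A ⟩ ✶ g′ ⟨ A ⟩) w               ≈⟨ +-cong (∙-eval A f g w) (∙-eval A f g′ w) ⟨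
      ((f ∙ g) ⟨ A ⟩) w + ((f ∙ g′) ⟨ A ⟩) w                       ≈⟨ eval-at.+ᴹ-homo w (f ∙ g) (f ∙ g′) ⟨
      ((f ∙ g F.+ᴹ f ∙ g′) ⟨ A ⟩) w                                ∎)
    (λ c g w → begin
      ((f ∙ (c F.*ₗ g)) ⟨ A ⟩) w                  ≈⟨ ∙-eval A f (c F.*ₗ g) w ⟩
      (f ⟨ A ⟩ ✶ (c F.*ₗ g) ⟨ A ⟩) w              ≈⟨ ✶-cong (λ _ → K.refl) (IsLinear.*ₗ-homo {M = FQSym} {N = Series A} (eval-linear A) c g) w ⟩
      (f ⟨ A ⟩ ✶ (λ u → c * (g ⟨ A ⟩) u)) w       ≈⟨ ✶-scaleʳ c (f ⟨ A ⟩) (g ⟨ A ⟩) w ⟩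
      c * (f ⟨ A ⟩ ✶ g ⟨ A ⟩) w                   ≈⟨ *-congˡ (∙-eval A f g w) ⟨
      c * ((f ∙ g) ⟨ A ⟩) w                       ≈⟨ eval-at.*ₗ-homo w c (f ∙ g) ⟨
      ((c F.*ₗ (f ∙ g)) ⟨ A ⟩) w                  ∎)
    where open import Relation.Binary.Reasoning.Setoid K.setoid

  -- The coproduct and its image among series with commuting letters

  private
    module T = Sums (FQSym ⊗ FQSym)

  splitting : Word ℕ → F⊗F.Carrierᴹ
  splitting p = T.∑< (suc (length p)) λ k → [ 𝐠 (lo k p) , 𝐠 (hi k p) ]

  Δ : 𝐅 → F⊗F.Carrierᴹ
  Δ = value (FQSym ⊗ FQSym) (splitting ∘ word)

  module _ {n ℓn} (N : LeftModule ring n ℓn) (φ : Word ℕ → LeftModule.Carrierᴹ N) where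

    -- Equal elements have equal series, and the series at `word α` is the coefficient of α, so
    -- `value-determined` applies: any prescription on permutation words extends linearly.
    extend-linear : IsLinear FQSym N (value N (φ ∘ word))
    extend-linear = mkLinear FQSym N (value N (φ ∘ word))
      (λ {f} {g} f≈g → value-determined N φ word f g λ α →
        K.trans (K.sym (eval-perm f (word-isPerm α))) (K.trans (f≈g (word α)) (eval-perm g (word-isPerm α))))
      (value-++ N (φ ∘ word)) (value-scale N (φ ∘ word))

    extend-G : ∀ α → LeftModule._≈ᴹ_ N (value N (φ ∘ word) (G α)) (φ (word α))
    extend-G α = LeftModule.≈ᴹ-trans N (LeftModule.+ᴹ-identityʳ N _) (LeftModule.*ₗ-identityˡ N _)

  Δ-linear : IsLinear FQSym (FQSym ⊗ FQSym) Δ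
  Δ-linear = extend-linear (FQSym ⊗ FQSym) splitting

  Δ-G : ∀ α → Δ (G α) F⊗F.≈ᴹ splitting (word α)
  Δ-G = extend-G (FQSym ⊗ FQSym) splitting

  Δ-𝐠 : ∀ {p} → IsPerm p → Δ (𝐠 p) F⊗F.≈ᴹ splitting p
  Δ-𝐠 {p} h = F⊗F.≈ᴹ-trans (Δ-G (toColoredPerm p)) (F⊗F.≈ᴹ-reflexive (cong splitting (word-toColoredPerm-perm h)))

  identify-linear : IsLinear (FQSym ⊗ FQSym) Series₂ identify
  identify-linear = ⊗-lift-linear FQSym FQSym Series₂
    (λ g → mkLinear FQSym Series₂ _
      (λ f≈f′ (w′ , w″) → *-congʳ (f≈f′ w′))
      (λ f f′ (w′ , w″) → K.trans (*-congʳ (ev.+ᴹ-homo f f′ w′)) (K.distribʳ _ _ _))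
      (λ c f (w′ , w″) → K.trans (*-congʳ (ev.*ₗ-homo c f w′)) (K.*-assoc _ _ _)))
    (λ f → mkLinear FQSym Series₂ _
      (λ g≈g′ (w′ , w″) → *-congˡ (g≈g′ w″))
      (λ g g′ (w′ , w″) → K.trans (*-congˡ (ev.+ᴹ-homo g g′ w″)) (K.distribˡ _ _ _))
      (λ c g (w′ , w″) → K.trans (*-congˡ (ev.*ₗ-homo c g w″))
        (K.trans (K.sym (K.*-assoc _ _ _)) (K.trans (*-congʳ (K.*-comm _ c)) (K.*-assoc _ _ _)))))
    where module ev = IsLinear {M = FQSym} {N = Series A} (eval-linear A)

  identify-at-linear : ∀ w → IsLinear (FQSym ⊗ FQSym) 𝕂ᴹ (λ t → identify t w)
  identify-at-linear w = ∘-linear {L = FQSym ⊗ FQSym} {M = Series₂} {N = 𝕂ᴹ} (at-linear w) identify-linear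

  _≟²_ : DecidableEquality (Word ℕ × Word ℕ)
  _≟²_ = Prod.≡-dec _≟ᵂ_ _≟ᵂ_

  private
    module D² = Delta _≟²_

  δ²-δ : ∀ p q p′ q′ → D².δ (p , q) (p′ , q′) ≈ᴷ δ p p′ * δ q q′
  δ²-δ p q p′ q′ = cases (p ≟ᵂ p′) (q ≟ᵂ q′)
    where
    cases : Dec (p ≡ p′) → Dec (q ≡ q′) → D².δ (p , q) (p′ , q′) ≈ᴷ δ p p′ * δ q q′
    cases (no p≢p′) _ = K.trans (K.reflexive (D².δ-≢ {p , q} {p′ , q′} (p≢p′ ∘ Prod.,-injectiveˡ)))
      (K.sym (K.trans (*-congʳ (K.reflexive (δ-≢ p≢p′))) (K.zeroˡ _)))
    cases _ (no q≢q′) = K.trans (K.reflexive (D².δ-≢ {p , q} {p′ , q′} (q≢q′ ∘ Prod.,-injectiveʳ)))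
      (K.sym (K.trans (*-congˡ (K.reflexive (δ-≢ q≢q′))) (K.zeroʳ _)))
    cases (yes p≡p′) (yes q≡q′) = K.trans (K.reflexive (D².δ-≡ (cong₂ _,_ p≡p′ q≡q′)))
      (K.sym (K.trans (*-cong (K.reflexive (δ-≡ p≡p′)) (K.reflexive (δ-≡ q≡q′))) (K.*-identityˡ _)))

  private
    word² : ColoredPerm × ColoredPerm → Word ℕ × Word ℕ
    word² (α , β) = word α , word β

    𝐠² : Word ℕ × Word ℕ → F⊗F.Carrierᴹ
    𝐠² (p , q) = [ 𝐠 p , 𝐠 q ]

    monomialsᶠ : F⊗F.Carrierᴹ → List (𝕂 × (ColoredPerm × ColoredPerm))
    monomialsᶠ = monomials (Series A) (𝐆 A)

    ⊗-generator≈𝐠² : ∀ αβ → ⊗-generator (Series A) (𝐆 A) αβ F⊗F.≈ᴹ 𝐠² (word² αβ)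
    ⊗-generator≈𝐠² (α , β) = ⊗-cong {x = G α} {x′ = 𝐠 (word α)} {y = G β} {y′ = 𝐠 (word β)} (G≈𝐠 α) (G≈𝐠 β)
      where open Tensor FQSym FQSym using (⊗-cong)

    tensor-by-𝐠² : ∀ t → t F⊗F.≈ᴹ value (FQSym ⊗ FQSym) (𝐠² ∘ word²) (monomialsᶠ t)
    tensor-by-𝐠² t = F⊗F.≈ᴹ-trans {t} {value (FQSym ⊗ FQSym) (⊗-generator (Series A) (𝐆 A)) (monomialsᶠ t)}
      {value (FQSym ⊗ FQSym) (𝐠² ∘ word²) (monomialsᶠ t)}
      (tensor-by-generators (Series A) (𝐆 A) t)
      (value-cong (FQSym ⊗ FQSym) {e = ⊗-generator (Series A) (𝐆 A)} {e′ = 𝐠² ∘ word²} ⊗-generator≈𝐠² (monomialsᶠ t))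

    -- At a pair of permutation words, the image of a product of two generators is a product of two
    -- deltas, so evaluation there extracts one coefficient.
    identify-coefficient : ∀ t αβ → identify t (word² αβ) ≈ᴷ D².coefficient word² (monomialsᶠ t) (word² αβ)
    identify-coefficient t (α , β) = begin
      identify t (word α , word β)
        ≈⟨ id.⟦⟧-cong (tensor-by-𝐠² t) ⟩
      identify (value (FQSym ⊗ FQSym) (𝐠² ∘ word²) (monomialsᶠ t)) (word α , word β)
        ≈⟨ id.value-homo (𝐠² ∘ word²) (monomialsᶠ t) ⟩
      value 𝕂ᴹ (λ α′β′ → identify (𝐠² (word² α′β′)) (word α , word β)) (monomialsᶠ t)
        ≈⟨ value-cong 𝕂ᴹ step (monomialsᶠ t) ⟩
      D².coefficient word² (monomialsᶠ t) (word α , word β) ∎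
      where
      open import Relation.Binary.Reasoning.Setoid K.setoid
      module id = IsLinear {M = FQSym ⊗ FQSym} {N = 𝕂ᴹ} (identify-at-linear (word α , word β))

      𝐠-word : ∀ α′ α → (𝐠 (word α′) ⟨ A ⟩) (word α) ≈ᴷ δ (word α′) (word α)
      𝐠-word α′ α = K.trans (eval-𝐠 A (word-isPerm α′) (word α)) (K.reflexive (cong (δ (word α′)) (std-perm (word-isPerm α))))

      step : ∀ α′β′ → identify (𝐠² (word² α′β′)) (word α , word β) ≈ᴷ D².δ (word² α′β′) (word α , word β)
      step (α′ , β′) = K.trans (K.+-identityʳ _) (K.trans (*-cong (𝐠-word α′ α) (𝐠-word β′ β)) (K.sym (δ²-δ (word α′) (word β′) (word α) (word β))))

  -- FQSym ⊗ FQSym is free on the products of two G's, whose images under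
  -- identify are linearly independent.
  identify-injective : ∀ {s t} → (∀ w → identify s w ≈ᴷ identify t w) → s F⊗F.≈ᴹ t
  identify-injective {s} {t} s≈t = begin
    s                                                              ≈⟨ tensor-by-𝐠² s ⟩
    value (FQSym ⊗ FQSym) (𝐠² ∘ word²) (monomialsᶠ s)              ≈⟨ D².value-determined (FQSym ⊗ FQSym) 𝐠² word² (monomialsᶠ s) (monomialsᶠ t)
      (λ αβ → K.trans (K.sym (identify-coefficient s αβ)) (K.trans (s≈t (word² αβ)) (identify-coefficient t αβ))) ⟩
    value (FQSym ⊗ FQSym) (𝐠² ∘ word²) (monomialsᶠ t)              ≈⟨ tensor-by-𝐠² t ⟨
    t                                                              ∎
    where open import Relation.Binary.Reasoning.Setoid F⊗F.≈ᴹ-setoid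

  H : RawBialgebra FQSym
  H = record { _∙_ = _∙_ ; 𝟙 = 𝟙 ; Δ = Δ ; ε = λ f → (f ⟨ A ⟩) [] }

  open RawBialgebra H using (_∙⊗_; lift; ε; Δ⊗id∘Δ; id⊗Δ∘Δ)

  private
    module identify-at w = IsLinear {M = FQSym ⊗ FQSym} {N = 𝕂ᴹ} (identify-at-linear w)

  identify-splitting : ∀ {p} → IsPerm p → ∀ w′ w″ →
    identify (splitting p) (w′ , w″) ≈ᴷ S.∑< (suc (length p)) λ k → δ (lo k p) (std A w′) * δ (hi k p) (std A w″)
  identify-splitting {p} h w′ w″ = K.trans
    (identify-at.∑<-homo (w′ , w″) (suc (length p)) (λ k → [ 𝐠 (lo k p) , 𝐠 (hi k p) ]))
    (S.∑<-cong {suc (length p)} λ {k} k<n → K.trans (K.+-identityʳ _)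
      (*-cong (eval-𝐠 A (lo-isPerm h (ℕ.s≤s⁻¹ k<n)) w′) (eval-𝐠 A (hi-isPerm h (ℕ.s≤s⁻¹ k<n)) w″)))

  open DecMembership _≟ᵂ_ using (_∈?_)

  -- Both sides are 1 or 0 according to whether p is among the shuffles. On the left the shuffles
  -- are distinct; on the right `lo k p` has length k, so only k = `length q` can contribute.
  shuffles-δ : ∀ {p q} r → IsPerm p → IsPerm q →
    ∑ᴷ (map (δ p) (shuffles q (shift (length q) r))) ≈ᴷ S.∑< (suc (length p)) λ k → δ (lo k p) q * δ (hi k p) r
  -- The factor `1#` brings the sum into the form required by `∑-δ`.
  shuffles-δ {p} {q} r hp hq = K.trans (K.sym (S.∑-cong L λ {z} _ → K.*-identityʳ (δ p z))) (cases (p ∈? L))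
    where
    L : List (Word ℕ)
    L = shuffles q (shift (length q) r)

    term : ℕ → 𝕂
    term k = δ (lo k p) q * δ (hi k p) r

    term-0 : ∀ {k} → ¬ (lo k p ≡ q × hi k p ≡ r) → term k ≈ᴷ 0#
    term-0 {k} ¬eq = by (lo k p ≟ᵂ q) (hi k p ≟ᵂ r)
      where
      by : Dec (lo k p ≡ q) → Dec (hi k p ≡ r) → term k ≈ᴷ 0#
      by (no lo≢q)  _          = K.trans (*-congʳ (K.reflexive (δ-≢ lo≢q))) (K.zeroˡ _)
      by _          (no hi≢r)  = K.trans (*-congˡ (K.reflexive (δ-≢ hi≢r))) (K.zeroʳ _)
      by (yes lo≡q) (yes hi≡r) = contradiction (lo≡q , hi≡r) ¬eq

    k≡∣q∣ : ∀ {k} → k ℕ.< suc (length p) → lo k p ≡ q → k ≡ length q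
    k≡∣q∣ k<n lo≡q = ≡.trans (≡.sym (length-lo hp (ℕ.s≤s⁻¹ k<n))) (cong length lo≡q)

    cases : Dec (p ∈ L) → ∑ᴷ (map (λ z → δ p z * 1#) L) ≈ᴷ S.∑< (suc (length p)) λ k → δ (lo k p) q * δ (hi k p) r
    cases (yes p∈L) with k≤n , lo≡q , hi≡r ← Equivalence.to (∈-shifted-shuffles hq) p∈L = K.trans
      (∑-δ 𝕂ᴹ (λ _ → 1#) {p} (shifted-shuffles-unique r hq) p∈L)
      (K.sym (K.trans
        (S.∑<-single {f = term} (s≤s k≤n) λ k<n k≢∣q∣ → term-0 λ (lo≡q , _) → k≢∣q∣ (k≡∣q∣ k<n lo≡q))
        (K.trans (*-cong (K.reflexive (δ-≡ lo≡q)) (K.reflexive (δ-≡ hi≡r))) (K.*-identityˡ 1#))))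
    cases (no p∉L) = K.trans (∑-δ-∉ 𝕂ᴹ (λ _ → 1#) {p} p∉L)
      (K.sym (S.∑<-0 {suc (length p)} {term} λ k<n → term-0 λ (lo≡q , hi≡r) → p∉L (member k<n lo≡q hi≡r)))
      where
      member : ∀ {k} → k ℕ.< suc (length p) → lo k p ≡ q → hi k p ≡ r → p ∈ L
      member k<n lo≡q hi≡r with refl ← k≡∣q∣ k<n lo≡q = Equivalence.from (∈-shifted-shuffles hq) (ℕ.s≤s⁻¹ k<n , lo≡q , hi≡r)

  commuting-linear : IsLinear (Series A′⊕A″) Series₂ commuting
  commuting-linear = mkLinear (Series A′⊕A″) Series₂ commuting
    (λ f≈g (w′ , w″) → shuffleSum-cong f≈g (left w′) (right w″))
    (λ f g (w′ , w″) → S.∑-+ f g (shuffles (left w′) (right w″)))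
    (λ c f (w′ , w″) → S.∑-* c f (shuffles (left w′) (right w″)))

  commuting-G : ∀ α w′ w″ → commuting (G α ⟨ A′⊕A″ ⟩) (w′ , w″) ≈ᴷ ∑ᴷ (map (δ (word α)) (shuffles (std A w′) (shift (length (std A w′)) (std A w″))))
  commuting-G α w′ w″ = begin
    ∑ᴷ (map (G α ⟨ A′⊕A″ ⟩) L)                  ≈⟨ S.∑-cong L (λ {z} _ → eval-G A′⊕A″ α z) ⟩
    ∑ᴷ (map (δ (word α) ∘ std A′⊕A″) L)         ≡⟨ cong ∑ᴷ (List.map-∘ L) ⟩
    ∑ᴷ (map (δ (word α)) (map (std A′⊕A″) L))   ≡⟨ cong (∑ᴷ ∘ map (δ (word α))) (std-shuffles w′ w″) ⟩
    ∑ᴷ (map (δ (word α)) (shuffles (std A w′) (shift (length w′) (std A w″))))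
      ≡⟨ cong (λ n → ∑ᴷ (map (δ (word α)) (shuffles (std A w′) (shift n (std A w″))))) (length-std A w′) ⟨
    ∑ᴷ (map (δ (word α)) (shuffles (std A w′) (shift (length (std A w′)) (std A w″)))) ∎
    where
    open import Relation.Binary.Reasoning.Setoid K.setoid
    L : List (Word (ℕ ⊎ ℕ))
    L = shuffles (left w′) (right w″)

  identify-Δ : ∀ f w → identify (Δ f) w ≈ᴷ commuting (f ⟨ A′⊕A″ ⟩) w
  identify-Δ = linear-ext (Series A) (𝐆 A) {N = Series₂} {φ = identify ∘ Δ} {ψ = λ f → commuting (f ⟨ A′⊕A″ ⟩)}
    (∘-linear {L = FQSym} {M = FQSym ⊗ FQSym} {N = Series₂} identify-linear Δ-linear)
    (∘-linear {L = FQSym} {M = Series A′⊕A″} {N = Series₂} commuting-linear (eval-linear A′⊕A″))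
    λ α (w′ , w″) → begin
      identify (Δ (G α)) (w′ , w″)
        ≈⟨ identify-at.⟦⟧-cong (w′ , w″) (Δ-G α) ⟩
      identify (splitting (word α)) (w′ , w″)
        ≈⟨ identify-splitting (word-isPerm α) w′ w″ ⟩
      S.∑< (suc (length (word α))) (λ k → δ (lo k (word α)) (std A w′) * δ (hi k (word α)) (std A w″))
        ≈⟨ shuffles-δ (std A w″) (word-isPerm α) (std-isPerm A w′) ⟨
      ∑ᴷ (map (δ (word α)) (shuffles (std A w′) (shift (length (std A w′)) (std A w″))))
        ≈⟨ commuting-G α w′ w″ ⟨
      commuting (G α ⟨ A′⊕A″ ⟩) (w′ , w″) ∎
    where open import Relation.Binary.Reasoning.Setoid K.setoid

  identify-∙⊗ : ∀ s t w′ w″ → identify (s ∙⊗ t) (w′ , w″) ≈ᴷ ((λ x y → identify s (x , y)) ✶✶ (λ x y → identify t (x , y))) w′ w″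
  identify-∙⊗ []            t w′ w″ = K.sym (✶✶-zeroˡ _ w′ w″)
  identify-∙⊗ ((f , g) ∷ s) t w′ w″ = begin
    identify (map _ t ++ s ∙⊗ t) (w′ , w″)
      ≈⟨ identify-at.+ᴹ-homo (w′ , w″) (map _ t) (s ∙⊗ t) ⟩
    identify (map _ t) (w′ , w″) + identify (s ∙⊗ t) (w′ , w″)
      ≈⟨ +-cong (row t) (identify-∙⊗ s t w′ w″) ⟩
    (fg ✶✶ (λ x y → identify t (x , y))) w′ w″ + ((λ x y → identify s (x , y)) ✶✶ (λ x y → identify t (x , y))) w′ w″
      ≈⟨ ✶✶-distribʳ fg (λ x y → identify s (x , y)) (λ x y → identify t (x , y)) w′ w″ ⟨
    ((λ x y → identify ((f , g) ∷ s) (x , y)) ✶✶ (λ x y → identify t (x , y))) w′ w″ ∎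
    where
    open import Relation.Binary.Reasoning.Setoid K.setoid
    fg : Word ℕ → Word ℕ → 𝕂
    fg x y = (f ⟨ A ⟩) x * (g ⟨ A ⟩) y

    row : ∀ t → identify (map (λ (f′ , g′) → f ∙ f′ , g ∙ g′) t) (w′ , w″) ≈ᴷ (fg ✶✶ (λ x y → identify t (x , y))) w′ w″
    row []              = K.sym (✶✶-zeroʳ fg w′ w″)
    row ((f′ , g′) ∷ t) = begin
      ((f ∙ f′) ⟨ A ⟩) w′ * ((g ∙ g′) ⟨ A ⟩) w″ + identify (map _ t) (w′ , w″)
        ≈⟨ +-cong (*-cong (∙-eval A f f′ w′) (∙-eval A g g′ w″)) (row t) ⟩
      (f ⟨ A ⟩ ✶ f′ ⟨ A ⟩) w′ * (g ⟨ A ⟩ ✶ g′ ⟨ A ⟩) w″ + (fg ✶✶ (λ x y → identify t (x , y))) w′ w″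
        ≈⟨ +-congʳ (✶-*-✶ (f ⟨ A ⟩) (f′ ⟨ A ⟩) (g ⟨ A ⟩) (g′ ⟨ A ⟩) w′ w″) ⟩
      (fg ✶✶ (λ x y → (f′ ⟨ A ⟩) x * (g′ ⟨ A ⟩) y)) w′ w″ + (fg ✶✶ (λ x y → identify t (x , y))) w′ w″
        ≈⟨ ✶✶-distribˡ fg (λ x y → (f′ ⟨ A ⟩) x * (g′ ⟨ A ⟩) y) (λ x y → identify t (x , y)) w′ w″ ⟨
      (fg ✶✶ (λ x y → identify ((f′ , g′) ∷ t) (x , y))) w′ w″ ∎

  Δ-∙-homo : ∀ f g → Δ (f ∙ g) F⊗F.≈ᴹ Δ f ∙⊗ Δ g
  Δ-∙-homo f g = identify-injective {Δ (f ∙ g)} {Δ f ∙⊗ Δ g} λ (w′ , w″) → begin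
    identify (Δ (f ∙ g)) (w′ , w″)
      ≈⟨ identify-Δ (f ∙ g) (w′ , w″) ⟩
    shuffleSum ((f ∙ g) ⟨ A′⊕A″ ⟩) (left w′) (right w″)
      ≈⟨ shuffleSum-cong (∙-eval A′⊕A″ f g) (left w′) (right w″) ⟩
    shuffleSum (f ⟨ A′⊕A″ ⟩ ✶ g ⟨ A′⊕A″ ⟩) (left w′) (right w″)
      ≈⟨ shuffleSum-✶ (f ⟨ A′⊕A″ ⟩) (g ⟨ A′⊕A″ ⟩) (left w′) (right w″) ⟩
    (shuffleSum (f ⟨ A′⊕A″ ⟩) ✶✶ shuffleSum (g ⟨ A′⊕A″ ⟩)) (left w′) (right w″)
      ≡⟨ cutSum-map _ _ w′ ⟩
    cutSum (λ x₁ x₂ → cutSum (λ y₁ y₂ → shuffleSum (f ⟨ A′⊕A″ ⟩) (left x₁) y₁ * shuffleSum (g ⟨ A′⊕A″ ⟩) (left x₂) y₂) (right w″)) w′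
      ≈⟨ cutSum-cong (λ x₁ x₂ → K.reflexive (cutSum-map _ _ w″)) w′ ⟩
    ((λ x y → commuting (f ⟨ A′⊕A″ ⟩) (x , y)) ✶✶ (λ x y → commuting (g ⟨ A′⊕A″ ⟩) (x , y))) w′ w″
      ≈⟨ ✶✶-cong (λ x y → identify-Δ f (x , y)) (λ x y → identify-Δ g (x , y)) w′ w″ ⟨
    ((λ x y → identify (Δ f) (x , y)) ✶✶ (λ x y → identify (Δ g) (x , y))) w′ w″
      ≈⟨ identify-∙⊗ (Δ f) (Δ g) w′ w″ ⟨
    identify (Δ f ∙⊗ Δ g) (w′ , w″) ∎
    where open import Relation.Binary.Reasoning.Setoid K.setoid

  Δ-𝟙-homo : Δ 𝟙 F⊗F.≈ᴹ [ 𝟙 , 𝟙 ]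
  Δ-𝟙-homo = Δ-𝐠 []

  -- Since `ε` is the coefficient of the empty word, the counit laws concern `identify (Δ f)` at
  -- pairs with one empty word, and such a pair has a single shuffle.
  Δ-eval-[]ˡ : ∀ f w → identify (Δ f) ([] , w) ≈ᴷ (f ⟨ A ⟩) w
  Δ-eval-[]ˡ f w = K.trans (identify-Δ f ([] , w)) (K.trans (K.+-identityʳ _)
    (K.trans (eval-std A′⊕A″ f (right w)) (K.trans (K.reflexive (cong (f ⟨ A ⟩) (std-right w))) (K.sym (eval-std A f w)))))

  Δ-eval-[]ʳ : ∀ f w → identify (Δ f) (w , []) ≈ᴷ (f ⟨ A ⟩) w
  Δ-eval-[]ʳ f w = K.trans (identify-Δ f (w , [])) (K.trans (shuffleSum-[] (f ⟨ A′⊕A″ ⟩) (left w))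
    (K.trans (eval-std A′⊕A″ f (left w)) (K.trans (K.reflexive (cong (f ⟨ A ⟩) (std-left w))) (K.sym (eval-std A f w)))))

  private
    lift-εˡ : ∀ t w → (lift (λ f g → ε f F.*ₗ g) t ⟨ A ⟩) w ≈ᴷ identify t ([] , w)
    lift-εˡ []            w = K.refl
    lift-εˡ ((f , g) ∷ t) w = K.trans (eval-at.+ᴹ-homo w (ε f F.*ₗ g) (lift (λ f g → ε f F.*ₗ g) t))
      (+-cong (eval-at.*ₗ-homo w (ε f) g) (lift-εˡ t w))

    lift-εʳ : ∀ t w → (lift (λ f g → ε g F.*ₗ f) t ⟨ A ⟩) w ≈ᴷ identify t (w , [])
    lift-εʳ []            w = K.refl
    lift-εʳ ((f , g) ∷ t) w = K.trans (eval-at.+ᴹ-homo w (ε g F.*ₗ f) (lift (λ f g → ε g F.*ₗ f) t))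
      (+-cong (K.trans (eval-at.*ₗ-homo w (ε g) f) (K.*-comm _ _)) (lift-εʳ t w))

  counitalˡ : ∀ f → lift (λ g h → ε g F.*ₗ h) (Δ f) F.≈ᴹ f
  counitalˡ f w = K.trans (lift-εˡ (Δ f) w) (Δ-eval-[]ˡ f w)

  counitalʳ : ∀ f → lift (λ g h → ε h F.*ₗ g) (Δ f) F.≈ᴹ f
  counitalʳ f w = K.trans (lift-εʳ (Δ f) w) (Δ-eval-[]ʳ f w)

  -- Coassociativity

  private
    F⊗F⊗F : LeftModule ring _ _
    F⊗F⊗F = FQSym ⊗ (FQSym ⊗ FQSym)

    module F⊗F⊗F = LeftModule F⊗F⊗F
    module T₃ = Sums F⊗F⊗F

    -- Addition in a tensor module is concatenation, so a map written entrywise on lists is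
    -- literally a sum of the kind that `⊗-lift-linear` handles.
    map-as-∑ : ∀ {a b} {B : Set a} {C : Set b} (f : B → C) xs → concatMap ([_] ∘ f) xs ≡ map f xs
    map-as-∑ f xs = ≡.trans (cong (foldr _++_ []) (List.map-∘ xs)) (List.concat-map-[ map f xs ])

    attach : 𝐅 → F⊗F.Carrierᴹ → F⊗F⊗F.Carrierᴹ
    attach h = map λ (f , g) → f , [ g , h ]

    triple-linear₁ : ∀ g h → IsLinear FQSym F⊗F⊗F (λ f → [ f , [ g , h ] ])
    triple-linear₁ g h = ⊗-linearˡ FQSym (FQSym ⊗ FQSym) [ g , h ]

    triple-linear₂ : ∀ f h → IsLinear FQSym F⊗F⊗F (λ g → [ f , [ g , h ] ])
    triple-linear₂ f h = ∘-linear {L = FQSym} {M = FQSym ⊗ FQSym} {N = F⊗F⊗F}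
      (⊗-linearʳ FQSym (FQSym ⊗ FQSym) f) (⊗-linearˡ FQSym FQSym h)

    triple-linear₃ : ∀ f g → IsLinear FQSym F⊗F⊗F (λ h → [ f , [ g , h ] ])
    triple-linear₃ f g = ∘-linear {L = FQSym} {M = FQSym ⊗ FQSym} {N = F⊗F⊗F}
      (⊗-linearʳ FQSym (FQSym ⊗ FQSym) f) (⊗-linearʳ FQSym FQSym g)

    attach-linear : ∀ h → IsLinear (FQSym ⊗ FQSym) F⊗F⊗F (attach h)
    attach-linear h = linear-resp {M = FQSym ⊗ FQSym} {N = F⊗F⊗F}
      {f = λ t → ∑ F⊗F⊗F (map (λ (f , g) → [ f , [ g , h ] ]) t)} {g = attach h}
      (λ t → F⊗F⊗F.≈ᴹ-reflexive (map-as-∑ _ t))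
      (⊗-lift-linear FQSym FQSym F⊗F⊗F {B = λ f g → [ f , [ g , h ] ]} (λ g → triple-linear₁ g h) (λ f → triple-linear₂ f h))

    attach-linear′ : ∀ t → IsLinear FQSym F⊗F⊗F (λ h → attach h t)
    attach-linear′ t = linear-resp {M = FQSym} {N = F⊗F⊗F}
      {f = λ h → ∑ F⊗F⊗F (map (λ (f , g) → [ f , [ g , h ] ]) t)} {g = λ h → attach h t}
      (λ h → F⊗F⊗F.≈ᴹ-reflexive (map-as-∑ _ t))
      (∑-linear {M = FQSym} {N = F⊗F⊗F} {φ = λ (f , g) h → [ f , [ g , h ] ]} (λ (f , g) → triple-linear₃ f g) t)

    Δ⊗id : F⊗F.Carrierᴹ → F⊗F⊗F.Carrierᴹ
    Δ⊗id = concatMap λ (f , h) → attach h (Δ f)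

    Δ⊗id-linear : IsLinear (FQSym ⊗ FQSym) F⊗F⊗F Δ⊗id
    Δ⊗id-linear = ⊗-lift-linear FQSym FQSym F⊗F⊗F {B = λ f h → attach h (Δ f)}
      (λ h → ∘-linear {L = FQSym} {M = FQSym ⊗ FQSym} {N = F⊗F⊗F} (attach-linear h) Δ-linear)
      (λ f → attach-linear′ (Δ f))

    id⊗Δ : F⊗F.Carrierᴹ → F⊗F⊗F.Carrierᴹ
    id⊗Δ = map (map₂ Δ)

    id⊗Δ-linear : IsLinear (FQSym ⊗ FQSym) F⊗F⊗F id⊗Δ
    id⊗Δ-linear = linear-resp {M = FQSym ⊗ FQSym} {N = F⊗F⊗F}
      {f = λ t → ∑ F⊗F⊗F (map (λ (f , g) → [ f , Δ g ]) t)} {g = id⊗Δ}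
      (λ t → F⊗F⊗F.≈ᴹ-reflexive (map-as-∑ _ t))
      (⊗-lift-linear FQSym FQSym F⊗F⊗F {B = λ f g → [ f , Δ g ]}
        (λ g → ⊗-linearˡ FQSym (FQSym ⊗ FQSym) (Δ g))
        (λ f → ∘-linear {L = FQSym} {M = FQSym ⊗ FQSym} {N = F⊗F⊗F} (⊗-linearʳ FQSym (FQSym ⊗ FQSym) f) Δ-linear))

    module attach h = IsLinear {M = FQSym ⊗ FQSym} {N = F⊗F⊗F} (attach-linear h)
    module Δ⊗id = IsLinear {M = FQSym ⊗ FQSym} {N = F⊗F⊗F} Δ⊗id-linear
    module id⊗Δ = IsLinear {M = FQSym ⊗ FQSym} {N = F⊗F⊗F} id⊗Δ-linear
    module pairʳ f = IsLinear {M = FQSym ⊗ FQSym} {N = F⊗F⊗F} (⊗-linearʳ FQSym (FQSym ⊗ FQSym) f)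

    𝐠³ : Word ℕ → Word ℕ → Word ℕ → F⊗F⊗F.Carrierᴹ
    𝐠³ p q r = [ 𝐠 p , [ 𝐠 q , 𝐠 r ] ]

  coassociative : ∀ f → Δ⊗id∘Δ f F⊗F⊗F.≈ᴹ id⊗Δ∘Δ f
  coassociative = linear-ext (Series A) (𝐆 A) {N = F⊗F⊗F} {φ = Δ⊗id ∘ Δ} {ψ = id⊗Δ ∘ Δ}
    (∘-linear {L = FQSym} {M = FQSym ⊗ FQSym} {N = F⊗F⊗F} Δ⊗id-linear Δ-linear)
    (∘-linear {L = FQSym} {M = FQSym ⊗ FQSym} {N = F⊗F⊗F} id⊗Δ-linear Δ-linear)
    on-G
    where
    open import Relation.Binary.Reasoning.Setoid F⊗F⊗F.≈ᴹ-setoid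
    on-G : ∀ α → Δ⊗id (Δ (G α)) F⊗F⊗F.≈ᴹ id⊗Δ (Δ (G α))
    on-G α = begin
      Δ⊗id (Δ (G α))
        ≈⟨ Δ⊗id.⟦⟧-cong {Δ (G α)} {splitting p} (Δ-G α) ⟩
      Δ⊗id (splitting p)
        ≈⟨ Δ⊗id.∑<-homo (suc n) (λ k → [ 𝐠 (lo k p) , 𝐠 (hi k p) ]) ⟩
      T₃.∑< (suc n) (λ k → Δ⊗id [ 𝐠 (lo k p) , 𝐠 (hi k p) ])
        ≈⟨ T₃.∑<-cong {suc n} {λ k → Δ⊗id [ 𝐠 (lo k p) , 𝐠 (hi k p) ]}
             {λ k → T₃.∑< (suc (length (lo k p))) λ j → 𝐠³ (lo j (lo k p)) (hi j (lo k p)) (hi k p)} left-term ⟩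
      T₃.∑< (suc n) (λ k → T₃.∑< (suc (length (lo k p))) λ j → 𝐠³ (lo j (lo k p)) (hi j (lo k p)) (hi k p))
        ≈⟨ ∑-coassoc K F⊗F⊗F 𝐠³ (word-isPerm α) ⟩
      T₃.∑< (suc n) (λ j → T₃.∑< (suc (length (hi j p))) λ i → 𝐠³ (lo j p) (lo i (hi j p)) (hi i (hi j p)))
        ≈⟨ T₃.∑<-cong {suc n} {λ j → id⊗Δ [ 𝐠 (lo j p) , 𝐠 (hi j p) ]}
             {λ j → T₃.∑< (suc (length (hi j p))) λ i → 𝐠³ (lo j p) (lo i (hi j p)) (hi i (hi j p))} right-term ⟨
      T₃.∑< (suc n) (λ j → id⊗Δ [ 𝐠 (lo j p) , 𝐠 (hi j p) ])
        ≈⟨ id⊗Δ.∑<-homo (suc n) (λ k → [ 𝐠 (lo k p) , 𝐠 (hi k p) ]) ⟨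
      id⊗Δ (splitting p)
        ≈⟨ id⊗Δ.⟦⟧-cong {Δ (G α)} {splitting p} (Δ-G α) ⟨
      id⊗Δ (Δ (G α)) ∎
      where
      p : Word ℕ
      p = word α

      n : ℕ
      n = length p

      left-term : ∀ {k} → k ℕ.< suc n → Δ⊗id [ 𝐠 (lo k p) , 𝐠 (hi k p) ] F⊗F⊗F.≈ᴹ
        T₃.∑< (suc (length (lo k p))) λ j → 𝐠³ (lo j (lo k p)) (hi j (lo k p)) (hi k p)
      left-term {k} k<n = begin
        attach (𝐠 (hi k p)) (Δ (𝐠 (lo k p))) ++ []
          ≈⟨ F⊗F⊗F.+ᴹ-identityʳ _ ⟩
        attach (𝐠 (hi k p)) (Δ (𝐠 (lo k p)))
          ≈⟨ attach.⟦⟧-cong (𝐠 (hi k p)) {Δ (𝐠 (lo k p))} {splitting (lo k p)} (Δ-𝐠 (lo-isPerm (word-isPerm α) (ℕ.s≤s⁻¹ k<n))) ⟩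
        attach (𝐠 (hi k p)) (splitting (lo k p))
          ≈⟨ attach.∑<-homo (𝐠 (hi k p)) (suc (length (lo k p))) (λ j → [ 𝐠 (lo j (lo k p)) , 𝐠 (hi j (lo k p)) ]) ⟩
        T₃.∑< (suc (length (lo k p))) (λ j → 𝐠³ (lo j (lo k p)) (hi j (lo k p)) (hi k p)) ∎

      right-term : ∀ {j} → j ℕ.< suc n → id⊗Δ [ 𝐠 (lo j p) , 𝐠 (hi j p) ] F⊗F⊗F.≈ᴹ
        T₃.∑< (suc (length (hi j p))) λ i → 𝐠³ (lo j p) (lo i (hi j p)) (hi i (hi j p))
      right-term {j} j<n = begin
        [ 𝐠 (lo j p) , Δ (𝐠 (hi j p)) ]
          ≈⟨ pairʳ.⟦⟧-cong (𝐠 (lo j p)) {Δ (𝐠 (hi j p))} {splitting (hi j p)} (Δ-𝐠 (hi-isPerm (word-isPerm α) (ℕ.s≤s⁻¹ j<n))) ⟩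
        [ 𝐠 (lo j p) , splitting (hi j p) ]
          ≈⟨ pairʳ.∑<-homo (𝐠 (lo j p)) (suc (length (hi j p))) (λ i → [ 𝐠 (lo i (hi j p)) , 𝐠 (hi i (hi j p)) ]) ⟩
        T₃.∑< (suc (length (hi j p))) (λ i → 𝐠³ (lo j p) (lo i (hi j p)) (hi i (hi j p))) ∎

  -- The antipode

  open Convolutions K FQSym _∙_ 𝟙 ∙-linearˡ ∙-linearʳ ∙-assoc ∙-identityˡ ∙-identityʳ using (η; _⊛_; module Inverse)
  open Inverse 𝐠 (F.≈ᴹ-refl {𝟙}) using (inverse; inverseˡ; inverseʳ)

  ε-linear : IsLinear FQSym 𝕂ᴹ ε
  ε-linear = eval-at-linear A []

  antipode : 𝐅 → 𝐅
  antipode = value FQSym (inverse ∘ word)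

  antipode-linear : IsLinear FQSym FQSym antipode
  antipode-linear = extend-linear FQSym inverse

  antipode-𝐠 : ∀ {p} → IsPerm p → antipode (𝐠 p) F.≈ᴹ inverse p
  antipode-𝐠 {p} h = F.≈ᴹ-trans {antipode (𝐠 p)} {inverse (word (toColoredPerm p))} {inverse p}
    (extend-G FQSym inverse (toColoredPerm p)) (F.≈ᴹ-reflexive (cong inverse (word-toColoredPerm-perm h)))

  private
    module Fs = Sums FQSym

    ε𝟙-linear : IsLinear FQSym FQSym (λ f → ε f F.*ₗ 𝟙)
    ε𝟙-linear = mkLinear FQSym FQSym _
      (λ f≈g → F.*ₗ-congʳ {𝟙} (f≈g []))
      (λ f g → F.≈ᴹ-trans {ε (f F.+ᴹ g) F.*ₗ 𝟙} {(ε f + ε g) F.*ₗ 𝟙} {ε f F.*ₗ 𝟙 F.+ᴹ ε g F.*ₗ 𝟙}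
        (F.*ₗ-congʳ {𝟙} (ε.+ᴹ-homo f g)) (F.*ₗ-distribʳ 𝟙 (ε f) (ε g)))
      (λ c f → F.≈ᴹ-trans {ε (c F.*ₗ f) F.*ₗ 𝟙} {(c * ε f) F.*ₗ 𝟙} {c F.*ₗ (ε f F.*ₗ 𝟙)}
        (F.*ₗ-congʳ {𝟙} (ε.*ₗ-homo c f)) (F.*ₗ-assoc c (ε f) 𝟙))
      where module ε = IsLinear {M = FQSym} {N = 𝕂ᴹ} ε-linear

    ε𝟙-G : ∀ α → ε (G α) F.*ₗ 𝟙 F.≈ᴹ η (word α)
    ε𝟙-G α = F.≈ᴹ-trans {ε (G α) F.*ₗ 𝟙} {δ (word α) [] F.*ₗ 𝟙} {η (word α)}
      (F.*ₗ-congʳ {𝟙} (eval-G A α [])) (δη (word α))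
      where
      δη : ∀ p → δ p [] F.*ₗ 𝟙 F.≈ᴹ η p
      δη []      = F.*ₗ-identityˡ 𝟙
      δη (_ ∷ _) = F.*ₗ-zeroˡ 𝟙

    convolve-linear : ∀ {φ ψ} → IsLinear FQSym FQSym φ → IsLinear FQSym FQSym ψ →
                      IsLinear (FQSym ⊗ FQSym) FQSym (lift (λ f g → φ f ∙ ψ g))
    convolve-linear {φ} {ψ} φ-linear ψ-linear = ⊗-lift-linear FQSym FQSym FQSym {B = λ f g → φ f ∙ ψ g}
      (λ g → ∘-linear {L = FQSym} {M = FQSym} {N = FQSym} (∙-linearˡ (ψ g)) φ-linear)
      (λ f → ∘-linear {L = FQSym} {M = FQSym} {N = FQSym} (∙-linearʳ (φ f)) ψ-linear)

    id-linear : IsLinear FQSym FQSym id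
    id-linear = mkLinear FQSym FQSym id (λ f≈g → f≈g) (λ f g → F.≈ᴹ-refl {f F.+ᴹ g}) (λ c f → F.≈ᴹ-refl {c F.*ₗ f})

    -- Serves both antipode laws, with `antipode` and `id` as φ and ψ in either order. By linearity
    -- it suffices to treat generators, where the coproduct is a splitting and the left side becomes
    -- the convolution of φ′ and ψ′.
    convolve : ∀ {φ ψ} → IsLinear FQSym FQSym φ → IsLinear FQSym FQSym ψ → ∀ (φ′ ψ′ : Word ℕ → 𝐅) →
      (∀ {p} → IsPerm p → φ (𝐠 p) F.≈ᴹ φ′ p) → (∀ {p} → IsPerm p → ψ (𝐠 p) F.≈ᴹ ψ′ p) →
      (∀ {p} → IsPerm p → (φ′ ⊛ ψ′) p F.≈ᴹ η p) →
      ∀ f → lift (λ f g → φ f ∙ ψ g) (Δ f) F.≈ᴹ ε f F.*ₗ 𝟙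
    convolve {φ} {ψ} φ-linear ψ-linear φ′ ψ′ φ≈ ψ≈ φ′⊛ψ′≈η = linear-ext (Series A) (𝐆 A) {N = FQSym}
      {φ = λ f → lift (λ f g → φ f ∙ ψ g) (Δ f)} {ψ = λ f → ε f F.*ₗ 𝟙}
      (∘-linear {L = FQSym} {M = FQSym ⊗ FQSym} {N = FQSym} (convolve-linear φ-linear ψ-linear) Δ-linear)
      ε𝟙-linear on-G
      where
      open import Relation.Binary.Reasoning.Setoid F.≈ᴹ-setoid
      module conv = IsLinear {M = FQSym ⊗ FQSym} {N = FQSym} (convolve-linear φ-linear ψ-linear)

      on-G : ∀ α → lift (λ f g → φ f ∙ ψ g) (Δ (G α)) F.≈ᴹ ε (G α) F.*ₗ 𝟙
      on-G α = begin
        lift (λ f g → φ f ∙ ψ g) (Δ (G α))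
          ≈⟨ conv.⟦⟧-cong {Δ (G α)} {splitting p} (Δ-G α) ⟩
        lift (λ f g → φ f ∙ ψ g) (splitting p)
          ≈⟨ conv.∑<-homo (suc (length p)) (λ k → [ 𝐠 (lo k p) , 𝐠 (hi k p) ]) ⟩
        Fs.∑< (suc (length p)) (λ k → φ (𝐠 (lo k p)) ∙ ψ (𝐠 (hi k p)) F.+ᴹ F.0ᴹ)
          ≈⟨ Fs.∑<-cong {suc (length p)} {λ k → φ (𝐠 (lo k p)) ∙ ψ (𝐠 (hi k p)) F.+ᴹ F.0ᴹ} {λ k → φ′ (lo k p) ∙ ψ′ (hi k p)} term ⟩
        (φ′ ⊛ ψ′) p
          ≈⟨ φ′⊛ψ′≈η (word-isPerm α) ⟩
        η p
          ≈⟨ ε𝟙-G α ⟨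
        ε (G α) F.*ₗ 𝟙 ∎
        where
        p : Word ℕ
        p = word α

        term : ∀ {k} → k ℕ.< suc (length p) → φ (𝐠 (lo k p)) ∙ ψ (𝐠 (hi k p)) F.+ᴹ F.0ᴹ F.≈ᴹ φ′ (lo k p) ∙ ψ′ (hi k p)
        term {k} k<n = F.≈ᴹ-trans {φ (𝐠 (lo k p)) ∙ ψ (𝐠 (hi k p)) F.+ᴹ F.0ᴹ} {φ (𝐠 (lo k p)) ∙ ψ (𝐠 (hi k p))} {φ′ (lo k p) ∙ ψ′ (hi k p)}
          (F.+ᴹ-identityʳ (φ (𝐠 (lo k p)) ∙ ψ (𝐠 (hi k p))))
          (∙-cong {φ (𝐠 (lo k p))} {φ′ (lo k p)} {ψ (𝐠 (hi k p))} {ψ′ (hi k p)}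
            (φ≈ (lo-isPerm (word-isPerm α) (ℕ.s≤s⁻¹ k<n))) (ψ≈ (hi-isPerm (word-isPerm α) (ℕ.s≤s⁻¹ k<n))))

  antipodeˡ : ∀ f → lift (λ g h → antipode g ∙ h) (Δ f) F.≈ᴹ ε f F.*ₗ 𝟙
  antipodeˡ = convolve {antipode} {id} antipode-linear id-linear inverse 𝐠 antipode-𝐠 (λ {p} _ → F.≈ᴹ-refl {𝐠 p}) inverseˡ

  antipodeʳ : ∀ f → lift (λ g h → g ∙ antipode h) (Δ f) F.≈ᴹ ε f F.*ₗ 𝟙
  antipodeʳ = convolve {id} {antipode} id-linear antipode-linear 𝐠 inverse (λ {p} _ → F.≈ᴹ-refl {𝐠 p}) antipode-𝐠 inverseʳ

  isAlgebra : IsAlgebra H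
  isAlgebra = record
    { isRing = record
      { +-isAbelianGroup = F.+ᴹ-isAbelianGroup
      ; *-cong           = λ {f} {f′} {g} {g′} → ∙-cong {f} {f′} {g} {g′}
      ; *-assoc          = ∙-assoc
      ; *-identity       = ∙-identityˡ , ∙-identityʳ
      ; distrib          = (λ f → IsLinear.+ᴹ-homo {M = FQSym} {N = FQSym} (∙-linearʳ f))
                         , (λ f → IsLinear.+ᴹ-homo {M = FQSym} {N = FQSym} (∙-linearˡ f))
      }
    ; *ₗ-∙-assoc = λ c f g → IsLinear.*ₗ-homo {M = FQSym} {N = FQSym} (∙-linearˡ g) c f
    ; ∙-*ₗ-comm  = λ c f g → IsLinear.*ₗ-homo {M = FQSym} {N = FQSym} (∙-linearʳ f) c g
    }

  isCoalgebra : IsCoalgebra H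
  isCoalgebra = record
    { Δ-linear      = Δ-linear
    ; ε-linear      = ε-linear
    ; coassociative = coassociative
    ; counitalˡ     = counitalˡ
    ; counitalʳ     = counitalʳ
    }

  isBialgebra : IsBialgebra H
  isBialgebra = record
    { isAlgebra   = isAlgebra
    ; isCoalgebra = isCoalgebra
    ; Δ-∙-homo    = Δ-∙-homo
    ; Δ-𝟙-homo    = Δ-𝟙-homo
    ; ε-∙-homo    = λ f g → ∙-eval A f g []
    ; ε-𝟙-homo    = 𝟙-eval []
    }

  isHopfAlgebra : IsHopfAlgebra H
  isHopfAlgebra = record
    { isBialgebra = isBialgebra
    ; S           = antipode
    ; S-linear    = antipode-linear
    ; antipodeˡ   = antipodeˡ
    ; antipodeʳ   = antipodeʳ
    }

  -- Grading and connectedness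

  degree-isSubmodule : ∀ n → IsSubmodule FQSym (Degree n)
  degree-isSubmodule n = record
    { resp-≈ = λ {f} {f′} f≈f′ (g , sizes , f≈g) → g , sizes , λ w → K.trans (K.sym (f≈f′ w)) (f≈g w)
    ; 0-∈    = [] , [] , λ w → K.refl
    ; +-∈    = λ {f} {g} df dg → degree-from-eval (f F.+ᴹ g) λ w ∣w∣≢n → K.trans (eval-at.+ᴹ-homo w f g)
        (K.trans (+-cong (eval-degree f df w ∣w∣≢n) (eval-degree g dg w ∣w∣≢n)) (K.+-identityˡ 0#))
    ; *ₗ-∈   = λ c {f} df → degree-from-eval (c F.*ₗ f) λ w ∣w∣≢n → K.trans (eval-at.*ₗ-homo w c f)
        (K.trans (*-congˡ (eval-degree f df w ∣w∣≢n)) (K.zeroʳ c))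
    }

  isGrading : IsGrading FQSym Degree
  isGrading = record
    { isSubmodule = degree-isSubmodule
    ; spanning    = λ f → suc (degree f) , (λ n → homogeneousPart n (f ⟨ A ⟩))
        , (λ n → homogeneousPart n (f ⟨ A ⟩) , homogeneousPart-sizes n (f ⟨ A ⟩) , λ w → K.refl)
        , λ w → K.trans (eval-std A f w) (K.sym (assemble-eval (suc (degree f)) (f ⟨ A ⟩) A w
            λ d<∣w∣ → eval-above-degree f (std A w) (subst (degree f ℕ.<_) (≡.sym (length-std A w)) d<∣w∣)))
    ; independent = independent
    }
    where
    -- A word of length n sees only the summand `f n`, as the other summands vanish on it.
    independent : ∀ N (f : ℕ → 𝐅) → (∀ n → Degree n (f n)) → ∑ FQSym (map f (upTo N)) F.≈ᴹ F.0ᴹ →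
                  ∀ n → n ℕ.< N → f n F.≈ᴹ F.0ᴹ
    independent N f df ∑f≈0 n n<N w with length w ℕ.≟ n
    ... | no  ∣w∣≢n = eval-degree (f n) (df n) w ∣w∣≢n
    ... | yes ∣w∣≡n = begin
      (f n ⟨ A ⟩) w
        ≈⟨ S.∑<-single {f = λ m → (f m ⟨ A ⟩) w} n<N (λ {m} _ m≢n → eval-degree (f m) (df m) w λ ∣w∣≡m → m≢n (≡.trans (≡.sym ∣w∣≡m) ∣w∣≡n)) ⟨
      S.∑< N (λ m → (f m ⟨ A ⟩) w)
        ≈⟨ eval-at.∑<-homo w N f ⟨
      (∑ FQSym (applyUpTo f N) ⟨ A ⟩) w
        ≡⟨ cong (λ fs → (∑ FQSym fs ⟨ A ⟩) w) (List.map-upTo f N) ⟨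
      (∑ FQSym (map f (upTo N)) ⟨ A ⟩) w
        ≈⟨ ∑f≈0 w ⟩
      0# ∎
      where open import Relation.Binary.Reasoning.Setoid K.setoid

  ∙-graded : ∀ {i j f g} → Degree i f → Degree j g → Degree (i ℕ.+ j) (f ∙ g)
  ∙-graded {i} {j} {f} {g} df dg = degree-from-eval (f ∙ g) λ w ∣w∣≢i+j → K.trans (∙-eval A f g w)
    (cutSum-0 (λ u v → (f ⟨ A ⟩) u * (g ⟨ A ⟩) v) w λ u v ∣u∣+∣v∣≡∣w∣ → vanish u v λ ∣u∣+∣v∣≡i+j → ∣w∣≢i+j (≡.trans (≡.sym ∣u∣+∣v∣≡∣w∣) ∣u∣+∣v∣≡i+j))
    where
    vanish : ∀ u v → length u ℕ.+ length v ≢ i ℕ.+ j → (f ⟨ A ⟩) u * (g ⟨ A ⟩) v ≈ᴷ 0#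
    vanish u v ≢i+j with length u ℕ.≟ i
    ... | no  ∣u∣≢i = K.trans (*-congʳ (eval-degree f df u ∣u∣≢i)) (K.zeroˡ _)
    ... | yes ∣u∣≡i = K.trans (*-congˡ (eval-degree g dg v λ ∣v∣≡j → ≢i+j (cong₂ ℕ._+_ ∣u∣≡i ∣v∣≡j))) (K.zeroʳ _)

  Bidegree : ℕ → 𝐅 × 𝐅 → Set _
  Bidegree n (f , g) = ∃[ i ] ∃[ j ] i ℕ.+ j ≡ n × Degree i f × Degree j g

  -- Stated for a list whose entries all have size n, because Δ is computed entry by entry; a
  -- general element of degree n is first replaced by such a representative.
  Δ-bidegree : ∀ {n} f → All (λ (_ , α) → size α ≡ n) f → All (Bidegree n) (Δ f)
  Δ-bidegree     []            []             = []
  Δ-bidegree {n} ((c , α) ∷ f) (refl ∷ sizes) = All.++⁺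
    (All.map⁺ (All.concat⁺ (All.applyUpTo⁺₁ (λ k → [ 𝐠 (lo k p) , 𝐠 (hi k p) ]) (suc (length p)) λ k<n → entry (ℕ.s≤s⁻¹ k<n) ∷ [])))
    (Δ-bidegree f sizes)
    where
    p : Word ℕ
    p = word α

    monomial-degree : ∀ d q → Degree (length q) [ d , toColoredPerm q ]
    monomial-degree d q = [ d , toColoredPerm q ] , refl ∷ [] , λ w → K.refl

    entry : ∀ {k} → k ℕ.≤ length p → Bidegree n (c F.*ₗ 𝐠 (lo k p) , 𝐠 (hi k p))
    entry {k} k≤n = length (lo k p) , length (hi k p)
      , ≡.trans (cong₂ ℕ._+_ (length-lo (word-isPerm α) k≤n) (length-hi (word-isPerm α) k≤n)) (≡.trans (ℕ.m+[n∸m]≡n k≤n) (length-word α))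
      , monomial-degree (c * 1#) (lo k p) , monomial-degree 1# (hi k p)

  isGradedBialgebra : IsGradedBialgebra H Degree
  isGradedBialgebra = record
    { isBialgebra = isBialgebra
    ; isGrading   = isGrading
    ; ∙-graded    = λ {i} {j} {f} {g} → ∙-graded {i} {j} {f} {g}
    ; 𝟙-graded    = 𝟙 , refl ∷ [] , λ w → K.refl
    ; Δ-graded    = λ {n} {f} (g , sizes , f≈g) → Δ g
        , IsLinear.⟦⟧-cong {M = FQSym} {N = FQSym ⊗ FQSym} Δ-linear {f} {g} f≈g , Δ-bidegree g sizes
    ; ε-graded    = λ {n} {f} df n≢0 → eval-degree f df [] (n≢0 ∘ ≡.sym)
    }

  isConnected : IsConnected H Degree
  isConnected = record
    { unit-surjective = λ {f} df → (f ⟨ A ⟩) [] , scalar f df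
    ; unit-injective  = λ {c} {d} c𝟙≈d𝟙 → K.trans (K.sym (at-[] c)) (K.trans (c𝟙≈d𝟙 []) (at-[] d))
    }
    where
    at-[] : ∀ c → ((c F.*ₗ 𝟙) ⟨ A ⟩) [] ≈ᴷ c
    at-[] c = K.trans (eval-at.*ₗ-homo [] c 𝟙) (K.trans (*-congˡ (𝟙-eval [])) (K.*-identityʳ c))

    scalar : ∀ f → Degree 0 f → f F.≈ᴹ (f ⟨ A ⟩) [] F.*ₗ 𝟙
    scalar f df []      = K.sym (at-[] ((f ⟨ A ⟩) []))
    scalar f df (a ∷ w) = K.trans (eval-degree f df (a ∷ w) λ ()) (K.sym (K.trans (eval-at.*ₗ-homo (a ∷ w) ((f ⟨ A ⟩) []) 𝟙)
      (K.trans (*-congˡ (𝟙-eval (a ∷ w))) (K.zeroʳ _))))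

  -- The coproduct as a sum over pairs of colored permutations

  halves : ColoredPerm → ℕ → ColoredPerm × ColoredPerm
  halves γ k = toColoredPerm (lo k (word γ)) , toColoredPerm (hi k (word γ))

  allHalves : ColoredPerm → List (ColoredPerm × ColoredPerm)
  allHalves γ = applyUpTo (halves γ) (suc (length (word γ)))

  private
    _≈²_ : ColoredPerm × ColoredPerm → ColoredPerm × ColoredPerm → Set
    (α , β) ≈² (α′ , β′) = word α ≡ word α′ × word β ≡ word β′

  word-halves : ∀ γ {k} → k ℕ.< suc (length (word γ)) →
    word (proj₁ (halves γ k)) ≡ lo k (word γ) × word (proj₂ (halves γ k)) ≡ hi k (word γ)
  word-halves γ k<n = word-toColoredPerm-perm (lo-isPerm (word-isPerm γ) (ℕ.s≤s⁻¹ k<n))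
                    , word-toColoredPerm-perm (hi-isPerm (word-isPerm γ) (ℕ.s≤s⁻¹ k<n))

  -- The first half at k has length k, so different cuts give different pairs; a pair whose shifted
  -- shuffle contains γ is the cut at the size of its first member.
  allHalves-enumerates : ∀ γ → Enumerates (×-setoid ColoredPerms ColoredPerms) (λ (α , β) → word γ ∈ α ⋓ β) (allHalves γ)
  allHalves-enumerates γ = record
    { unique   = SetoidUnique.applyUpTo⁺₁ (×-setoid ColoredPerms ColoredPerms) (halves γ) (suc (length p)) distinct
    ; complete = λ (α , β) → mk⇔ (∈⇒half α β) (half⇒∈ α β)
    }
    where
    p : Word ℕ
    p = word γ

    length-first : ∀ {k} → k ℕ.< suc (length p) → length (word (proj₁ (halves γ k))) ≡ k
    length-first k<n = ≡.trans (cong length (proj₁ (word-halves γ k<n))) (length-lo (word-isPerm γ) (ℕ.s≤s⁻¹ k<n))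

    distinct : ∀ {i j} → i ℕ.< j → j ℕ.< suc (length p) → ¬ halves γ i ≈² halves γ j
    distinct i<j j<n (lo≡ , _) = ℕ.<⇒≢ i<j
      (≡.trans (≡.sym (length-first (ℕ.<-trans i<j j<n))) (≡.trans (cong length lo≡) (length-first j<n)))

    shuffles-size : ∀ α β → shuffles (word α) (shift (length (word α)) (word β)) ≡ α ⋓ β
    shuffles-size α β = cong (λ n → shuffles (word α) (shift n (word β))) (length-word α)

    ∈⇒half : ∀ α β → p ∈ α ⋓ β → Any ((α , β) ≈²_) (allHalves γ)
    ∈⇒half α β p∈ with k≤n , lo≡ , hi≡ ← Equivalence.to (∈-shifted-shuffles (word-isPerm α)) (subst (p ∈_) (≡.sym (shuffles-size α β)) p∈) =
      let eqˡ , eqʳ = word-halves γ (s≤s k≤n) in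
      Any.applyUpTo⁺ (halves γ) (≡.sym (≡.trans eqˡ lo≡) , ≡.sym (≡.trans eqʳ hi≡)) (s≤s k≤n)

    half⇒∈ : ∀ α β → Any ((α , β) ≈²_) (allHalves γ) → p ∈ α ⋓ β
    half⇒∈ α β αβ∈ with k , k<n , α≡ , β≡ ← Any.applyUpTo⁻ (halves γ) αβ∈ =
      subst (p ∈_) (shuffles-size α β) (Equivalence.from (∈-shifted-shuffles (word-isPerm α))
        ( subst (ℕ._≤ length p) (≡.sym ∣α∣≡k) (ℕ.s≤s⁻¹ k<n)
        , ≡.trans (cong (λ n → lo n p) ∣α∣≡k) (≡.sym (≡.trans α≡ (proj₁ (word-halves γ k<n))))
        , ≡.trans (cong (λ n → hi n p) ∣α∣≡k) (≡.sym (≡.trans β≡ (proj₂ (word-halves γ k<n))))))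
      where
      ∣α∣≡k : length (word α) ≡ k
      ∣α∣≡k = ≡.trans (cong length α≡) (length-first k<n)

  coproduct-formula : ∀ γ → Δ (G γ) F⊗F.≈ᴹ ∑ (FQSym ⊗ FQSym) (map (λ (α , β) → [ G α , G β ]) (allHalves γ))
  coproduct-formula γ = F⊗F.≈ᴹ-trans (Δ-G γ) (F⊗F.≈ᴹ-reflexive
    (cong (∑ (FQSym ⊗ FQSym)) (≡.sym (List.map-applyUpTo (halves γ) (λ (α , β) → [ G α , G β ]) (suc (length (word γ)))))))

  ∙-⋆ : ∀ f g w → ((f ∙ g) ⟨ A ⟩) w ≈ᴷ (f ⟨ A ⟩ ⋆ g ⟨ A ⟩) w
  ∙-⋆ f g w = K.trans (∙-eval A f g w) (K.sym (K.trans
    (K.reflexive (cong (λ us → ∑ᴷ (zipWith (λ u v → (f ⟨ A ⟩) u * (g ⟨ A ⟩) v) us (tails w))) (≡.sym (List.map-id (inits w)))))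
    (∑ᴷ-inits-tails (λ u v → (f ⟨ A ⟩) u * (g ⟨ A ⟩) v) id w)))

theorem3p3 : ∀ {k ℓk : Level} (K : CommutativeRing k ℓk) (ℓ : ℕ) →
    let open CommutativeRing K using () renaming (_≈_ to _≈ᴷ_)
        open LinearAlgebra K
        open FreeQuasiSymmetric K ℓ
        open LeftModule (FQSym ⊗ FQSym) using () renaming (_≈ᴹ_ to _≈⊗_)
    in
    Σ[ H ∈ RawBialgebra FQSym ]
    let open RawBialgebra H in
    (∀ f g w → ((f ∙ g) ⟨ A ⟩) w ≈ᴷ (f ⟨ A ⟩ ⋆ g ⟨ A ⟩) w)
    × (∀ w → (𝟙 ⟨ A ⟩) w ≈ᴷ one w)
    × (∀ f w → identify (Δ f) w ≈ᴷ commuting (f ⟨ A′⊕A″ ⟩) w)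
    × IsGradedBialgebra H Degree
    × IsConnected H Degree
    × IsHopfAlgebra H
    × (∀ γ → ∃[ αβs ]
        Enumerates (×-setoid ColoredPerms ColoredPerms) (λ (α , β) → word γ ∈ α ⋓ β) αβs
        × Δ (G γ) ≈⊗ ∑ (FQSym ⊗ FQSym) (map (λ (α , β) → [ G α , G β ]) αβs))
theorem3p3 K ℓ = H , ∙-⋆ , 𝟙-eval , identify-Δ , isGradedBialgebra , isConnected , isHopfAlgebra
  , λ γ → allHalves γ , allHalves-enumerates γ , coproduct-formula γ
  where open Hopf K ℓ
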